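{- Let $\alpha\ge 16$ be an integer. For every input string $T$ of length $n$ as in the context, the r-comp algorithm with parameter $\alpha$ (which computes the RLBWT of $T$) uses $O(r\log n)$ bits of working space, where $r$ is the number of runs in the BWT $L_n$ of $T$.
   Context: Model: unit-cost word RAM with word size $\Theta(\log n)$ bits. Strings and BWT. $T$ is a string of length $n$ over an ordered alphabet $\Sigma=\{1,\dots,n^{O(1)}\}$ whose smallest character $\$$ occurs in $T$ exactly once, at position $n$. For $1\le\delta\le n$ let $T_\delta=T[n-\delta+1..n]$, and let $x_1,\dots,x_\delta$ be the permutation of $1,\dots,\delta$ with $T_\delta[x_1..\delta]\prec\cdots\prec T_\delta[x_\delta..\delta]$ (lexicographic order). The BWT of $T_\delta$ is $L_\delta$ with $L_\delta[m]=T_\delta[x_m-1]$, where $T_\delta[0]:=\$$; and $F_\delta[m]=T_\delta[x_m]$. $\mathrm{LF}_\delta$ is the bijection of $\{1,\dots,\delta\}$ with $\mathrm{LF}_\delta(a)=b$ iff $x_a-1=x_b$, or $x_a=1$ and $x_b=\delta$. A run is a maximal block of equal characters; if $L_n=P_1P_2\cdots P_r$ is the decomposition into runs, the RLBWT of $T$ is $(P_1[1],|P_1|),\dots,(P_r[1],|P_r|)$. DBWT. A DBWT $D$ of $L_\delta$ is a sequence $L_\delta[p_1..p_2-1],\dots,L_\delta[p_k..p_{k+1}-1]$ with $p_1=1<p_2<\cdots<p_k<p_{k+1}=\delta+1$, each piece (a DBWT-repetition) being a power of a single character. The F-interval of the $i$-th repetition is $[\mathrm{LF}_\delta(p_i),\mathrm{LF}_\delta(p_{i+1}-1)]$.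 Repetition $i$ covers $\mathrm{LF}_\delta(p_j)$ if $\mathrm{LF}_\delta(p_j)\in[p_i,p_{i+1}-1]$; F-interval $i$ covers $p_j$ if $p_j\in[\mathrm{LF}_\delta(p_i),\mathrm{LF}_\delta(p_{i+1}-1)]$. A repetition is $\alpha$-heavy if it covers at least $\alpha$ starting positions of F-intervals; an F-interval is $\alpha$-heavy if it covers at least $\alpha$ starting positions of repetitions. $D$ is $\alpha$-balanced if it has no $\alpha$-heavy repetition and no $\alpha$-heavy F-interval. Data structure. The LF-interval graph of $D$ has nodes $u_1,\dots,u_k$ (repetitions) and $v_1,\dots,v_k$ (F-intervals), each labelled by its character and length; undirected edges $(u_i,v_i)$; a directed edge $(u_i,v_j)$ labelled $p_i-\mathrm{LF}_\delta(p_j)$ whenever F-interval $j$ covers $p_i$; and a directed edge $(v_j,u_i)$ labelled $\mathrm{LF}_\delta(p_j)-p_i$ whenever repetition $i$ covers $\mathrm{LF}_\delta(p_j)$. It is stored with two doubly linked lists (the $u_i$ in order of $i$, the $v_i$ in order of $\mathrm{LF}_\delta(p_i)$), an order-maintenance structure on the $u_i$ ($O(1)$-time comparison, insertion, deletion), two arrays listing the nodes of $\alpha$-heavy repetitions and of $\alpha$-heavy F-intervals, and a B-tree whose keys are pairs $(u_g,L_\delta[p_g])$, compared first by character and then by $g$. The B-tree stores those $v_g$ for which one of the following holds (a non-existing following repetition counts as having a character different from all others): (a) repetitions $g$ and $g+1$ have different characters and repetition $g+1$ is not $\$$; (b) repetition $g+1$ is $\$$ and repetitions $g$ and $g+2$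 have different characters; (c) repetition $g$ is $\$$. Algorithm r-comp. It reads $T[n],T[n-1],\dots,T[1]$ one character at a time and maintains the stored LF-interval graph of a DBWT, starting with the one-piece DBWT $\$$ of $L_1$. For $\delta=1,\dots,n-1$, given the $\alpha$-balanced DBWT $D$ of $L_\delta$, let $c=T[n-\delta]$, let $\mathrm{rep}$ be the position of $\$$ in $L_\delta$, and let $\mathrm{ins}=1+\#\{m:L_\delta[m]<c\}+\#\{m\le\mathrm{rep}:L_\delta[m]=c\}$. (1) Update: replace the one-letter repetition $\$$ by the one-letter repetition $c$; if some repetition has $p_j<\mathrm{ins}<p_{j+1}$, split it into pieces of lengths $\mathrm{ins}-p_j$ and $p_{j+1}-\mathrm{ins}$; insert a one-letter repetition $\$$ so that it occupies position $\mathrm{ins}$. This gives a DBWT of $L_{\delta+1}$. The insertion position of the new F-interval among the $v$'s is found with the B-tree if neither repetition adjacent to $\$$ in $D$ has character $c$, and otherwise directly from an adjacent repetition with character $c$. (2) If at least one repetition adjacent to $\$$ in $D$ has character $c$ (fast update), merge: let $w$ be the new one-letter repetition $c$ and consider its left and right neighbours after step (1). If only the left one has character $c$, merge it with $w$; if only the right one does, merge $w$ with it; if both do, merge all three when the previous update (from $L_{\delta-1}$ to $L_\delta$) split a repetition in its step (1), and otherwise merge only the left neighbour with $w$. (3) Balancing: while the DBWT (with positions $p_1,\dots,p_{k+1}$ in $L_{\delta+1}$) is not $\alpha$-balanced, pick $i$ such that repetition $i$ or F-interval $i$ is $\alpha$-heavy. If repetition $i$ is $\alpha$-heavy, let $s_1<\dots<s_t$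 be the F-interval starting positions it covers and $\ell=s_{\lceil t/2\rceil+1}-p_i$; otherwise let $q_1<\dots<q_t$ be the repetition starting positions covered by F-interval $i$ and $\ell=q_{\lceil t/2\rceil+1}-\mathrm{LF}_{\delta+1}(p_i)$. Split repetition $i$ into pieces of lengths $\ell$ and $p_{i+1}-p_i-\ell$. The stored graph and auxiliary structures are updated locally after each change. After the last step, adjacent equal-letter repetitions are merged and the RLBWT of $T$ is output. -}

module Defs where

open import Data.Bool.Base using (Bool; true; false; if_then_else_; _∧_; _∨_)
open import Data.Fin.Base using (Fin; toℕ)
open import Data.Nat.Properties using (_≟_; _≤?_; _<?_; ≤-decTotalOrder)
open import Data.List.Base using (List; []; _∷_; _++_; map; concatMap; drop; take; filter; length; upTo; derun)
open import Data.List.Membership.Propositional using (_∈_)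
import Data.List.Relation.Binary.Lex.NonStrict as Lex
open import Data.List.Relation.Binary.Permutation.Propositional using (_↭_)
open import Data.List.Relation.Unary.All using (All)
open import Data.List.Relation.Unary.Linked using (Linked)
open import Data.List.Sort (Lex.≤-decTotalOrder ≤-decTotalOrder) using () renaming (sort to sortStrings)
open import Data.List.Sort ≤-decTotalOrder using () renaming (sort to sortNumbers)
open import Data.Maybe.Base using (Maybe; just; nothing)
import Data.Maybe.Properties as Maybe
open import Data.Nat.Base using (ℕ; zero; suc; _+_; _*_; _∸_; _^_; _⊓_; _≤_; _<_; _≤ᵇ_; _<ᵇ_; _≡ᵇ_; ⌈_/2⌉; NonZero)
open import Data.Nat.DivMod using (_/_)
open import Data.Nat.ListAction using (sum)
open import Data.Nat.Logarithm using (⌊log₂_⌋)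
open import Data.Product.Base using (∃-syntax; _×_; _,_; proj₁; proj₂)
open import Data.Sum.Base using (_⊎_)
open import Data.Vec.Base using (Vec; toList; lookup)
open import Function.Base using (_∘_)
open import Function.Bundles using (_⇔_)
open import Relation.Binary.PropositionalEquality.Core using (_≡_; _≢_)
open import Relation.Nullary.Decidable.Core using (Dec; ¬?; _×-dec_; _⊎-dec_)
open import Relation.Nullary.Negation.Core using (¬_)

-- Positions in strings, in BWTs and in lists of repetitions start at 1.

Char : Set
Char = ℕ

$ : Char
$ = 1

Text : ℕ → Set
Text n = Vec Char n

-- The alphabet is {1, …, σ} for some σ ≤ n ^ d.
record IsInput (d n : ℕ) (T : Text n) : Set where
  field
    inAlphabet : ∀ i → 1 ≤ lookup T i × lookup T i ≤ n ^ d
    $-last     : ∀ i → lookup T i ≡ $ ⇔ suc (toℕ i) ≡ n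

-- at e xs i is xs[i], and e when i is not a position of xs.
at : ℕ → List ℕ → ℕ → ℕ
at e xs       zero          = e
at e []       (suc i)       = e
at e (x ∷ xs) (suc zero)    = x
at e (x ∷ xs) (suc (suc i)) = at e xs (suc i)

-- The first position of y, which is assumed to occur.
positionOf : ℕ → List ℕ → ℕ
positionOf y []       = 1
positionOf y (x ∷ xs) = if x ≡ᵇ y then 1 else suc (positionOf y xs)

module _ {n : ℕ} (T : Text n) where

  -- T_δ
  suffix : ℕ → List Char
  suffix δ = drop (n ∸ δ) (toList T)

  -- x_1, …, x_δ: the suffixes of T_δ are sorted as strings, and a suffix
  -- of length m starts at position δ + 1 - m.
  suffixArray : ℕ → List ℕ
  suffixArray δ = map (λ s → suc δ ∸ length s) (sortStrings (map (λ i → drop i (suffix δ)) (upTo δ)))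

  -- L_δ; the first argument of at realises T_δ[0] := $.
  bwt : ℕ → List Char
  bwt δ = map (λ x → at $ (suffix δ) (x ∸ 1)) (suffixArray δ)

  LF : ℕ → ℕ → ℕ
  LF δ a = positionOf (if x ≡ᵇ 1 then δ else x ∸ 1) (suffixArray δ)
    where
    x : ℕ
    x = at 0 (suffixArray δ) a

  -- r: derun keeps one letter of every maximal block of equal letters.
  runs : ℕ
  runs = length (derun _≟_ (bwt n))

record Repetition : Set where
  constructor _^^_
  field
    char : Char
    len  : ℕ
open Repetition public

-- A DBWT in run-length form; the string it factorises is the
-- concatenation of its repetitions.
DBWT : Set
DBWT = List Repetition

record Piece : Set where
  field
    index : ℕ
    start : ℕ
    rep   : Repetition
open Piece public

pieces : DBWT → List Piece
pieces = go 1 1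
  where
  go : ℕ → ℕ → DBWT → List Piece
  go i p []      = []
  go i p (R ∷ D) = record { index = i ; start = p ; rep = R } ∷ go (suc i) (p + len R) D

end : Piece → ℕ
end P = start P + len (rep P) ∸ 1

module _ {n : ℕ} (T : Text n) (δ : ℕ) where

  F-start F-end : Piece → ℕ
  F-start P = LF T δ (start P)
  F-end   P = LF T δ (end P)

  RepCovers : Piece → Piece → Set
  RepCovers P Q = start P ≤ F-start Q × F-start Q ≤ end P

  F-Covers : Piece → Piece → Set
  F-Covers P Q = F-start P ≤ start Q × start Q ≤ F-end P

  repCovers? : ∀ P Q → Dec (RepCovers P Q)
  repCovers? P Q = (start P ≤? F-start Q) ×-dec (F-start Q ≤? end P)

  F-covers? : ∀ P Q → Dec (F-Covers P Q)
  F-covers? P Q = (F-start P ≤? start Q) ×-dec (start Q ≤? F-end P)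

  module _ (D : DBWT) where

    coveredByRep : Piece → List ℕ
    coveredByRep P = sortNumbers (map F-start (filter (repCovers? P) (pieces D)))

    -- In increasing order, since pieces D is.
    coveredByF : Piece → List ℕ
    coveredByF P = map start (filter (F-covers? P) (pieces D))

    module _ (α : ℕ) where

      HeavyRep HeavyF : Piece → Set
      HeavyRep P = α ≤ length (coveredByRep P)
      HeavyF   P = α ≤ length (coveredByF P)

      heavyRep? : ∀ P → Dec (HeavyRep P)
      heavyRep? P = α ≤? length (coveredByRep P)

      heavyF? : ∀ P → Dec (HeavyF P)
      heavyF? P = α ≤? length (coveredByF P)

      Balanced : Set
      Balanced = All (λ P → ¬ HeavyRep P × ¬ HeavyF P) (pieces D)

      -- The piece is cut just before covered position number ⌈t/2⌉ + 1 of t.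
      cutLength : Piece → ℕ
      cutLength P = if α ≤ᵇ length (coveredByRep P)
                    then middle (coveredByRep P) ∸ start P
                    else middle (coveredByF P) ∸ F-start P
        where
        middle : List ℕ → ℕ
        middle s = at 0 s (⌈ length s /2⌉ + 1)

-- cut i ℓ D splits repetition i of D after ℓ letters.
cut : ℕ → ℕ → DBWT → DBWT
cut i             ℓ []      = []
cut zero          ℓ (R ∷ D) = R ∷ D
cut (suc zero)    ℓ (R ∷ D) = (char R ^^ ℓ) ∷ (char R ^^ (len R ∸ ℓ)) ∷ D
cut (suc (suc i)) ℓ (R ∷ D) = R ∷ cut (suc i) ℓ D

replace$ : Char → DBWT → DBWT
replace$ c = map (λ R → if char R ≡ᵇ $ then c ^^ 1 else R)

-- insert$ m D puts the repetition $ after the first m letters of D,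
-- splitting the repetition that has letter m and letter m + 1, if any.
insert$ : ℕ → DBWT → DBWT
insert$ zero    D       = ($ ^^ 1) ∷ D
insert$ (suc m) []      = ($ ^^ 1) ∷ []
insert$ (suc m) (R ∷ D) =
  if len R ≤ᵇ suc m
  then R ∷ insert$ (suc m ∸ len R) D
  else (char R ^^ suc m) ∷ ($ ^^ 1) ∷ (char R ^^ (len R ∸ suc m)) ∷ D

insert$Splits : ℕ → DBWT → Bool
insert$Splits zero    D       = false
insert$Splits (suc m) []      = false
insert$Splits (suc m) (R ∷ D) =
  if len R ≤ᵇ suc m then insert$Splits (suc m ∸ len R) D else true

-- Some repetition adjacent to $ has character c.
adjacentTo$ : Char → DBWT → Bool
adjacentTo$ c (Q ∷ R ∷ D) =
  ((char Q ≡ᵇ $) ∧ (char R ≡ᵇ c)) ∨ ((char Q ≡ᵇ c) ∧ (char R ≡ᵇ $)) ∨ adjacentTo$ c (R ∷ D)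
adjacentTo$ c _ = false

_⊕_ : Repetition → Repetition → Repetition
Q ⊕ R = char Q ^^ (len Q + len R)

mergeRight : Repetition → DBWT → DBWT
mergeRight W []      = W ∷ []
mergeRight W (R ∷ D) = if char R ≡ᵇ char W then (W ⊕ R) ∷ D else W ∷ R ∷ D

-- mergeAt all m D merges the repetition that follows the first m letters of D
-- with its neighbours of the same character; if there are two of them, the
-- right one takes part only if all is true.
mergeAt : Bool → ℕ → DBWT → DBWT
mergeAt all m       []          = []
mergeAt all zero    (W ∷ D)     = mergeRight W D
mergeAt all (suc m) (Q ∷ [])    = Q ∷ []
mergeAt all (suc m) (Q ∷ W ∷ D) =
  if len Q ≤ᵇ m then Q ∷ mergeAt all (suc m ∸ len Q) (W ∷ D)
  else if char Q ≡ᵇ char W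
       then (if all then mergeRight (Q ⊕ W) D else (Q ⊕ W) ∷ D)
       else Q ∷ mergeRight W D

module _ {n : ℕ} (T : Text n) (δ : ℕ) where

  nextChar : Char
  nextChar = at $ (toList T) (n ∸ δ)

  rep$ : ℕ
  rep$ = positionOf $ (bwt T δ)

  ins : ℕ
  ins = 1 + length (filter (_<? nextChar) (bwt T δ))
          + length (filter (_≟ nextChar) (take rep$ (bwt T δ)))

  update : DBWT → DBWT
  update D = insert$ (ins ∸ 1) (replace$ nextChar D)

  updateSplits : DBWT → Bool
  updateSplits D = insert$Splits (ins ∸ 1) (replace$ nextChar D)

  -- The new repetition w = c has moved one position to the right if $ was put before it.
  fastMerge : (previousSplit : Bool) → DBWT → DBWT
  fastMerge previousSplit D =
    if adjacentTo$ nextChar D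
    then mergeAt previousSplit (if rep$ <ᵇ ins then rep$ ∸ 1 else rep$) (update D)
    else update D

data Phase : Set where
  inserted  : Phase  -- $ was inserted, and a fast update has not merged yet
  balancing : Phase
  finishing : Phase  -- L_n is complete, equal neighbours are being merged

-- Reached α T φ δ D s: some execution of r-comp with parameter α on T comes
-- to hold, in phase φ, the DBWT D of L_δ. The bit s tells whether the update
-- from L_(δ-1) split a repetition when it inserted $.
data Reached (α : ℕ) {n : ℕ} (T : Text n) : Phase → ℕ → DBWT → Bool → Set where
  initial : Reached α T balancing 1 (($ ^^ 1) ∷ []) false
  insert  : ∀ {δ D s} → δ < n → Reached α T balancing δ D s → Balanced T δ D α →
            Reached α T inserted (suc δ) (update T δ D) (updateSplits T δ D)
  merge   : ∀ {δ D s} → δ < n → Reached α T balancing δ D s → Balanced T δ D α →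
            Reached α T balancing (suc δ) (fastMerge T δ s D) (updateSplits T δ D)
  balance : ∀ {δ D s P} → Reached α T balancing δ D s →
            P ∈ pieces D → HeavyRep T δ D α P ⊎ HeavyF T δ D α P →
            Reached α T balancing δ (cut (index P) (cutLength T δ D α P) D) s
  finish  : ∀ {D s} → Reached α T balancing n D s → Balanced T n D α →
            Reached α T finishing n D s
  join    : ∀ {D Q R E s} → Reached α T finishing n (D ++ Q ∷ R ∷ E) s → char Q ≡ char R →
            Reached α T finishing n (D ++ (Q ⊕ R) ∷ E) s

data Node : Set where
  u v : ℕ → Node

record DirectedEdge : Set where
  field
    source target : Node
    label         : ℕ
open DirectedEdge public

record Graph : Set where
  field
    nodes      : List (Node × Repetition)
    undirected : List (Node × Node)
    directed   : List DirectedEdge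
open Graph public

LF-intervalGraph : ∀ {n} → Text n → ℕ → DBWT → Graph
LF-intervalGraph T δ D = record
  { nodes      = map (λ P → u (index P) , rep P) (pieces D) ++ map (λ P → v (index P) , rep P) (pieces D)
  ; undirected = map (λ P → u (index P) , v (index P)) (pieces D)
  ; directed   = concatMap (λ Q → map (λ P → record
                     { source = u (index P) ; target = v (index Q) ; label = start P ∸ F-start T δ Q })
                     (filter (F-covers? T δ Q) (pieces D))) (pieces D)
              ++ concatMap (λ P → map (λ Q → record
                     { source = v (index Q) ; target = u (index P) ; label = F-start T δ Q ∸ start P })
                     (filter (repCovers? T δ P) (pieces D))) (pieces D)
  }

-- Trees of height h. An inner node with keys k_1, …, k_m and children
-- t_0, …, t_m is node t_0 ((k_1 , t_1) ∷ … ∷ (k_m , t_m) ∷ []).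
data BTree (A : Set) : ℕ → Set where
  leaf : List A → BTree A zero
  node : ∀ {h} → BTree A h → List (A × BTree A h) → BTree A (suc h)

-- Filled t m b: the root of b has between m and 2t - 1 keys, and every other
-- node between t - 1 and 2t - 1.
data Filled {A : Set} (t : ℕ) : ∀ {h} → ℕ → BTree A h → Set where
  leaf : ∀ {m ks} → m ≤ length ks → length ks ≤ 2 * t ∸ 1 → Filled t m (leaf ks)
  node : ∀ {h m} {b : BTree A h} {bs} → m ≤ length bs → length bs ≤ 2 * t ∸ 1 →
         Filled t (t ∸ 1) b → All (Filled t (t ∸ 1) ∘ proj₂) bs → Filled t m (node b bs)

-- Every inner node, the root included, has a key.
IsBTree : {A : Set} → ℕ → ∀ {h} → BTree A h → Set
IsBTree t {h} b = Filled t (1 ⊓ h) b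

module _ {A : Set} where

  mutual
    inorder : ∀ {h} → BTree A h → List A
    inorder (leaf ks)   = ks
    inorder (node b bs) = inorder b ++ inorders bs

    inorders : ∀ {h} → List (A × BTree A h) → List A
    inorders []             = []
    inorders ((k , b) ∷ bs) = k ∷ inorder b ++ inorders bs

  mutual
    nodeCount : ∀ {h} → BTree A h → ℕ
    nodeCount (leaf ks)   = 1
    nodeCount (node b bs) = 1 + nodeCount b + nodeCounts bs

    nodeCounts : ∀ {h} → List (A × BTree A h) → ℕ
    nodeCounts []             = 0
    nodeCounts ((k , b) ∷ bs) = nodeCount b + nodeCounts bs

-- The character of repetition g, or nothing when there is no such repetition,
-- so that a missing repetition differs from every character.
charAt : DBWT → ℕ → Maybe Char
charAt D       zero          = nothing
charAt []      (suc g)       = nothing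
charAt (R ∷ D) (suc zero)    = just (char R)
charAt (R ∷ D) (suc (suc g)) = charAt D (suc g)

Indexed : DBWT → Piece → Set
Indexed D P =
    (charAt D g ≢ charAt D (1 + g) × charAt D (1 + g) ≢ just $)
  ⊎ (charAt D (1 + g) ≡ just $ × charAt D g ≢ charAt D (2 + g))
  ⊎ charAt D g ≡ just $
  where
  g : ℕ
  g = index P

indexed? : ∀ D P → Dec (Indexed D P)
indexed? D P =
    (¬? (charAt D g ≟ᴹ charAt D (1 + g)) ×-dec ¬? (charAt D (1 + g) ≟ᴹ just $))
  ⊎-dec ((charAt D (1 + g) ≟ᴹ just $) ×-dec ¬? (charAt D g ≟ᴹ charAt D (2 + g)))
  ⊎-dec (charAt D g ≟ᴹ just $)
  where
  g : ℕ
  g = index P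
  _≟ᴹ_ : (x y : Maybe Char) → Dec (x ≡ y)
  _≟ᴹ_ = Maybe.≡-dec _≟_

-- (g , c) is the key (u_g , c), stored with the value v_g.
Entry : Set
Entry = ℕ × Char

entry : Piece → Entry
entry P = index P , char (rep P)

_≺_ : Entry → Entry → Set
(g , c) ≺ (g′ , c′) = c < c′ ⊎ (c ≡ c′ × g < g′)

-- The two-level order-maintenance structure of Dietz and Sleator: a tagged
-- list of nonempty groups, each a tagged list of elements. Elements are
-- compared by group tag first and by their own tag within a group.
Groups : Set
Groups = List (ℕ × List (ℕ × Node))

members : ℕ × List (ℕ × Node) → List Node
members = map proj₂ ∘ proj₂

-- Maintains M G xs: G represents the order xs with tags at most M.
record Maintains (M : ℕ) (G : Groups) (xs : List Node) : Set where
  field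
    nonempty    : All (λ g → 1 ≤ length (proj₂ g)) G
    elements    : concatMap members G ≡ xs
    groupTags   : Linked _<_ (map proj₁ G)
    elementTags : All (Linked _<_ ∘ map proj₁ ∘ proj₂) G
    tagBound    : All (λ g → proj₁ g ≤ M × All (λ e → proj₁ e ≤ M) (proj₂ g)) G

-- The constants hidden by the O- and Θ-notation of the model.
record Constants : Set where
  field
    wordFactor  : ℕ  -- κ: the word size is at least log n / κ and at most κ log n
    numberExp   : ℕ  -- d: alphabet size, tags and addresses are at most n ^ d
    minDegree   : ℕ  -- t: B-tree nodes have at most 2t children
    minDegree≥2 : 2 ≤ minDegree
    registers   : ℕ  -- list heads, counters and variables of the program
open Constants public

record WordSize (K : Constants) (n w : ℕ) : Set where
  field
    lower : ⌊log₂ n ⌋ ≤ wordFactor K * w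
    upper : w ≤ wordFactor K * ⌊log₂ n ⌋

record Storage : Set where
  field
    graph       : Graph
    u-list      : List Node
    v-list      : List Node
    order       : Groups
    heavyReps   : List Node
    heavyFs     : List Node
    treeHeight  : ℕ
    tree        : BTree Entry treeHeight
open Storage public

-- S is a possible content of the memory when r-comp holds the DBWT D of L_δ.
record Stores (K : Constants) (α : ℕ) {n : ℕ} (T : Text n) (δ : ℕ) (D : DBWT) (S : Storage) : Set where
  field
    graph≡     : graph S ≡ LF-intervalGraph T δ D
    u-list≡    : u-list S ≡ map (u ∘ index) (pieces D)
    v-list≡    : ∃[ Ps ] (Ps ↭ pieces D × Linked (λ P Q → F-start T δ P < F-start T δ Q) Ps
                          × v-list S ≡ map (v ∘ index) Ps)
    order≡     : Maintains (n ^ numberExp K) (order S) (map (u ∘ index) (pieces D))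
    heavyReps≡ : heavyReps S ↭ map (u ∘ index) (filter (heavyRep? T δ D α) (pieces D))
    heavyFs≡   : heavyFs S ↭ map (v ∘ index) (filter (heavyF? T δ D α) (pieces D))
    isBTree    : IsBTree (minDegree K) (tree S)
    sorted     : Linked _≺_ (inorder (tree S))
    entries    : inorder (tree S) ↭ map entry (filter (indexed? D) (pieces D))

-- The memory contents that occur while r-comp runs on T.
Occurs : Constants → ℕ → ∀ {n} → Text n → Storage → Set
Occurs K α T S = ∃[ φ ] ∃[ δ ] ∃[ D ] ∃[ s ] (Reached α T φ δ D s × Stores K α T δ D S)

module _ (K : Constants) (n w : ℕ) .{{_ : NonZero w}} where

  -- The binary representation of m ≥ 1 has ⌊log₂ m⌋ + 1 bits, hence fits in
  -- ⌈(⌊log₂ m⌋ + 1) / w⌉ = ⌊⌊log₂ m⌋ / w⌋ + 1 words.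
  words : ℕ → ℕ
  words m = suc (⌊log₂ m ⌋ / w)

  -- The words reserved for a pointer or a number at most n ^ d.
  field-words : ℕ
  field-words = words (n ^ numberExp K)

  -- Character, length, incident edges, order record, slot in a heavy array.
  nodeWords : Node × Repetition → ℕ
  nodeWords (_ , R) = words (char R) + words (len R) + 3 * field-words

  -- Label, both ends, and links in the incidence lists of both ends.
  directedWords : DirectedEdge → ℕ
  directedWords e = words (label e) + 6 * field-words

  graphWords : Graph → ℕ
  graphWords G = sum (map nodeWords (nodes G))
               + length (undirected G) * (2 * field-words)
               + sum (map directedWords (directed G))

  linkedListWords : List Node → ℕ
  linkedListWords xs = length xs * (3 * field-words)

  -- An element has a tag, two links, its group and its node; a group has a
  -- tag, two links and its first element.
  orderWords : Groups → ℕ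
  orderWords G = sum (map groupWords G)
    where
    elementWords : ℕ × Node → ℕ
    elementWords (tag , _) = words tag + 4 * field-words
    groupWords : ℕ × List (ℕ × Node) → ℕ
    groupWords (tag , es) = words tag + 3 * field-words + sum (map elementWords es)

  arrayWords : List Node → ℕ
  arrayWords xs = (1 + length xs) * field-words

  -- Every node reserves 2t - 1 slots for a key and its value (u_g, character,
  -- v_g), 2t slots for children, a key count and a link to its parent.
  treeWords : ∀ {h} → BTree Entry h → ℕ
  treeWords b = nodeCount b * (((2 * minDegree K ∸ 1) * 3 + 2 * minDegree K + 2) * field-words)

  spaceInWords : Storage → ℕ
  spaceInWords S = graphWords (graph S)
                 + linkedListWords (u-list S) + linkedListWords (v-list S)
                 + orderWords (order S)
                 + arrayWords (heavyReps S) + arrayWords (heavyFs S)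
                 + treeWords (tree S)
                 + registers K * field-words

  spaceInBits : Storage → ℕ
  spaceInBits S = w * spaceInWords S

{-# OPTIONS --safe #-}

-- Identify row m of the sorted suffixes with the suffix of length m. A row once
-- inserted never changes its place among the others, L_δ has the preceding
-- character of row m at row m, LF maps row m to row m + 1 (row δ to row 1), and
-- a DBWT is the set V of rows at which a repetition starts; its F-intervals
-- start at V + 1. Leave out the repetition $ and, if $ splits a repetition, the
-- cut next to $. Then a fast update does not change V, except that the start of
-- the repetition that row δ joins from the left moves to row δ. An update that
-- is not fast adds at most two rows to V, but it also inserts a letter into L
-- between two letters that differ from it, so it adds a run; runs never
-- disappear, hence there are at most r such updates.
--
-- The cuts made by balancing are paid by the potential |V| + Σ (c ∸ 6), where
-- c ranges over the numbers of starting positions covered by the repetitions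
-- and by the F-intervals, and a starting position at a border counts on both
-- sides of it. With this convention a fast update, which can only separate two
-- coinciding borders, does not increase the potential; a cut of a heavy
-- repetition or F-interval does not increase it either, because α ≥ 16; and an
-- update that is not fast increases it by at most 10. So there are O(r)
-- repetitions at all times.
--
-- LF is monotone on each repetition, so every starting position is covered by
-- one repetition and one F-interval, the graph has O(r) edges, and all stored
-- numbers have O(log n) bits.

module Submission where

open import Defs
open import Data.Nat.Base
open import Data.Nat.Properties
open import Data.Nat.DivMod using (/-monoˡ-≤; m/n*n≤m)
open import Data.Nat.ListAction using (sum)
open import Data.Nat.ListAction.Properties using (sum-↭)
open import Data.Nat.Logarithm using (⌊log₂_⌋; ⌊log₂⌋-mono-≤; ⌊log₂[2^n]⌋≡n)
open import Data.Nat.Tactic.RingSolver using (solve-∀)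
open import Algebra.Properties.CommutativeSemigroup +-commutativeSemigroup using (interchange; x∙yz≈y∙xz; xy∙z≈xz∙y)
open import Data.Bool.Base using (Bool; true; false; if_then_else_; not; _∧_; _∨_) renaming (T to IsTrue)
open import Data.Bool.Properties using (∨-identityʳ; ∧-zeroʳ; ∧-identityʳ) renaming (_≟_ to _≟ᵇ_)
open import Data.Fin.Base as Fin using (Fin; toℕ; fromℕ<)
open import Data.Fin.Properties using (toℕ-fromℕ<)
open import Data.Vec.Base using (Vec; toList; lookup; _∷_; [])
open import Data.Vec.Properties using (length-toList)
open import Data.List.Base using (List; []; _∷_; _++_; [_]; map; filter; length; concatMap; replicate; drop; take; upTo; derun)
open import Data.List.Properties
  using (++-assoc; ++-identityʳ; ∷-injective; ∷ʳ-injectiveʳ; length-++; length-map; length-drop; length-replicate; length-filter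
        ; map-++; map-∘; map-cong; map-cong-local; concatMap-++; drop-drop
        ; filter-++; filter-all; filter-none; filter-accept; filter-reject)
open import Data.List.Relation.Unary.All as All using (All; []; _∷_)
import Data.List.Relation.Unary.All.Properties as All
open import Data.List.Relation.Unary.Any using (here; there)
open import Data.List.Relation.Unary.AllPairs as AllPairs using (AllPairs; []; _∷_)
import Data.List.Relation.Unary.AllPairs.Properties as AllPairs
open import Data.List.Relation.Unary.Linked using (Linked; []; [-]; _∷_)
open import Data.List.Relation.Unary.Sorted.TotalOrder.Properties using (↗↭↗⇒≋)
open import Data.List.Relation.Unary.Unique.Propositional using (Unique)
import Data.List.Relation.Unary.Unique.Propositional.Properties as Unique
open import Data.List.Membership.Propositional using (_∈_)
open import Data.List.Membership.Propositional.Properties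
  using (∈-++⁺ˡ; ∈-++⁺ʳ; ∈-++⁻; ∈-∃++; ∈-map⁺; ∈-map⁻; ∈-filter⁻; ∈-upTo⁺; ∈-upTo⁻)
open import Data.List.Membership.Propositional.Properties.WithK using (unique∧set⇒bag)
open import Data.List.Relation.Binary.BagAndSetEquality using (∼bag⇒↭)
import Data.List.Relation.Binary.Lex.Core as LexCore
import Data.List.Relation.Binary.Lex.NonStrict as Lex
import Data.List.Relation.Binary.Pointwise as Pointwise
open import Data.List.Relation.Binary.Permutation.Propositional using (_↭_; ↭-trans; ↭-reflexive; ↭⇒↭ₛ; ↭⇒↭ₛ′)
open import Data.List.Relation.Binary.Permutation.Propositional.Properties using (map⁺; filter-↭; ↭-length)
open import Data.List.Sort (Lex.≤-decTotalOrder ≤-decTotalOrder) using () renaming (sort to sortStrings; sort-↭ to sortStrings-↭; sort-↗ to sortStrings-↗)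
open import Data.List.Sort ≤-decTotalOrder using () renaming (sort-↭ to sortNumbers-↭; sort-↗ to sortNumbers-↗)
open import Data.Product.Base hiding (map)
open import Data.Sum.Base using (_⊎_; inj₁; inj₂)
open import Data.Empty using (⊥)
open import Function.Base using (_∘_; id)
open import Function.Bundles using (mk⇔; Equivalence)
open import Relation.Binary.Bundles using (DecTotalOrder)
open import Relation.Binary.Definitions using (Trichotomous; tri<; tri≈; tri>)
open import Relation.Binary.PropositionalEquality hiding ([_])
open import Relation.Nullary.Decidable.Core using (Dec; yes; no; does; _×-dec_)
open import Relation.Nullary.Negation.Core using (¬_; contradiction)

-- All but `r` of the updates may be fast, so a fast update must cost nothing at all, not even a
-- constant. This decides what is counted. Borders that exist only because of `$` reappear elsewhere
-- with every update; they are left out until a non-fast update makes them permanent. A border of a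
-- repetition and one of an F-interval may coincide, and an inserted row can separate them either
-- way; if the coincidence counts on both sides, the separation can only remove a count. The merge
-- itself is not disturbed either: the new `$` never lands between the replaced letter and an equal
-- neighbour, since a third row would then lie between two adjacent ones.
--
-- The excess is convex and 0 up to `θ`, so an additional border never raises a sum of excesses
-- while the weight counted twice is at most `θ`. A new row raises one weight of each kind, counted
-- at most twice, and the number of repetitions: 5 in all, hence 10 for a non-fast update. Runs are
-- counted in the BWT without its `$`, where an update inserts one letter and changes nothing else.

-- A potential for weighted lists with cutting positions

∑ : (ℕ → ℕ) → List ℕ → ℕ
∑ f []       = 0
∑ f (x ∷ xs) = f x + ∑ f xs

-- Both parts of a repetition or F-interval that is 16-heavy get 8 starting
-- positions when it is cut. At most 2 of these are left out of the potential
-- below, so that a cut gains at least θ - 1, which pays for the new starting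
-- positions (2 in repetitions, 2 in F-intervals) and for the new repetition.
θ : ℕ
θ = 6

excess : ℕ → ℕ
excess c = c ∸ θ

∸-superadditive : ∀ k m b → (m ∸ k) + (b ∸ k) ≤ (m + b) ∸ k
∸-superadditive zero    m b = ≤-refl
∸-superadditive (suc k) zero b = ≤-refl
∸-superadditive (suc k) (suc m) zero = ≤-reflexive (trans (+-identityʳ _) (cong (_∸ k) (sym (+-identityʳ m))))
∸-superadditive (suc k) (suc m) (suc b) = ≤-trans (∸-superadditive k m b) (∸-monoˡ-≤ k (+-monoʳ-≤ m (n≤1+n b)))

∸-convex : ∀ k {q t} b → q ≤ t → (t ∸ k) + ((q + b) ∸ k) ≤ ((t + b) ∸ k) + (q ∸ k)
∸-convex zero {q} {t} b _ = ≤-reflexive (lem t q b)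
  where lem : ∀ t q b → t + (q + b) ≡ t + b + q
        lem = solve-∀
∸-convex (suc k) {t = t} b z≤n = ≤-trans (∸-superadditive (suc k) t b) (m≤m+n _ _)
∸-convex (suc k) b (s≤s q≤t) = ∸-convex k b q≤t

-- The pieces are cut out by the positions x with a x > 0; the weight of a
-- cutting position counts for the pieces on both of its sides.
closePiece : ℕ → ℕ → ℕ → (ℕ → ℕ) → ℕ
closePiece zero    t q rest = rest t
closePiece (suc _) t q rest = excess t + rest q

Φ : (a b : ℕ → ℕ) → ℕ → List ℕ → ℕ
Φ a b c []       = excess c
Φ a b c (x ∷ xs) = closePiece (a x) (c + b x) (b x) (λ d → Φ a b d xs)

Φ-monoᶜ : ∀ a b {c d} xs → c ≤ d → Φ a b c xs ≤ Φ a b d xs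
Φ-monoᶜ a b []       c≤d = ∸-monoˡ-≤ θ c≤d
Φ-monoᶜ a b (x ∷ xs) c≤d with a x
... | zero  = Φ-monoᶜ a b xs (+-monoˡ-≤ (b x) c≤d)
... | suc _ = +-monoˡ-≤ _ (∸-monoˡ-≤ θ (+-monoˡ-≤ (b x) c≤d))

excess-suc : ∀ c → excess (suc c) ≤ suc (excess c)
excess-suc c = ∸-suc-≤ θ c
  where
  ∸-suc-≤ : ∀ k c → suc c ∸ k ≤ suc (c ∸ k)
  ∸-suc-≤ zero c = ≤-refl
  ∸-suc-≤ (suc k) zero = ≤-trans (m∸n≤m 0 k) z≤n
  ∸-suc-≤ (suc k) (suc c) = ∸-suc-≤ k c

-- Only the piece in progress sees the carried weight, and `excess` is 1-Lipschitz.
Φ-sucᶜ : ∀ a b c xs → Φ a b (suc c) xs ≤ suc (Φ a b c xs)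
Φ-sucᶜ a b c []       = excess-suc c
Φ-sucᶜ a b c (x ∷ xs) with a x
... | zero  = Φ-sucᶜ a b (c + b x) xs
... | suc _ = +-monoˡ-≤ _ (excess-suc (c + b x))

-- Truncation is the only non-linearity of `excess`. The rows `ms` keep the piece open until it
-- weighs `θ`, so the extra `d` counts in full.
Φ-linear : ∀ a b c d ms vs → All (λ m → a m ≡ 0) ms → θ ≤ c + ∑ b ms →
           d + Φ a b c (ms ++ vs) ≤ Φ a b (d + c) (ms ++ vs)
Φ-linear a b c d [] vs [] h = go vs
  where
  h′ : θ ≤ c
  h′ = subst (θ ≤_) (+-identityʳ c) h
  shift : ∀ e → d + (excess (c + e)) ≡ excess (d + c + e)
  shift e = trans (sym (+-∸-assoc d (≤-trans h′ (m≤m+n c e)))) (cong excess (sym (+-assoc d c e)))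
  go : ∀ vs → d + Φ a b c vs ≤ Φ a b (d + c) vs
  go [] = ≤-reflexive (sym (+-∸-assoc d h′))
  go (z ∷ vs) with a z
  ... | zero  = subst (λ e → d + Φ a b (c + b z) vs ≤ Φ a b e vs) (sym (+-assoc d c (b z)))
                  (Φ-linear a b (c + b z) d [] vs [] (≤-trans h′ (≤-trans (m≤m+n c (b z)) (m≤m+n _ 0))))
  ... | suc _ = ≤-reflexive (trans (sym (+-assoc d _ _)) (cong (_+ Φ a b (b z) vs) (shift (b z))))
Φ-linear a b c d (m ∷ ms) vs (am ∷ ams) h rewrite am =
  subst (λ e → d + Φ a b (c + b m) (ms ++ vs) ≤ Φ a b e (ms ++ vs)) (sym (+-assoc d c (b m)))
    (Φ-linear a b (c + b m) d ms vs ams (subst (θ ≤_) (sym (+-assoc c (b m) (∑ b ms))) h))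

-- Convexity of `excess`, carried along the list until the piece in progress is closed; from there
-- on both sides continue with the same weight.
Φ-convex : ∀ a b {q t} xs → q ≤ t → excess t + Φ a b q xs ≤ Φ a b t xs + excess q
Φ-convex a b {q} {t} [] q≤t = ≤-refl
Φ-convex a b {q} {t} (x ∷ xs) q≤t with a x
... | zero  = +-cancelʳ-≤ (excess (q + b x)) _ _ (begin
      excess t + Φ a b (q + b x) xs + excess (q + b x) ≡⟨ xy∙z≈xz∙y (excess t) _ _ ⟩
      (excess t + excess (q + b x)) + Φ a b (q + b x) xs ≤⟨ +-monoˡ-≤ _ (∸-convex θ (b x) q≤t) ⟩
      (excess (t + b x) + excess q) + Φ a b (q + b x) xs ≡⟨ xy∙z≈xz∙y (excess (t + b x)) _ _ ⟩
      (excess (t + b x) + Φ a b (q + b x) xs) + excess q ≤⟨ +-monoˡ-≤ _ (Φ-convex a b xs (+-monoˡ-≤ (b x) q≤t)) ⟩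
      (Φ a b (t + b x) xs + excess (q + b x)) + excess q ≡⟨ xy∙z≈xz∙y (Φ a b (t + b x) xs) _ _ ⟩
      Φ a b (t + b x) xs + excess q + excess (q + b x) ∎)
  where
  open ≤-Reasoning
... | suc _ = begin
      excess t + (excess (q + b x) + Φ a b (b x) xs) ≡⟨ +-assoc (excess t) _ _ ⟨
      excess t + excess (q + b x) + Φ a b (b x) xs ≤⟨ +-monoˡ-≤ _ (∸-convex θ (b x) q≤t) ⟩
      excess (t + b x) + excess q + Φ a b (b x) xs ≡⟨ xy∙z≈xz∙y (excess (t + b x)) _ _ ⟩
      excess (t + b x) + Φ a b (b x) xs + excess q ∎
  where
  open ≤-Reasoning

-- A cut restarts the piece with the weight `q` of the cutting row, the only weight counted twice;
-- up to `θ` it has no excess.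
Φ-cut : ∀ a b {q t} xs → q ≤ t → q ≤ θ → excess t + Φ a b q xs ≤ Φ a b t xs
Φ-cut a b {q} {t} xs q≤t q≤θ =
  subst (excess t + Φ a b q xs ≤_) (trans (cong (Φ a b t xs +_) (m≤n⇒m∸n≡0 q≤θ)) (+-identityʳ _)) (Φ-convex a b xs q≤t)

-- Each additional cutting row is handled by `Φ-cut`, which is why the weights `b′` must stay below
-- `θ`.
Φ-mono : ∀ {a a′ b b′ : ℕ → ℕ} c xs → (∀ {x} → x ∈ xs → a′ x ≡ 0 → a x ≡ 0) →
         (∀ {x} → x ∈ xs → b′ x ≤ b x) → (∀ {x} → x ∈ xs → b′ x ≤ θ) →
         Φ a′ b′ c xs ≤ Φ a b c xs
Φ-mono c [] hₐ h h′ = ≤-refl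
Φ-mono {a} {a′} {b} {b′} c (x ∷ xs) hₐ h h′ with a′ x | a x | hₐ (here refl)
... | zero  | zero  | _ = ≤-trans (Φ-mono (c + b′ x) xs (hₐ ∘ there) (h ∘ there) (h′ ∘ there)) (Φ-monoᶜ a b xs (+-monoʳ-≤ c (h (here refl))))
... | zero  | suc _ | e with () ← e refl
... | suc _ | zero  | _ = ≤-trans (Φ-cut a′ b′ xs (m≤n+m (b′ x) c) (h′ (here refl)))
                            (≤-trans (Φ-mono (c + b′ x) xs (hₐ ∘ there) (h ∘ there) (h′ ∘ there)) (Φ-monoᶜ a b xs (+-monoʳ-≤ c (h (here refl)))))
... | suc _ | suc _ | _ = +-mono-≤ (∸-monoˡ-≤ θ (+-monoʳ-≤ c (h (here refl))))
                            (≤-trans (Φ-mono (b′ x) xs (hₐ ∘ there) (h ∘ there) (h′ ∘ there)) (Φ-monoᶜ a b xs (h (here refl))))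

Φ-cong : ∀ {a a′ b b′ : ℕ → ℕ} c {xs} → All (λ x → a x ≡ a′ x × b x ≡ b′ x) xs → Φ a b c xs ≡ Φ a′ b′ c xs
Φ-cong c [] = refl
Φ-cong {a} {a′} {b} {b′} c {x ∷ xs} ((ex , fx) ∷ es) rewrite ex | fx with a′ x
... | zero  = Φ-cong (c + b′ x) es
... | suc _ = cong (excess (c + b′ x) +_) (Φ-cong (b′ x) es)

-- Rows on which both potentials agree can be stripped if the inequality is known for every weight
-- `d` carried into the rest.
Φ-prefix : ∀ {a a′ b b′ : ℕ → ℕ} {us xs ys} j k c → All (λ x → a x ≡ a′ x × b x ≡ b′ x) us →
           (∀ d → j + Φ a b d xs ≤ k + Φ a′ b′ d ys) → j + Φ a b c (us ++ xs) ≤ k + Φ a′ b′ c (us ++ ys)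
Φ-prefix j k c [] h = h c
Φ-prefix {a} {a′} {b} {b′} {w ∷ us} {xs} {ys} j k c ((eu , fu) ∷ es) h rewrite eu | fu with a′ w
... | zero  = Φ-prefix j k (c + b′ w) es h
... | suc _ = begin
    j + (e + Φ a b (b′ w) (us ++ xs)) ≡⟨ x∙yz≈y∙xz j e _ ⟩
    e + (j + Φ a b (b′ w) (us ++ xs)) ≤⟨ +-monoʳ-≤ e (Φ-prefix j k (b′ w) es h) ⟩
    e + (k + Φ a′ b′ (b′ w) (us ++ ys)) ≡⟨ x∙yz≈y∙xz e k _ ⟩
    k + (e + Φ a′ b′ (b′ w) (us ++ ys)) ∎
  where
  open ≤-Reasoning
  e : ℕ
  e = excess (c + b′ w)

Φ-neutral : ∀ {a b : ℕ → ℕ} {x} c us vs → a x ≡ 0 → b x ≡ 0 → Φ a b c (us ++ x ∷ vs) ≡ Φ a b c (us ++ vs)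
Φ-neutral {b = b} c [] vs ax bx rewrite ax | bx | +-identityʳ c = refl
Φ-neutral {a} {b} c (w ∷ us) vs ax bx with a w
... | zero  = Φ-neutral (c + b w) us vs ax bx
... | suc _ = cong (excess (c + b w) +_) (Φ-neutral (b w) us vs ax bx)

-- A row counts in at most two pieces, in two if it is a cutting row, and each excess grows by at
-- most 1.
Φ-raise : ∀ {a b b′ : ℕ → ℕ} {x} c {xs} → Unique xs → (∀ {y} → y ∈ xs → y ≢ x → b′ y ≡ b y) → b′ x ≤ suc (b x) →
          Φ a b′ c xs ≤ 2 + Φ a b c xs
Φ-raise c {[]} _ _ _ = m≤n+m _ 2
Φ-raise {a} {b} {b′} {x} c {y ∷ xs} (y∉ ∷ un) h hx with y ≟ x
... | no y≢x rewrite h (here refl) y≢x with a y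
...   | zero  = Φ-raise (c + b y) un (h ∘ there) hx
...   | suc _ = ≤-trans (+-monoʳ-≤ (excess (c + b y)) (Φ-raise (b y) un (h ∘ there) hx)) (≤-reflexive (x∙yz≈y∙xz (excess (c + b y)) 2 _))
Φ-raise {a} {b} {b′} {x} c {x ∷ xs} (x∉ ∷ un) h hx | yes refl = at-x
  where
  below : ∀ {d e} → d ≤ suc e → Φ a b′ d xs ≤ suc (Φ a b e xs)
  below {d} {e} d≤ = ≤-trans (≤-reflexive (Φ-cong d (All.tabulate (λ z∈ → refl , h (there z∈) (λ z≡x → All.lookup x∉ z∈ (sym z≡x))))))
                   (≤-trans (Φ-monoᶜ a b xs d≤) (Φ-sucᶜ a b e xs))
  c≤ : c + b′ x ≤ suc (c + b x)
  c≤ = subst (c + b′ x ≤_) (+-suc c (b x)) (+-monoʳ-≤ c hx)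
  at-x : Φ a b′ c (x ∷ xs) ≤ 2 + Φ a b c (x ∷ xs)
  at-x with a x
  ... | zero  = m≤n⇒m≤1+n (below c≤)
  ... | suc _ = ≤-trans (+-mono-≤ (≤-trans (∸-monoˡ-≤ θ c≤) (excess-suc (c + b x))) (below hx)) (≤-reflexive (cong suc (+-suc _ _)))

-- Both parts reach `θ`, so no subtraction is truncated: the piece contributes its weight minus `θ`,
-- the two parts contribute this weight plus `b σ` minus twice `θ`. The row `f` may fail to be a
-- cutting row; then the weight carried into it only makes the left part heavier.
Φ-gain : ∀ {a a′ b : ℕ → ℕ} {σ} c us f ms ns vs → (∀ {y} → y ∈ us ++ f ∷ ms ++ σ ∷ ns ++ vs → y ≢ σ → a′ y ≡ a y) → 1 ≤ a′ σ → a σ ≡ 0 →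
         Unique (us ++ f ∷ ms ++ σ ∷ ns ++ vs) →
         All (λ m → a m ≡ 0) ms → All (λ m → a m ≡ 0) ns →
         θ ≤ b f + ∑ b ms + b σ → θ ≤ b σ + ∑ b ns →
         θ + Φ a′ b c (us ++ f ∷ ms ++ σ ∷ ns ++ vs) ≤ b σ + Φ a b c (us ++ f ∷ ms ++ σ ∷ ns ++ vs)
Φ-gain {a} {a′} {b} {σ} c us f ms ns vs h hσ aσ un ams ans left right =
  Φ-prefix {us = us} θ (b σ) c (same us ∈-++⁺ˡ (λ y∈ → apart us un y∈ (there (∈-++⁺ʳ ms (here refl))))) from-f
  where
  same : ∀ ys → (∀ {y} → y ∈ ys → y ∈ us ++ f ∷ ms ++ σ ∷ ns ++ vs) → (∀ {y} → y ∈ ys → y ≢ σ) →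
         All (λ x → a′ x ≡ a x × b x ≡ b x) ys
  same ys i n = All.tabulate (λ y∈ → h (i y∈) (n y∈) , refl)
  apart : ∀ {y z} ys {zs} → Unique (ys ++ zs) → y ∈ ys → z ∈ zs → y ≢ z
  apart (y ∷ ys) (y∉ ∷ _) (here refl) z∈ = All.lookup y∉ (∈-++⁺ʳ ys z∈)
  apart (y ∷ ys) (_ ∷ un)  (there y∈)  z∈ = apart ys un y∈ z∈
  dropˡ : ∀ ys {zs} → Unique (ys ++ zs) → Unique {A = ℕ} zs
  dropˡ [] un = un
  dropˡ (y ∷ ys) (_ ∷ un) = dropˡ ys un
  un₁ : Unique (f ∷ ms ++ σ ∷ ns ++ vs)
  un₁ = dropˡ us un
  un₂ : Unique (σ ∷ ns ++ vs)
  un₂ = dropˡ (f ∷ ms) un₁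
  atσ : ∀ d → θ ≤ d + b σ → θ + Φ a′ b d (σ ∷ ns ++ vs) ≤ b σ + Φ a b d (σ ∷ ns ++ vs)
  atσ d hd rewrite sym (m+[n∸m]≡n hσ) | aσ = begin
    θ + (excess (d + b σ) + Φ a′ b (b σ) (ns ++ vs)) ≡⟨ +-assoc θ (excess (d + b σ)) _ ⟨
    (θ + excess (d + b σ)) + Φ a′ b (b σ) (ns ++ vs) ≡⟨ cong (_+ Φ a′ b (b σ) (ns ++ vs)) (m+[n∸m]≡n hd) ⟩
    (d + b σ) + Φ a′ b (b σ) (ns ++ vs) ≡⟨ cong ((d + b σ) +_) (Φ-cong (b σ) (same (ns ++ vs) (∈-++⁺ʳ us ∘ there ∘ ∈-++⁺ʳ ms ∘ there) λ y∈ e → All.lookup (AllPairs.head un₂) y∈ (sym e))) ⟩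
    (d + b σ) + Φ a b (b σ) (ns ++ vs) ≡⟨ cong (_+ Φ a b (b σ) (ns ++ vs)) (+-comm d (b σ)) ⟩
    (b σ + d) + Φ a b (b σ) (ns ++ vs) ≡⟨ +-assoc (b σ) d _ ⟩
    b σ + (d + Φ a b (b σ) (ns ++ vs)) ≤⟨ +-monoʳ-≤ (b σ) (Φ-linear a b (b σ) d ns vs ans right) ⟩
    b σ + Φ a b (d + b σ) (ns ++ vs) ∎
    where open ≤-Reasoning
  middle : ∀ ms d → All (λ m → a m ≡ 0) ms → All (λ m → a′ m ≡ a m) ms → θ ≤ d + ∑ b ms + b σ →
           θ + Φ a′ b d (ms ++ σ ∷ ns ++ vs) ≤ b σ + Φ a b d (ms ++ σ ∷ ns ++ vs)
  middle [] d _ _ hd = atσ d (subst (λ e → θ ≤ e + b σ) (+-identityʳ d) hd)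
  middle (m ∷ ms) d (am ∷ ams) (m≢ ∷ ms≢) hd rewrite m≢ | am =
    middle ms (d + b m) ams ms≢ (subst (λ e → θ ≤ e + b σ) (sym (+-assoc d (b m) (∑ b ms))) hd)
  ms≢ : All (λ m → a′ m ≡ a m) ms
  ms≢ = All.tabulate (λ y∈ → h (∈-++⁺ʳ us (there (∈-++⁺ˡ y∈))) (apart (f ∷ ms) un₁ (there y∈) (here refl)))
  from-f : ∀ d → θ + Φ a′ b d (f ∷ ms ++ σ ∷ ns ++ vs) ≤ b σ + Φ a b d (f ∷ ms ++ σ ∷ ns ++ vs)
  from-f d rewrite h (∈-++⁺ʳ us (here refl)) (apart (f ∷ ms) un₁ (here refl) (here refl)) with a f
  ... | zero  = middle ms (d + b f) ams ms≢ (≤-trans left (+-monoˡ-≤ (b σ) (+-monoˡ-≤ (∑ b ms) (m≤n+m (b f) d))))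
  ... | suc _ = begin
    θ + (e + Φ a′ b (b f) (ms ++ σ ∷ ns ++ vs)) ≡⟨ x∙yz≈y∙xz θ e _ ⟩
    e + (θ + Φ a′ b (b f) (ms ++ σ ∷ ns ++ vs)) ≤⟨ +-monoʳ-≤ e (middle ms (b f) ams ms≢ left) ⟩
    e + (b σ + Φ a b (b f) (ms ++ σ ∷ ns ++ vs)) ≡⟨ x∙yz≈y∙xz e (b σ) _ ⟩
    b σ + (e + Φ a b (b f) (ms ++ σ ∷ ns ++ vs)) ∎
    where
    open ≤-Reasoning
    e : ℕ
    e = excess (d + b f)

-- A cutting position and a weight between the same two rows are tied; placing
-- a new row x before y may only break such ties.
module _ {a a′ b b′ : ℕ → ℕ} {x y : ℕ} (ax : a x ≡ 0) (bx : b x ≡ 0) (by : b y ≡ b′ y + b′ x) where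

  Φ-tieˡ : a′ x ≡ 0 → a′ y ≡ a y → ∀ c vs → All (λ z → a′ z ≡ a z × b′ z ≡ b z) vs →
           Φ a′ b′ c (x ∷ y ∷ vs) ≤ Φ a b c (x ∷ y ∷ vs)
  Φ-tieˡ a′x a′y c vs same rewrite ax | bx | by | a′x | a′y | +-identityʳ c | +-comm (b′ y) (b′ x) | +-assoc c (b′ x) (b′ y) with a y
  ... | zero  = ≤-reflexive (Φ-cong _ same)
  ... | suc _ = +-monoʳ-≤ (excess (c + (b′ x + b′ y))) (≤-trans (≤-reflexive (Φ-cong _ same)) (Φ-monoᶜ a b vs (m≤n+m (b′ y) (b′ x))))

  Φ-tieʳ : a′ x ≡ a y → a′ y ≡ 0 → ∀ c vs → All (λ z → a′ z ≡ a z × b′ z ≡ b z) vs →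
           Φ a′ b′ c (x ∷ y ∷ vs) ≤ Φ a b c (x ∷ y ∷ vs)
  Φ-tieʳ a′x a′y c vs same rewrite ax | bx | by | a′x | +-identityʳ c | +-comm (b′ y) (b′ x) with a y
  ... | zero  rewrite a′y | +-assoc c (b′ x) (b′ y) = ≤-reflexive (Φ-cong _ same)
  ... | suc _ rewrite a′y = +-mono-≤ (∸-monoˡ-≤ θ (+-monoʳ-≤ c (m≤m+n (b′ x) (b′ y)))) (≤-reflexive (Φ-cong _ same))

  -- With the roles exchanged, the tied cuts can come apart and enclose a new piece between `x` and
  -- `y`. It weighs at most `a y`, so it has no excess.
  Φ-tieˡ′ : a y ≤ θ → a′ x ≡ 0 → a′ y ≡ a y → ∀ c vs → All (λ z → b′ z ≡ b z × a′ z ≡ a z) vs →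
            Φ b′ a′ c (x ∷ y ∷ vs) ≤ Φ b a c (x ∷ y ∷ vs)
  Φ-tieˡ′ ay a′x a′y c vs same rewrite ax | bx | by | a′x | a′y | +-identityʳ c with b′ x | b′ y
  ... | zero  | zero  = ≤-reflexive (Φ-cong _ same)
  ... | zero  | suc _ = +-monoʳ-≤ (excess (c + a y)) (≤-reflexive (Φ-cong _ same))
  ... | suc _ | zero  = +-mono-≤ (∸-monoˡ-≤ θ (m≤m+n c (a y))) (≤-reflexive (Φ-cong _ same))
  ... | suc _ | suc _ = +-mono-≤ (∸-monoˡ-≤ θ (m≤m+n c (a y)))
                          (subst (λ e → e + Φ b′ a′ (a y) vs ≤ Φ b a (a y) vs) (sym (m≤n⇒m∸n≡0 ay)) (≤-reflexive (Φ-cong _ same)))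

  Φ-tieʳ′ : a y ≤ θ → a′ x ≡ a y → a′ y ≡ 0 → ∀ c vs → All (λ z → b′ z ≡ b z × a′ z ≡ a z) vs →
            Φ b′ a′ c (x ∷ y ∷ vs) ≤ Φ b a c (x ∷ y ∷ vs)
  Φ-tieʳ′ ay a′x a′y c vs same rewrite ax | bx | by | a′x | a′y | +-identityʳ c with b′ x | b′ y
  ... | zero  | zero  rewrite +-identityʳ (c + a y) = ≤-reflexive (Φ-cong _ same)
  ... | zero  | suc _ rewrite +-identityʳ (c + a y) =
          +-monoʳ-≤ (excess (c + a y)) (≤-trans (≤-reflexive (Φ-cong _ same)) (Φ-monoᶜ b a vs z≤n))
  ... | suc _ | zero  rewrite +-identityʳ (a y) = +-monoʳ-≤ (excess (c + a y)) (≤-reflexive (Φ-cong _ same))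
  ... | suc _ | suc _ rewrite +-identityʳ (a y) = +-monoʳ-≤ (excess (c + a y))
                          (subst (λ e → e + Φ b′ a′ 0 vs ≤ Φ b a (a y) vs) (sym (m≤n⇒m∸n≡0 ay))
                            (≤-trans (≤-reflexive (Φ-cong _ same)) (Φ-monoᶜ b a vs z≤n)))

-- Rows of the BWT

module _ {A : Set} where

  unique-split : ∀ {x : A} us {vs} us′ {vs′} → Unique (us ++ x ∷ vs) → us ++ x ∷ vs ≡ us′ ++ x ∷ vs′ → us ≡ us′ × vs ≡ vs′
  unique-split []       []         _        refl = refl , refl
  unique-split []       (w ∷ us′)  (x∉ ∷ _) refl = contradiction refl (All.lookup x∉ (∈-++⁺ʳ us′ (here refl)))
  unique-split (w ∷ us) []         (w∉ ∷ _) refl = contradiction refl (All.lookup w∉ (∈-++⁺ʳ us (here refl)))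
  unique-split (w ∷ us) (w′ ∷ us′) (_ ∷ un) eq with ∷-injective eq
  ... | refl , eq′ with unique-split us us′ un eq′
  ...   | refl , refl = refl , refl

  module _ {_∼_ : A → A → Set} where

    AllPairs-++⁻ʳ : ∀ us {vs} → AllPairs _∼_ (us ++ vs) → AllPairs _∼_ vs
    AllPairs-++⁻ʳ []       ps       = ps
    AllPairs-++⁻ʳ (w ∷ us) (_ ∷ ps) = AllPairs-++⁻ʳ us ps

    AllPairs-++⁻ˡ : ∀ us {vs} → AllPairs _∼_ (us ++ vs) → AllPairs _∼_ us
    AllPairs-++⁻ˡ []       ps       = []
    AllPairs-++⁻ˡ (w ∷ us) (p ∷ ps) = All.++⁻ˡ us p ∷ AllPairs-++⁻ˡ us ps

    AllPairs-across : ∀ us {vs x y} → AllPairs _∼_ (us ++ vs) → x ∈ us → y ∈ vs → x ∼ y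
    AllPairs-across (w ∷ us) (p ∷ ps) (here refl) y∈ = All.lookup p (∈-++⁺ʳ us y∈)
    AllPairs-across (w ∷ us) (p ∷ ps) (there x∈)  y∈ = AllPairs-across us ps x∈ y∈

  same-members⇒↭ : {xs ys : List A} → Unique xs → Unique ys →
                   (∀ {x} → x ∈ xs → x ∈ ys) → (∀ {x} → x ∈ ys → x ∈ xs) → xs ↭ ys
  same-members⇒↭ ux uy f g = ∼bag⇒↭ (unique∧set⇒bag ux uy (mk⇔ f g))

-- Row m stands for the suffix of length m of the text; ch m is the character
-- that precedes it, so that suffix m + 1 is ch m followed by suffix m.
module RowOrder (ch : ℕ → ℕ) where

  infix 4 _⊏_ _⊏?_

  data _⊏_ : ℕ → ℕ → Set where
    empty : ∀ {m} → zero ⊏ suc m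
    char< : ∀ {l m} → ch l < ch m → suc l ⊏ suc m
    char≡ : ∀ {l m} → ch l ≡ ch m → l ⊏ m → suc l ⊏ suc m

  ⊏-irrefl : ∀ {m} → ¬ (m ⊏ m)
  ⊏-irrefl (char< p)   = <-irrefl refl p
  ⊏-irrefl (char≡ _ p) = ⊏-irrefl p

  ⊏-char : ∀ {l m} → suc l ⊏ suc m → ch l ≤ ch m
  ⊏-char (char< p)   = <⇒≤ p
  ⊏-char (char≡ e _) = ≤-reflexive e

  ⊏-cancel : ∀ {l m} → suc l ⊏ suc m → ch l ≡ ch m → l ⊏ m
  ⊏-cancel (char< p)   e = contradiction e (<⇒≢ p)
  ⊏-cancel (char≡ _ p) _ = p

  ⊏-trans : ∀ {k l m} → k ⊏ l → l ⊏ m → k ⊏ m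
  ⊏-trans empty       (char< _)   = empty
  ⊏-trans empty       (char≡ _ _) = empty
  ⊏-trans (char< p)   (char< q)   = char< (<-trans p q)
  ⊏-trans (char< p)   (char≡ e _) = char< (<-≤-trans p (≤-reflexive e))
  ⊏-trans (char≡ e _) (char< q)   = char< (≤-<-trans (≤-reflexive e) q)
  ⊏-trans (char≡ e p) (char≡ f q) = char≡ (trans e f) (⊏-trans p q)

  ⊏-cmp : Trichotomous _≡_ _⊏_
  ⊏-cmp zero    zero    = tri≈ (λ ()) refl (λ ())
  ⊏-cmp zero    (suc m) = tri< empty (λ ()) (λ ())
  ⊏-cmp (suc l) zero    = tri> (λ ()) (λ ()) empty
  ⊏-cmp (suc l) (suc m) with <-cmp (ch l) (ch m)
  ... | tri< p _ _ = tri< (char< p) (λ { refl → <-irrefl refl p }) (λ q → ⊏-irrefl (⊏-trans (char< p) q))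
  ... | tri> _ _ p = tri> (λ q → ⊏-irrefl (⊏-trans (char< p) q)) (λ { refl → <-irrefl refl p }) (char< p)
  ... | tri≈ _ e _ with ⊏-cmp l m
  ...   | tri< p _ _ = tri< (char≡ e p) (λ { refl → ⊏-irrefl p }) (λ q → ⊏-irrefl (⊏-trans (char≡ e p) q))
  ...   | tri> _ _ p = tri> (λ q → ⊏-irrefl (⊏-trans (char≡ (sym e) p) q)) (λ { refl → ⊏-irrefl p }) (char≡ (sym e) p)
  ...   | tri≈ _ refl _ = tri≈ ⊏-irrefl refl ⊏-irrefl

  _⊏?_ : ∀ l m → Dec (l ⊏ m)
  l ⊏? m with ⊏-cmp l m
  ... | tri< p _ _ = yes p
  ... | tri≈ p _ _ = no p
  ... | tri> p _ _ = no p

  ⊏⇒≢ : ∀ {l m} → l ⊏ m → l ≢ m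
  ⊏⇒≢ p refl = ⊏-irrefl p

  ⊏-asym : ∀ {l m} → l ⊏ m → ¬ (m ⊏ l)
  ⊏-asym p q = ⊏-irrefl (⊏-trans p q)

  Sorted : List ℕ → Set
  Sorted = AllPairs _⊏_

  sorted⇒unique : ∀ {xs} → Sorted xs → Unique xs
  sorted⇒unique = AllPairs.map ⊏⇒≢

  sorted-split : ∀ {xs} z → Sorted xs → All (_≢ z) xs → xs ≡ filter (_⊏? z) xs ++ filter (z ⊏?_) xs
  sorted-split z []       _          = refl
  sorted-split {x ∷ xs} z (p ∷ ps) (x≢z ∷ ≢z) with ⊏-cmp x z | z ⊏? x
  ... | tri< x⊏z _ _ | yes z⊏x = contradiction z⊏x (⊏-asym x⊏z)
  ... | tri< x⊏z _ _ | no _    = cong (x ∷_) (sorted-split z ps ≢z)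
  ... | tri≈ _ e _   | _       = contradiction e x≢z
  ... | tri> _ _ z⊏x | no ¬z⊏x = contradiction z⊏x ¬z⊏x
  ... | tri> _ _ z⊏x | yes _
    rewrite filter-none (_⊏? z) {xs} (All.map (λ x⊏y y⊏z → ⊏-asym (⊏-trans z⊏x x⊏y) y⊏z) p)
          | filter-all (z ⊏?_) {xs} (All.map (⊏-trans z⊏x) p) = refl

  no-gap : ∀ {m m′ w} ys {zs} → Sorted (ys ++ m ∷ m′ ∷ zs) → w ∈ ys ++ m ∷ m′ ∷ zs → m ⊏ w → ¬ (w ⊏ m′)
  no-gap {m} {m′} ys s w∈ m⊏w w⊏m′ with ∈-++⁻ ys w∈
  ... | inj₁ w∈ys = ⊏-asym m⊏w (AllPairs-across ys s w∈ys (here refl))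
  ... | inj₂ (here refl) = ⊏-irrefl m⊏w
  ... | inj₂ (there (here refl)) = ⊏-irrefl w⊏m′
  ... | inj₂ (there (there w∈zs)) with AllPairs-++⁻ʳ ys s
  ...   | _ ∷ (p ∷ _) = ⊏-asym w⊏m′ (All.lookup p w∈zs)

  adjacent : ∀ {m m′} xs → Sorted xs → m ∈ xs → m′ ∈ xs → m ⊏ m′ → (∀ {w} → w ∈ xs → m ⊏ w → ¬ (w ⊏ m′)) →
             ∃[ ys ] ∃[ zs ] xs ≡ ys ++ m ∷ m′ ∷ zs
  adjacent (x ∷ xs) (p ∷ s) (here refl) (here refl) m⊏m′ _ = contradiction m⊏m′ ⊏-irrefl
  adjacent (x ∷ xs) (p ∷ s) (there m∈) (here refl) m⊏m′ _ = contradiction (All.lookup p m∈) (⊏-asym m⊏m′)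
  adjacent (x ∷ xs) (p ∷ s) (there m∈) (there m′∈) m⊏m′ h with adjacent xs s m∈ m′∈ m⊏m′ (h ∘ there)
  ... | ys , zs , eq = x ∷ ys , zs , cong (x ∷_) eq
  adjacent (x ∷ xs) (p ∷ s) (here refl) (there (here refl)) m⊏m′ _ = [] , _ , refl
  adjacent (x ∷ w ∷ xs) (p ∷ (q ∷ s)) (here refl) (there (there m′∈)) m⊏m′ h =
    contradiction (All.lookup q m′∈) (h (there (here refl)) (All.lookup p (here refl)))

  -- By definition, `rows (suc δ)` is `rows δ` with row `suc δ` inserted, just as an update inserts
  -- `$`; `lower δ` and `upper δ` are the parts on both sides of the new row.
  rows lower upper : ℕ → List ℕ
  rows zero    = []
  rows (suc δ) = lower δ ++ suc δ ∷ upper δ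
  lower δ = filter (_⊏? suc δ) (rows δ)
  upper δ = filter (suc δ ⊏?_) (rows δ)

  rows-bounds : ∀ {m} δ → m ∈ rows δ → 1 ≤ m × m ≤ δ
  rows-bounds (suc δ) m∈ with ∈-++⁻ (lower δ) m∈
  ... | inj₁ m∈l with rows-bounds δ (proj₁ (∈-filter⁻ (_⊏? suc δ) {xs = rows δ} m∈l))
  ...   | p , q = p , m≤n⇒m≤1+n q
  rows-bounds (suc δ) m∈ | inj₂ (here refl) = s≤s z≤n , ≤-refl
  rows-bounds (suc δ) m∈ | inj₂ (there m∈w) with rows-bounds δ (proj₁ (∈-filter⁻ (suc δ ⊏?_) {xs = rows δ} m∈w))
  ...   | p , q = p , m≤n⇒m≤1+n q

  rows-sorted : ∀ δ → Sorted (rows δ)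
  rows-sorted zero    = []
  rows-sorted (suc δ) = AllPairs.++⁺ (AllPairs.filter⁺ (_⊏? suc δ) (rows-sorted δ))
    (All.all-filter (suc δ ⊏?_) (rows δ) ∷ AllPairs.filter⁺ (suc δ ⊏?_) (rows-sorted δ))
    (All.map (λ p → p ∷ All.map (⊏-trans p) (All.all-filter (suc δ ⊏?_) (rows δ))) (All.all-filter (_⊏? suc δ) (rows δ)))

  rows-unique : ∀ δ → Unique (rows δ)
  rows-unique δ = sorted⇒unique (rows-sorted δ)

  rows-split : ∀ δ → rows δ ≡ lower δ ++ upper δ
  rows-split δ = sorted-split (suc δ) (rows-sorted δ)
    (All.tabulate λ m∈ e → <-irrefl e (s≤s (proj₂ (rows-bounds δ m∈))))

  rows⁺ : ∀ {m} δ → 1 ≤ m → m ≤ δ → m ∈ rows δ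
  rows⁺ {m} zero    1≤m m≤0 = contradiction (≤-trans 1≤m m≤0) (λ ())
  rows⁺ {m} (suc δ) 1≤m m≤δ with m ≟ suc δ
  ... | yes refl = ∈-++⁺ʳ (lower δ) (here refl)
  ... | no m≢ with ∈-++⁻ (lower δ) (subst (m ∈_) (rows-split δ) (rows⁺ δ 1≤m (s≤s⁻¹ (≤∧≢⇒< m≤δ m≢))))
  ...   | inj₁ m∈ = ∈-++⁺ˡ m∈
  ...   | inj₂ m∈ = ∈-++⁺ʳ (lower δ) (there m∈)

  rows-suc : ∀ {m} δ → m ∈ rows δ → m ∈ rows (suc δ)
  rows-suc δ m∈ with rows-bounds δ m∈
  ... | p , q = rows⁺ (suc δ) p (m≤n⇒m≤1+n q)

module RowFacts (n : ℕ) (ch : ℕ → ℕ) (ch-zero : ch 0 ≡ 1) (ch-pos : ∀ {m} → 1 ≤ m → m < n → 1 < ch m) where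

  open RowOrder ch public

  -- The L-character of row m of L_δ is ch (origin δ m), where row δ has the
  -- character $ = ch 0; LF maps row m to row next δ m.
  origin : ℕ → ℕ → ℕ
  origin δ m = if m ≡ᵇ δ then 0 else m

  chr : ℕ → ℕ → ℕ
  chr δ m = ch (origin δ m)

  next : ℕ → ℕ → ℕ
  next δ m = suc (origin δ m)

  origin-last : ∀ δ → origin δ δ ≡ 0
  origin-last δ with δ ≡ᵇ δ in eq
  ... | true  = refl
  ... | false = contradiction (subst IsTrue eq (≡⇒≡ᵇ δ δ refl)) id

  origin-other : ∀ {δ m} → m ≢ δ → origin δ m ≡ m
  origin-other {δ} {m} m≢δ with m ≡ᵇ δ in eq
  ... | true  = contradiction (≡ᵇ⇒≡ m δ (subst IsTrue (sym eq) _)) m≢δ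
  ... | false = refl

  chr-last : ∀ δ → chr δ δ ≡ 1
  chr-last δ = trans (cong ch (origin-last δ)) ch-zero

  chr-other : ∀ {δ m} → m ≢ δ → chr δ m ≡ ch m
  chr-other m≢δ = cong ch (origin-other m≢δ)

  module _ {δ : ℕ} (δ≤n : δ ≤ n) where

    chr-pos : ∀ {m} → m ∈ rows δ → m ≢ δ → 1 < chr δ m
    chr-pos m∈ m≢δ with rows-bounds δ m∈
    ... | p , q = subst (1 <_) (sym (chr-other m≢δ)) (ch-pos p (<-≤-trans (≤∧≢⇒< q m≢δ) δ≤n))

    next-∈ : ∀ {m} → m ∈ rows δ → next δ m ∈ rows δ
    next-∈ {m} m∈ with rows-bounds δ m∈ | m ≟ δ
    ... | p , q | yes refl = rows⁺ δ (s≤s z≤n) (subst (λ e → suc e ≤ m) (sym (origin-last m)) p)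
    ... | p , q | no m≢δ = rows⁺ δ (s≤s z≤n) (subst (λ e → suc e ≤ δ) (sym (origin-other m≢δ)) (≤∧≢⇒< q m≢δ))

    next-surjective : ∀ {m} → m ∈ rows δ → ∃[ w ] (w ∈ rows δ × next δ w ≡ m)
    next-surjective {zero} m∈ = contradiction (proj₁ (rows-bounds δ m∈)) λ ()
    next-surjective {suc zero} m∈ = δ , rows⁺ δ (proj₂ (rows-bounds δ m∈)) ≤-refl , cong suc (origin-last δ)
    next-surjective {suc (suc m)} m∈ with proj₂ (rows-bounds δ m∈)
    ... | q = suc m , rows⁺ δ (s≤s z≤n) (<⇒≤ q) , cong suc (origin-other (<⇒≢ q))

    next-injective : ∀ {l m} → l ∈ rows δ → m ∈ rows δ → next δ l ≡ next δ m → l ≡ m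
    next-injective {l} {m} l∈ m∈ e with l ≟ δ | m ≟ δ
    ... | yes refl | yes refl = refl
    ... | no l≢ | no m≢ = trans (sym (origin-other l≢)) (trans (suc-injective e) (origin-other m≢))
    ... | yes refl | no m≢ = contradiction (trans (sym (origin-last l)) (trans (suc-injective e) (origin-other m≢)))
                               (λ z → <⇒≢ (proj₁ (rows-bounds δ m∈)) z)
    ... | no l≢ | yes refl = contradiction (trans (sym (origin-last m)) (trans (suc-injective (sym e)) (origin-other l≢)))
                               (λ z → <⇒≢ (proj₁ (rows-bounds δ l∈)) z)

    next-↭ : map (next δ) (rows δ) ↭ rows δ
    next-↭ = same-members⇒↭ (unique-map (rows-unique δ) id) (rows-unique δ) to from
      where
      unique-map : ∀ {xs} → Unique xs → (∀ {x} → x ∈ xs → x ∈ rows δ) → Unique (map (next δ) xs)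
      unique-map [] _ = []
      unique-map {x ∷ xs} (x∉ ∷ un) h = All.map⁺ (All.tabulate λ y∈ e → All.lookup x∉ y∈ (next-injective (h (here refl)) (h (there y∈)) e))
                                 ∷ unique-map un (h ∘ there)
      to : ∀ {x} → x ∈ map (next δ) (rows δ) → x ∈ rows δ
      to x∈ with ∈-map⁻ (next δ) x∈
      ... | w , w∈ , refl = next-∈ w∈
      from : ∀ {x} → x ∈ rows δ → x ∈ map (next δ) (rows δ)
      from x∈ with next-surjective x∈
      ... | w , w∈ , refl = ∈-map⁺ (next δ) w∈

    -- `$` occurs in row `δ` only, so row `δ` shares its character with no other row, and every
    -- other row is its own origin.
    chr-≡ : ∀ {l m} → l ∈ rows δ → m ∈ rows δ → chr δ l ≡ chr δ m →
            (l ≡ δ × m ≡ δ) ⊎ (origin δ l ≡ l × origin δ m ≡ m)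
    chr-≡ {l} {m} l∈ m∈ e with l ≟ δ | m ≟ δ
    ... | yes p | yes q = inj₁ (p , q)
    ... | no p  | no q  = inj₂ (origin-other p , origin-other q)
    ... | yes refl | no q = contradiction (trans (sym (chr-last δ)) e) (<⇒≢ (chr-pos m∈ q))
    ... | no p | yes refl = contradiction (trans (sym (chr-last δ)) (sym e)) (<⇒≢ (chr-pos l∈ p))

    next-mono : ∀ {l m} → l ∈ rows δ → m ∈ rows δ → chr δ l ≡ chr δ m → l ⊏ m → next δ l ⊏ next δ m
    next-mono l∈ m∈ e l⊏m with chr-≡ l∈ m∈ e
    ... | inj₁ (refl , refl) = contradiction l⊏m ⊏-irrefl
    ... | inj₂ (p , q) = char≡ e (subst₂ _⊏_ (sym p) (sym q) l⊏m)

    next-reflects : ∀ {l m} → l ∈ rows δ → m ∈ rows δ → chr δ l ≡ chr δ m → next δ l ⊏ next δ m → l ⊏ m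
    next-reflects l∈ m∈ e p with chr-≡ l∈ m∈ e
    ... | inj₁ (refl , refl) = contradiction p ⊏-irrefl
    ... | inj₂ (eq₁ , eq₂) = subst₂ _⊏_ eq₁ eq₂ (⊏-cancel p e)

    -- Neighbouring rows with one character have neighbouring images, so the F-interval of a
    -- repetition is contiguous. The image of `m` is glued to the block obtained for the rest.
    next-block : ∀ us m ms vs → rows δ ≡ us ++ m ∷ ms ++ vs → All (λ x → chr δ x ≡ chr δ m) ms →
                 ∃[ us′ ] ∃[ vs′ ] rows δ ≡ us′ ++ map (next δ) (m ∷ ms) ++ vs′
    next-block us m [] vs eq [] = ∈-∃++ (next-∈ (subst (m ∈_) (sym eq) (∈-++⁺ʳ us (here refl))))
    next-block us m (m′ ∷ ms) vs eq (e ∷ es)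
      with next-block (us ++ [ m ]) m′ ms vs (trans eq (sym (++-assoc us [ m ] _))) (All.map (λ p → trans p (sym e)) es)
         | adjacent (rows δ) (rows-sorted δ) (next-∈ m∈) (next-∈ m′∈) (next-mono m∈ m′∈ (sym e) m⊏m′) none
      where
      m∈ : m ∈ rows δ
      m∈ = subst (m ∈_) (sym eq) (∈-++⁺ʳ us (here refl))
      m′∈ : m′ ∈ rows δ
      m′∈ = subst (m′ ∈_) (sym eq) (∈-++⁺ʳ us (there (here refl)))
      s : Sorted (us ++ m ∷ m′ ∷ ms ++ vs)
      s = subst Sorted eq (rows-sorted δ)
      m⊏m′ : m ⊏ m′
      m⊏m′ = All.lookup (AllPairs.head (AllPairs-++⁻ʳ us s)) (here refl)
      none : ∀ {w} → w ∈ rows δ → next δ m ⊏ w → ¬ (w ⊏ next δ m′)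
      none w∈ p q with next-surjective w∈
      ... | z , z∈ , refl = no-gap us s (subst (z ∈_) eq z∈) (next-reflects m∈ z∈ (sym e₁) p) (next-reflects z∈ m′∈ (trans e₁ (sym e)) q)
        where
        -- The image of `z` lies between two images with the same first character, so it has this
        -- character too, and the order can be pulled back along LF.
        e₁ : chr δ z ≡ chr δ m
        e₁ = ≤-antisym (subst (chr δ z ≤_) e (⊏-char q)) (⊏-char p)
    ... | us′ , vs′ , eq₁ | ys , zs , eq₂ with unique-split us′ (ys ++ [ next δ m ]) (subst Unique eq₁ (rows-unique δ))
                                               (trans (sym eq₁) (trans eq₂ (sym (++-assoc ys [ next δ m ] _))))
    ...   | refl , refl = ys , vs′ , trans eq₁ (++-assoc ys [ next δ m ] _)

  module _ {δ : ℕ} (1≤δ : 1 ≤ δ) (δ<n : δ < n) where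

    -- In both cases x = c z with c z before or after z; then z lies strictly
    -- between x and row δ.
    new-row-not-right-of : ∀ {x} → x ∈ rows δ → (∀ {w} → w ∈ rows δ → x ⊏ w → ¬ (w ⊏ δ)) → ch x ≡ ch δ →
                           x ⊏ δ → x ⊏ suc δ → ¬ (suc δ ⊏ δ)
    new-row-not-right-of {x} x∈ gap e x⊏δ x⊏ ⊏δ with ⊏-cmp (suc x) x
    ... | tri≈ _ () _
    ... | tri> _ _ x⊏sx = gap (rows⁺ δ (s≤s z≤n) (≤∧≢⇒< (proj₂ (rows-bounds δ x∈)) (⊏⇒≢ x⊏δ))) x⊏sx (⊏-trans (char≡ e x⊏δ) ⊏δ)
    new-row-not-right-of {zero} x∈ _ _ _ _ _ | tri< _ _ _ = contradiction (proj₁ (rows-bounds δ x∈)) λ ()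
    new-row-not-right-of {suc z} x∈ gap e _ x⊏ _ | tri< sx⊏x _ _ with z ≟ 0
    ... | yes refl = <⇒≢ (ch-pos 1≤δ δ<n) (trans (sym ch-zero) (≤-antisym (⊏-char x⊏) (subst (_≤ ch z) e (⊏-char sx⊏x))))
    ... | no z≢0 = gap (rows⁺ δ (n≢0⇒n>0 z≢0) (≤-trans (n≤1+n z) (proj₂ (rows-bounds δ x∈)))) (⊏-cancel sx⊏x (trans e (sym ez))) (⊏-cancel x⊏ ez)
      where
      ez : ch z ≡ ch δ
      ez = ≤-antisym (⊏-char x⊏) (subst (_≤ ch z) e (⊏-char sx⊏x))

    -- The mirror image. Together the two lemmas keep the new `$` from coming between row `δ` and
    -- the neighbour with which a fast update merges it.
    new-row-not-left-of : ∀ {y} → y ∈ rows δ → (∀ {w} → w ∈ rows δ → δ ⊏ w → ¬ (w ⊏ y)) → ch y ≡ ch δ →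
                          δ ⊏ y → suc δ ⊏ y → ¬ (δ ⊏ suc δ)
    new-row-not-left-of {y} y∈ gap e δ⊏y ⊏y δ⊏ with ⊏-cmp (suc y) y
    ... | tri≈ _ () _
    ... | tri< sy⊏y _ _ = gap (rows⁺ δ (s≤s z≤n) (≤∧≢⇒< (proj₂ (rows-bounds δ y∈)) (λ q → ⊏⇒≢ δ⊏y (sym q)))) (⊏-trans δ⊏ (char≡ (sym e) δ⊏y)) sy⊏y
    new-row-not-left-of {zero} y∈ _ _ _ _ _ | tri> _ _ _ = contradiction (proj₁ (rows-bounds δ y∈)) λ ()
    new-row-not-left-of {suc z} y∈ gap e _ ⊏y _ | tri> _ _ y⊏sy with z ≟ 0
    ... | yes refl = <⇒≢ (ch-pos 1≤δ δ<n) (trans (sym ch-zero) (≤-antisym (subst (ch z ≤_) e (⊏-char y⊏sy)) (⊏-char ⊏y)))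
    ... | no z≢0 = gap (rows⁺ δ (n≢0⇒n>0 z≢0) (≤-trans (n≤1+n z) (proj₂ (rows-bounds δ y∈)))) (⊏-cancel ⊏y (sym ez)) (⊏-cancel y⊏sy (trans ez (sym e)))
      where
      ez : ch z ≡ ch δ
      ez = ≤-antisym (subst (ch z ≤_) e (⊏-char y⊏sy)) (⊏-char ⊏y)

    -- A row in between would begin with the common first character of `suc δ` and `suc y`; without
    -- it, it would lie between `δ` and `y`. Row 1 has no row left after its first character, but
    -- that character is `$`.
    new-row-adjacent : ∀ {y} → y ∈ rows δ → (∀ {w} → w ∈ rows δ → δ ⊏ w → ¬ (w ⊏ y)) → ch y ≡ ch δ →
                       ∀ {w} → w ∈ rows (suc δ) → suc δ ⊏ w → ¬ (w ⊏ suc y)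
    new-row-adjacent y∈ gap e w∈ (char< p) (char< q) = <-asym p (<-≤-trans q (≤-reflexive e))
    new-row-adjacent y∈ gap e w∈ (char< p) (char≡ f _) = <⇒≢ p (sym (trans f e))
    new-row-adjacent y∈ gap e w∈ (char≡ f _) (char< q) = <⇒≢ q (trans (sym f) (sym e))
    new-row-adjacent y∈ gap e {suc zero} w∈ (char≡ f p) (char≡ _ q) =
      <⇒≢ (ch-pos 1≤δ δ<n) (trans (sym ch-zero) (sym f))
    new-row-adjacent y∈ gap e {suc (suc w)} w∈ (char≡ f p) (char≡ _ q) =
      gap (rows⁺ δ (s≤s z≤n) (s≤s⁻¹ (proj₂ (rows-bounds (suc δ) w∈)))) p q

-- Run-length forms as marked lists of rows

piecesFrom : ℕ → ℕ → DBWT → List Piece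
piecesFrom i p []      = []
piecesFrom i p (R ∷ D) = record { index = i ; start = p ; rep = R } ∷ piecesFrom (suc i) (p + len R) D

-- The accumulating loop inside pieces has no name; the metavariable go is
-- solved by it.
mutual
  go : ℕ → ℕ → DBWT → List Piece
  go = _

  pieces-∷ : ∀ R D → pieces (R ∷ D) ≡ piecesFrom 1 1 (R ∷ D)
  pieces-∷ R D with 2 | 1 + len R
  ... | i | p = cong (_ ∷_) (go≡ i p D)

  go≡ : ∀ i p D → go i p D ≡ piecesFrom i p D
  go≡ i p []      = refl
  go≡ i p (R ∷ D) = cong (_ ∷_) (go≡ (suc i) (p + len R) D)

pieces≡ : ∀ D → pieces D ≡ piecesFrom 1 1 D
pieces≡ []      = refl
pieces≡ (R ∷ D) = pieces-∷ R D

≡ᵇ-refl : ∀ m → (m ≡ᵇ m) ≡ true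
≡ᵇ-refl zero    = refl
≡ᵇ-refl (suc m) = ≡ᵇ-refl m

≢⇒≡ᵇ : ∀ {l m} → l ≢ m → (l ≡ᵇ m) ≡ false
≢⇒≡ᵇ {l} {m} l≢m with l ≡ᵇ m in eq
... | true  = contradiction (≡ᵇ⇒≡ l m (subst IsTrue (sym eq) _)) l≢m
... | false = refl

≤⇒≤ᵇ-true : ∀ {l m} → l ≤ m → (l ≤ᵇ m) ≡ true
≤⇒≤ᵇ-true {l} {m} l≤m with l ≤ᵇ m in eq
... | true  = refl
... | false = contradiction (≤⇒≤ᵇ l≤m) (subst IsTrue eq)

≰⇒≤ᵇ-false : ∀ {l m} → ¬ l ≤ m → (l ≤ᵇ m) ≡ false
≰⇒≤ᵇ-false {l} {m} l≰m with l ≤ᵇ m in eq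
... | true  = contradiction (≤ᵇ⇒≤ l m (subst IsTrue (sym eq) _)) l≰m
... | false = refl

bit : Bool → ℕ
bit true  = 1
bit false = 0

-- The rows of a BWT are cut into repetitions at the rows x with A x; the
-- first row always starts a repetition. A partial repetition of k letters c is
-- carried along.
segments : (A : ℕ → Bool) (chr : ℕ → Char) → Char → ℕ → List ℕ → DBWT
segments A chr c k []       = (c ^^ k) ∷ []
segments A chr c k (x ∷ xs) =
  if A x then (c ^^ k) ∷ segments A chr (chr x) 1 xs else segments A chr c (suc k) xs

toDBWT : (A : ℕ → Bool) (chr : ℕ → Char) → List ℕ → DBWT
toDBWT A chr []       = []
toDBWT A chr (x ∷ xs) = segments A chr (chr x) 1 xs

data Coherent (A : ℕ → Bool) (chr : ℕ → Char) : Char → List ℕ → Set where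
  []  : ∀ {c} → Coherent A chr c []
  _∷_ : ∀ {c x xs} → (A x ≡ false → chr x ≡ c) → Coherent A chr (chr x) xs → Coherent A chr c (x ∷ xs)

lastChar : (ℕ → Char) → Char → List ℕ → Char
lastChar chr c []       = c
lastChar chr c (x ∷ xs) = lastChar chr (chr x) xs

-- Says that the row before this list ends its repetition. With the row of `$` marked as well, `$`
-- is a repetition of one letter.
data Stops (A : ℕ → Bool) : List ℕ → Set where
  []  : Stops A []
  _∷_ : ∀ {x} → A x ≡ true → ∀ xs → Stops A (x ∷ xs)

segments-cong : ∀ {A A′ chr chr′ c k xs} → All (λ x → A x ≡ A′ x × chr x ≡ chr′ x) xs →
                segments A chr c k xs ≡ segments A′ chr′ c k xs
segments-cong [] = refl
segments-cong {A′ = A′} {xs = x ∷ xs} ((eA , ec) ∷ es) rewrite eA | ec with A′ x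
... | true  = cong (_ ∷_) (segments-cong es)
... | false = segments-cong es

Coherent-cong : ∀ {A A′ chr chr′ c xs} → All (λ x → A x ≡ A′ x × chr x ≡ chr′ x) xs →
                Coherent A chr c xs → Coherent A′ chr′ c xs
Coherent-cong [] [] = []
Coherent-cong ((eA , ec) ∷ es) (h ∷ co) =
  (λ e → trans (sym ec) (h (trans eA e))) ∷ subst (λ d → Coherent _ _ d _) ec (Coherent-cong es co)

-- `segments` emits a repetition only at its end, so its result does not reduce to a head and a
-- tail; `firstLength` and `laterSegments` provide them.
firstLength : (ℕ → Bool) → List ℕ → ℕ
firstLength A []       = 0
firstLength A (x ∷ xs) = if A x then 0 else suc (firstLength A xs)

laterSegments : (ℕ → Bool) → (ℕ → Char) → List ℕ → DBWT
laterSegments A chr []       = []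
laterSegments A chr (x ∷ xs) = if A x then segments A chr (chr x) 1 xs else laterSegments A chr xs

segments-∷ : ∀ A chr c k xs → segments A chr c k xs ≡ (c ^^ (k + firstLength A xs)) ∷ laterSegments A chr xs
segments-∷ A chr c k []       = cong (λ e → (c ^^ e) ∷ []) (sym (+-identityʳ k))
segments-∷ A chr c k (x ∷ xs) with A x
... | true  = cong (λ e → (c ^^ e) ∷ segments A chr (chr x) 1 xs) (sym (+-identityʳ k))
... | false = trans (segments-∷ A chr c (suc k) xs) (cong (λ e → (c ^^ e) ∷ laterSegments A chr xs) (sym (+-suc k (firstLength A xs))))

length-segments : ∀ A chr c k xs → length (segments A chr c k xs) ≡ suc (∑ (bit ∘ A) xs)
length-segments A chr c k []       = refl
length-segments A chr c k (x ∷ xs) with A x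
... | true  = cong suc (length-segments A chr (chr x) 1 xs)
... | false = length-segments A chr c (suc k) xs

expand : DBWT → List Char
expand = concatMap (λ R → replicate (len R) (char R))

replicate-suc-∷ʳ : ∀ k (c : Char) xs → replicate (suc k) c ++ xs ≡ replicate k c ++ c ∷ xs
replicate-suc-∷ʳ zero    c xs = refl
replicate-suc-∷ʳ (suc k) c xs = cong (c ∷_) (replicate-suc-∷ʳ k c xs)

expand-segments : ∀ A chr c k {xs} → Coherent A chr c xs → expand (segments A chr c k xs) ≡ replicate k c ++ map chr xs
expand-segments A chr c k [] = refl
expand-segments A chr c k {x ∷ xs} (h ∷ co) with A x
... | true  = cong (replicate k c ++_) (expand-segments A chr (chr x) 1 co)
... | false with h refl
...   | refl = trans (expand-segments A chr c (suc k) co) (replicate-suc-∷ʳ k c (map chr xs))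

positive-segments : ∀ A chr c k xs → 1 ≤ k → All (λ R → 1 ≤ len R) (segments A chr c k xs)
positive-segments A chr c k []       1≤k = 1≤k ∷ []
positive-segments A chr c k (x ∷ xs) 1≤k with A x
... | true  = 1≤k ∷ positive-segments A chr (chr x) 1 xs ≤-refl
... | false = positive-segments A chr c (suc k) xs (s≤s z≤n)

replace$-segments : ∀ {q} A chr c k xs → c ≢ $ → All (λ x → chr x ≢ $) xs →
                    replace$ q (segments A chr c k xs) ≡ segments A chr c k xs
replace$-segments A chr c k [] c≢ [] rewrite ≢⇒≡ᵇ c≢ = refl
replace$-segments A chr c k (x ∷ xs) c≢ (x≢ ∷ xs≢) with A x
... | true  rewrite ≢⇒≡ᵇ c≢ = cong (_ ∷_) (replace$-segments A chr (chr x) 1 xs x≢ xs≢)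
... | false = replace$-segments A chr c (suc k) xs c≢ xs≢

-- Row `w` and the row after it are both marked, so `$` is a one-letter repetition, and its
-- replacement changes one character and no mark.
replace$-at : ∀ {q} A chr chr′ c k us {w vs} → c ≢ $ → All (λ x → chr x ≢ $) us → All (λ x → chr x ≢ $) vs →
              chr w ≡ $ → A w ≡ true → Stops A vs → chr′ w ≡ q →
              All (λ x → chr x ≡ chr′ x) us → All (λ x → chr x ≡ chr′ x) vs →
              replace$ q (segments A chr c k (us ++ w ∷ vs)) ≡ segments A chr′ c k (us ++ w ∷ vs)
replace$-at {q} A chr chr′ c k [] c≢ us≢ vs≢ w$ Aw st ew _ evs
  rewrite Aw | w$ | ≢⇒≡ᵇ c≢ with st
... | [] rewrite ew = refl
... | _∷_ {y} Ay vs′ rewrite Ay with vs≢ | evs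
...   | y≢ ∷ vs′≢ | e ∷ es rewrite ew | replace$-segments {q} A chr (chr y) 1 vs′ y≢ vs′≢ | e =
        cong (λ D → _ ∷ _ ∷ D) (segments-cong (All.map (λ p → refl , p) es))
replace$-at {q} A chr chr′ c k (x ∷ us) c≢ (x≢ ∷ us≢) vs≢ w$ Aw st ew (e ∷ es) evs with A x
... | true  rewrite ≢⇒≡ᵇ c≢ | sym e = cong (_ ∷_) (replace$-at A chr chr′ (chr x) 1 us x≢ us≢ vs≢ w$ Aw st ew es evs)
... | false = replace$-at A chr chr′ c (suc k) us c≢ us≢ vs≢ w$ Aw st ew es evs

-- `$` goes right before these rows; it splits a repetition exactly if the first of them is
-- unmarked.
splits : (ℕ → Bool) → List ℕ → Bool
splits A []       = false
splits A (y ∷ ys) = not (A y)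

insert$-skip : ∀ c k j D → insert$ (suc k + j) ((c ^^ suc k) ∷ D) ≡ (c ^^ suc k) ∷ insert$ j D
insert$-skip c k j D rewrite ≤⇒≤ᵇ-true (s≤s (m≤m+n k j)) | m+n∸m≡n k j = refl

insert$-cut : ∀ c k j D → insert$ (suc k) ((c ^^ (suc (suc k) + j)) ∷ D) ≡ (c ^^ suc k) ∷ ($ ^^ 1) ∷ (c ^^ suc j) ∷ D
insert$-cut c k j D rewrite ≰⇒≤ᵇ-false {suc (suc k) + j} {suc k} (λ p → <-irrefl refl (≤-trans (m≤m+n (2 + k) j) p))
                          | trans (cong (_∸ k) (sym (+-suc k j))) (m+n∸m≡n k (suc j)) = refl

insert$Splits-skip : ∀ c k j D → insert$Splits (suc k + j) ((c ^^ suc k) ∷ D) ≡ insert$Splits j D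
insert$Splits-skip c k j D rewrite ≤⇒≤ᵇ-true (s≤s (m≤m+n k j)) | m+n∸m≡n k j = refl

insert$Splits-cut : ∀ c k j D → insert$Splits (suc k) ((c ^^ (suc (suc k) + j)) ∷ D) ≡ true
insert$Splits-cut c k j D rewrite ≰⇒≤ᵇ-false {suc (suc k) + j} {suc k} (λ p → <-irrefl refl (≤-trans (m≤m+n (2 + k) j) p)) = refl

-- Inserting `$` amounts to inserting the row `w` and marking both `w` and the row after it. Only
-- that next row may change its mark, namely when a repetition is split, whence `drop 1 vs`.
insert$-segments : ∀ A A′ chr c k us {w vs} → Coherent A chr c (us ++ vs) →
                   All (λ x → A x ≡ A′ x) us → A′ w ≡ true → chr w ≡ $ → Stops A′ vs →
                   All (λ x → A x ≡ A′ x) (drop 1 vs) →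
                   insert$ (suc k + length us) (segments A chr c (suc k) (us ++ vs)) ≡ segments A′ chr c (suc k) (us ++ w ∷ vs)
insert$-segments A A′ chr c k [] {w} {[]} co _ A′w w$ [] _ rewrite A′w | w$ = insert$-skip c k 0 []
insert$-segments A A′ chr c k [] {w} {y ∷ vs} (h ∷ co) _ A′w w$ (A′y ∷ _) es rewrite A′w | w$ | A′y with A y
... | true = trans (insert$-skip c k 0 _) (cong (λ D → _ ∷ _ ∷ D) (segments-cong (All.map (_, refl) es)))
... | false rewrite segments-∷ A chr c (2 + k) vs | +-identityʳ k | h refl =
        trans (insert$-cut c k (firstLength A vs) _)
          (cong (λ D → _ ∷ _ ∷ D) (trans (sym (segments-∷ A chr c 1 vs)) (segments-cong (All.map (_, refl) es))))
insert$-segments A A′ chr c k (x ∷ us) {w} {vs} (h ∷ co) (e ∷ es) A′w w$ st q rewrite sym e with A x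
... | true  = trans (insert$-skip c k (suc (length us)) _) (cong (_ ∷_) (insert$-segments A A′ chr (chr x) 0 us co es A′w w$ st q))
... | false rewrite h refl | +-suc k (length us) = insert$-segments A A′ chr c (suc k) us co es A′w w$ st q

insert$Splits-segments : ∀ A chr c k us vs →
                         insert$Splits (suc k + length us) (segments A chr c (suc k) (us ++ vs)) ≡ splits A vs
insert$Splits-segments A chr c k [] [] = insert$Splits-skip c k 0 []
insert$Splits-segments A chr c k [] (y ∷ vs) with A y
... | true = insert$Splits-skip c k 0 (segments A chr (chr y) 1 vs)
... | false rewrite segments-∷ A chr c (2 + k) vs | +-identityʳ k = insert$Splits-cut c k (firstLength A vs) (laterSegments A chr vs)
insert$Splits-segments A chr c k (x ∷ us) vs with A x
... | true  = trans (insert$Splits-skip c k (suc (length us)) (segments A chr (chr x) 1 (us ++ vs))) (insert$Splits-segments A chr (chr x) 0 us vs)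
... | false rewrite +-suc k (length us) = insert$Splits-segments A chr c (suc k) us vs

adjacentTo$-none : ∀ q A chr c k xs → c ≢ $ → All (λ x → chr x ≢ $) xs → adjacentTo$ q (segments A chr c k xs) ≡ false
adjacentTo$-none q A chr c k [] c≢ [] = refl
adjacentTo$-none q A chr c k (x ∷ xs) c≢ (x≢ ∷ xs≢) with A x
... | false = adjacentTo$-none q A chr c (suc k) xs c≢ xs≢
... | true with adjacentTo$-none q A chr (chr x) 1 xs x≢ xs≢
...   | ih rewrite segments-∷ A chr (chr x) 1 xs | ≢⇒≡ᵇ c≢ | ≢⇒≡ᵇ x≢ | ∧-zeroʳ (c ≡ᵇ q) = ih

headIs : (ℕ → Char) → Char → List ℕ → Bool
headIs chr q []       = false
headIs chr q (y ∷ ys) = chr y ≡ᵇ q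

adjacentTo$-segments : ∀ q A chr c k us {w vs} → Coherent A chr c us → c ≢ $ → q ≢ $ →
                       All (λ x → chr x ≢ $) us → All (λ x → chr x ≢ $) vs →
                       chr w ≡ $ → A w ≡ true → Stops A vs →
                       adjacentTo$ q (segments A chr c k (us ++ w ∷ vs)) ≡ (lastChar chr c us ≡ᵇ q) ∨ headIs chr q vs
adjacentTo$-segments q A chr c k [] [] c≢ q≢ _ _ w$ Aw [] rewrite Aw | w$ | ≢⇒≡ᵇ c≢ = cong (_∨ false) (∧-identityʳ (c ≡ᵇ q))
adjacentTo$-segments q A chr c k [] [] c≢ q≢ _ (y≢ ∷ vs≢) w$ Aw (_∷_ {y} Ay vs)
  rewrite Aw | w$ | Ay | ≢⇒≡ᵇ c≢ | ∧-identityʳ (c ≡ᵇ q) | segments-∷ A chr (chr y) 1 vs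
        | ≢⇒≡ᵇ (λ e → q≢ (sym e)) | sym (segments-∷ A chr (chr y) 1 vs)
        | adjacentTo$-none q A chr (chr y) 1 vs y≢ vs≢ = cong ((c ≡ᵇ q) ∨_) (∨-identityʳ (chr y ≡ᵇ q))
adjacentTo$-segments q A chr c k (x ∷ us) {w} {vs} (h ∷ co) c≢ q≢ (x≢ ∷ us≢) vs≢ w$ Aw st with A x
... | false rewrite h refl = adjacentTo$-segments q A chr c (suc k) us co c≢ q≢ us≢ vs≢ w$ Aw st
... | true with adjacentTo$-segments q A chr (chr x) 1 us {w} {vs} co x≢ q≢ us≢ vs≢ w$ Aw st
...   | ih rewrite segments-∷ A chr (chr x) 1 (us ++ w ∷ vs) | ≢⇒≡ᵇ c≢ | ≢⇒≡ᵇ x≢ | ∧-zeroʳ (c ≡ᵇ q) = ih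

mergeAt-skip : ∀ all c k j D → 1 ≤ length D → mergeAt all (suc k + suc j) ((c ^^ suc k) ∷ D) ≡ (c ^^ suc k) ∷ mergeAt all (suc j) D
mergeAt-skip all c k j (W ∷ D) _
  rewrite +-suc k j | ≤⇒≤ᵇ-true (s≤s (m≤m+n k j)) | trans (cong (_∸ k) (sym (+-suc k j))) (m+n∸m≡n k (suc j)) = refl

mergeBoth : Bool → Repetition → Repetition → DBWT → DBWT
mergeBoth all Q W D =
  if char Q ≡ᵇ char W then (if all then mergeRight (Q ⊕ W) D else (Q ⊕ W) ∷ D) else Q ∷ mergeRight W D

mergeAt-here : ∀ all c k W D → mergeAt all (suc k) ((c ^^ suc k) ∷ W ∷ D) ≡ mergeBoth all (c ^^ suc k) W D
mergeAt-here all c k W D rewrite ≰⇒≤ᵇ-false {suc k} {k} (<-irrefl refl) = refl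

1≤length-segments : ∀ A chr c k xs → 1 ≤ length (segments A chr c k xs)
1≤length-segments A chr c k xs rewrite length-segments A chr c k xs = s≤s z≤n

firstLength-stops : ∀ {A vs} → Stops A vs → firstLength A vs ≡ 0
firstLength-stops [] = refl
firstLength-stops (Ay ∷ _) rewrite Ay = refl

-- The repetitions that end earlier are skipped; `base` is what happens at `w`, for a left neighbour
-- of any length.
mergeAt-segments : ∀ all A A′ chr c k us {w vs} → Coherent A chr c us → All (λ x → A x ≡ A′ x) us → A w ≡ true →
                   (∀ j → mergeBoth all (lastChar chr c us ^^ suc j) (chr w ^^ 1) (laterSegments A chr vs) ≡
                          segments A′ chr (lastChar chr c us) (suc j) (w ∷ vs)) →
                   Stops A vs →
                   mergeAt all (suc k + length us) (segments A chr c (suc k) (us ++ w ∷ vs)) ≡ segments A′ chr c (suc k) (us ++ w ∷ vs)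
mergeAt-segments all A A′ chr c k [] {w} {vs} [] [] Aw base st
  rewrite Aw | segments-∷ A chr (chr w) 1 vs | firstLength-stops st | +-identityʳ k = trans (mergeAt-here all c k _ _) (base k)
mergeAt-segments all A A′ chr c k (x ∷ us) {w} {vs} (h ∷ co) (e ∷ es) Aw base st rewrite sym e with A x
... | true  = trans (mergeAt-skip all c k (length us) (segments A chr (chr x) 1 (us ++ w ∷ vs)) (1≤length-segments A chr (chr x) 1 (us ++ w ∷ vs)))
                (cong (_ ∷_) (mergeAt-segments all A A′ chr (chr x) 0 us co es Aw base st))
... | false rewrite h refl | +-suc k (length us) = mergeAt-segments all A A′ chr c (suc k) us co es Aw base st

-- To merge two repetitions is to remove the mark between them, here that of `w`. A right neighbour
-- with the same character stays apart because `all` is false.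
mergeLeft-base : ∀ all {A A′ chr c w vs} j → c ≡ chr w → A′ w ≡ false → Stops A vs → All (λ x → A x ≡ A′ x) vs →
                 all ≡ false ⊎ headIs chr (chr w) vs ≡ false →
                 mergeBoth all (c ^^ suc j) (chr w ^^ 1) (laterSegments A chr vs) ≡ segments A′ chr c (suc j) (w ∷ vs)
mergeLeft-base all {chr = chr} {w = w} j refl A′w [] es h rewrite A′w | ≡ᵇ-refl (chr w) | +-comm j 1 with all
... | true  = refl
... | false = refl
mergeLeft-base all {A} {A′} {chr} {w = w} j refl A′w (_∷_ {y} Ay vs) (e ∷ es) h
  rewrite A′w | ≡ᵇ-refl (chr w) | +-comm j 1 | Ay | sym e | segments-∷ A chr (chr y) 1 vs with all | h
... | false | _ = cong (_ ∷_) (trans (sym (segments-∷ A chr (chr y) 1 vs)) (segments-cong (All.map (_, refl) es)))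
... | true  | inj₂ q rewrite q = cong (_ ∷_) (trans (sym (segments-∷ A chr (chr y) 1 vs)) (segments-cong (All.map (_, refl) es)))

mergeRight-base : ∀ all {A A′ chr c w y vs} j → c ≢ chr w → A′ w ≡ true → A y ≡ true → A′ y ≡ false → chr y ≡ chr w →
                  All (λ x → A x ≡ A′ x) vs →
                  mergeBoth all (c ^^ suc j) (chr w ^^ 1) (laterSegments A chr (y ∷ vs)) ≡ segments A′ chr c (suc j) (w ∷ y ∷ vs)
mergeRight-base all {A} {A′} {chr} {w = w} {y} {vs} j c≢ A′w Ay A′y e es
  rewrite A′w | ≢⇒≡ᵇ c≢ | Ay | A′y | segments-∷ A chr (chr y) 1 vs | e | ≡ᵇ-refl (chr w) =
  cong (_ ∷_) (trans (sym (segments-∷ A chr (chr w) 2 vs)) (segments-cong (All.map (_, refl) es)))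

mergeBoth-base : ∀ {A A′ chr c w y vs} j → c ≡ chr w → A′ w ≡ false → A y ≡ true → A′ y ≡ false → chr y ≡ chr w →
                 All (λ x → A x ≡ A′ x) vs →
                 mergeBoth true (c ^^ suc j) (chr w ^^ 1) (laterSegments A chr (y ∷ vs)) ≡ segments A′ chr c (suc j) (w ∷ y ∷ vs)
mergeBoth-base {A} {A′} {chr} {w = w} {y} {vs} j refl A′w Ay A′y e es
  rewrite A′w | ≡ᵇ-refl (chr w) | Ay | A′y | segments-∷ A chr (chr y) 1 vs | e | ≡ᵇ-refl (chr w) =
  trans (cong (λ k → (chr w ^^ k) ∷ laterSegments A chr vs) (lem j (firstLength A vs)))
    (trans (sym (segments-∷ A chr (chr w) (3 + j) vs)) (segments-cong (All.map (_, refl) es)))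
  where
  lem : ∀ j f → suc (j + 1 + suc f) ≡ suc (suc (suc (j + f)))
  lem = solve-∀

infixl 6 _∪_

_∪_ : (ℕ → Bool) → ℕ → ℕ → Bool
(A ∪ e) x = (x ≡ᵇ e) ∨ A x

∪-same : ∀ A e → (A ∪ e) e ≡ true
∪-same A e rewrite ≡ᵇ-refl e = refl

∪-other : ∀ A {e x} → x ≢ e → (A ∪ e) x ≡ A x
∪-other A x≢e rewrite ≢⇒≡ᵇ x≢e = refl

-- The rows of a piece, and cuts as new marks

module _ (A : ℕ → Bool) (chr : ℕ → Char) where

  -- The piece that contains the `k` letters carried along, so its first row is not in `xs`. By
  -- `cut≡`, a cut of the piece just adds a mark.
  record FirstBlock (c : Char) (k : ℕ) (xs : List ℕ) (i p : ℕ) (P : Piece) : Set where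
    field
      inside after : List ℕ
      list≡  : xs ≡ inside ++ after
      inner  : All (λ x → A x ≡ false) inside
      stops  : Stops A after
      index≡ : index P ≡ i
      start≡ : start P ≡ p
      rep≡   : rep P ≡ c ^^ (k + length inside)
      cut≡   : ∀ ms e ns → inside ≡ ms ++ e ∷ ns →
               cut 1 (k + length ms) (segments A chr c k xs) ≡ segments (A ∪ e) chr c k xs

  -- A piece that starts in `xs`. There are `number` pieces between it and the carried one, hence
  -- the two successors in `cut≡`.
  record LaterBlock (c : Char) (k : ℕ) (xs : List ℕ) (i p : ℕ) (P : Piece) : Set where
    field
      before : List ℕ
      first  : ℕ
      inside after : List ℕ
      list≡  : xs ≡ before ++ first ∷ inside ++ after
      inner  : All (λ x → A x ≡ false) inside
      begins : A first ≡ true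
      stops  : Stops A after
      number : ℕ
      index≡ : index P ≡ i + suc number
      start≡ : start P ≡ p + k + length before
      rep≡   : rep P ≡ chr first ^^ suc (length inside)
      cut≡   : ∀ ms e ns → inside ≡ ms ++ e ∷ ns →
               cut (suc (suc number)) (suc (length ms)) (segments A chr c k xs) ≡ segments (A ∪ e) chr c k xs

  cut-start : ∀ {c k x xs e m ℓ} → A x ≡ true → x ≢ e →
              cut (suc m) ℓ (segments A chr (chr x) 1 xs) ≡ segments (A ∪ e) chr (chr x) 1 xs →
              cut (suc (suc m)) ℓ (segments A chr c k (x ∷ xs)) ≡ segments (A ∪ e) chr c k (x ∷ xs)
  cut-start {x = x} {e = e} Ax x≢e eq rewrite ∪-other A x≢e | Ax = cong (_ ∷_) eq

  cut-continue : ∀ {c k x xs e m ℓ} → A x ≡ false → x ≢ e →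
                 cut m ℓ (segments A chr c (suc k) xs) ≡ segments (A ∪ e) chr c (suc k) xs →
                 cut m ℓ (segments A chr c k (x ∷ xs)) ≡ segments (A ∪ e) chr c k (x ∷ xs)
  cut-continue {x = x} {e = e} Ax x≢e eq rewrite ∪-other A x≢e | Ax = eq

  cut-first : ∀ {c k x xs} → A x ≡ false → chr x ≡ c → All (x ≢_) xs →
              cut 1 k (segments A chr c k (x ∷ xs)) ≡ segments (A ∪ x) chr c k (x ∷ xs)
  cut-first {c} {k} {x} {xs} Ax refl x∉ rewrite ≡ᵇ-refl x | Ax | segments-∷ A chr c (suc k) xs
    | trans (cong (_∸ k) (sym (+-suc k (firstLength A xs)))) (m+n∸m≡n k (suc (firstLength A xs))) =
    cong (_ ∷_) (trans (sym (segments-∷ A chr c 1 xs)) (segments-cong (All.map (λ x≢y → sym (∪-other A (λ e → x≢y (sym e))) , refl) x∉)))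

  block-of : ∀ c k xs i p {P} → Coherent A chr c xs → Unique xs → P ∈ piecesFrom i p (segments A chr c k xs) →
             FirstBlock c k xs i p P ⊎ LaterBlock c k xs i p P
  block-of c k [] i p co un (here refl) = inj₁ record
    { inside = [] ; after = [] ; list≡ = refl ; inner = [] ; stops = [] ; index≡ = refl ; start≡ = refl
    ; rep≡ = cong (c ^^_) (sym (+-identityʳ k)) ; cut≡ = λ { [] _ _ () ; (_ ∷ _) _ _ () } }
  block-of c k (x ∷ xs) i p (h ∷ co) (x∉ ∷ un) P∈ with A x in Ax
  block-of c k (x ∷ xs) i p (h ∷ co) (x∉ ∷ un) (here refl) | true = inj₁ record
    { inside = [] ; after = x ∷ xs ; list≡ = refl ; inner = [] ; stops = Ax ∷ xs ; index≡ = refl ; start≡ = refl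
    ; rep≡ = cong (c ^^_) (sym (+-identityʳ k)) ; cut≡ = λ { [] _ _ () ; (_ ∷ _) _ _ () } }
  block-of c k (x ∷ xs) i p (h ∷ co) (x∉ ∷ un) (there P∈) | true with block-of (chr x) 1 xs (suc i) (p + k) co un P∈
  ... | inj₁ B = inj₂ record
    { before = [] ; first = x ; inside = inside ; after = after ; list≡ = cong (x ∷_) list≡ ; inner = inner
    ; begins = Ax ; stops = stops ; number = 0 ; index≡ = trans index≡ (+-comm 1 i)
    ; start≡ = trans start≡ (sym (+-identityʳ (p + k))) ; rep≡ = rep≡
    ; cut≡ = λ ms e ns eq → cut-start {xs = xs} Ax (λ { refl → (All.lookup x∉ (e∈ eq)) refl }) (cut≡ ms e ns eq) }
    where
    open FirstBlock B
    e∈ : ∀ {e ms ns} → inside ≡ ms ++ e ∷ ns → e ∈ xs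
    e∈ {e} {ms} eq = subst (e ∈_) (sym list≡) (∈-++⁺ˡ (subst (e ∈_) (sym eq) (∈-++⁺ʳ ms (here refl))))
  ... | inj₂ B = inj₂ record
    { before = x ∷ before ; first = first ; inside = inside ; after = after ; list≡ = cong (x ∷_) list≡ ; inner = inner
    ; begins = begins ; stops = stops ; number = suc number ; index≡ = trans index≡ (sym (+-suc i (suc number)))
    ; start≡ = trans start≡ (+-assoc (p + k) 1 (length before)) ; rep≡ = rep≡
    ; cut≡ = λ ms e ns eq → cut-start {xs = xs} Ax (λ { refl → (All.lookup x∉ (e∈ eq)) refl }) (cut≡ ms e ns eq) }
    where
    open LaterBlock B
    e∈ : ∀ {e ms ns} → inside ≡ ms ++ e ∷ ns → e ∈ xs
    e∈ {e} {ms} eq = subst (e ∈_) (sym list≡) (∈-++⁺ʳ before (there (∈-++⁺ˡ (subst (e ∈_) (sym eq) (∈-++⁺ʳ ms (here refl))))))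
  block-of c k (x ∷ xs) i p (h ∷ co) (x∉ ∷ un) P∈ | false with h refl
  ... | refl with block-of c (suc k) xs i p co un P∈
  ...   | inj₁ B = inj₁ record
    { inside = x ∷ inside ; after = after ; list≡ = cong (x ∷_) list≡ ; inner = Ax ∷ inner ; stops = stops
    ; index≡ = index≡ ; start≡ = start≡ ; rep≡ = trans rep≡ (cong (c ^^_) (sym (+-suc k (length inside))))
    ; cut≡ = cutHere }
    where
    open FirstBlock B
    cutHere : ∀ ms e ns → x ∷ inside ≡ ms ++ e ∷ ns →
              cut 1 (k + length ms) (segments A chr c k (x ∷ xs)) ≡ segments (A ∪ e) chr c k (x ∷ xs)
    cutHere [] _ _ eq with ∷-injective eq
    ... | refl , _ rewrite +-identityʳ k = cut-first Ax refl x∉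
    cutHere (m ∷ ms) e ns eq with ∷-injective eq
    ... | refl , eq′ rewrite ∪-other A {e} {x} (All.lookup x∉ (subst (e ∈_) (sym list≡) (∈-++⁺ˡ (subst (e ∈_) (sym eq′) (∈-++⁺ʳ ms (here refl)))))) | Ax
                           | +-suc k (length ms) = cut≡ ms e ns eq′
  ...   | inj₂ B = inj₂ record
    { before = x ∷ before ; first = first ; inside = inside ; after = after ; list≡ = cong (x ∷_) list≡ ; inner = inner
    ; begins = begins ; stops = stops ; number = number ; index≡ = index≡
    ; start≡ = trans start≡ (lem p k (length before)) ; rep≡ = rep≡
    ; cut≡ = λ ms e ns eq → cut-continue {xs = xs} Ax (λ { refl → (All.lookup x∉ (e∈ eq)) refl }) (cut≡ ms e ns eq) }
    where
    open LaterBlock B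
    lem : ∀ p k b → p + suc k + b ≡ p + k + suc b
    lem = solve-∀
    e∈ : ∀ {e ms ns} → inside ≡ ms ++ e ∷ ns → e ∈ xs
    e∈ {e} {ms} eq = subst (e ∈_) (sym list≡) (∈-++⁺ʳ before (there (∈-++⁺ˡ (subst (e ∈_) (sym eq) (∈-++⁺ʳ ms (here refl))))))

positions : (ℕ → Bool) → ℕ → List ℕ → List ℕ
positions A p []       = []
positions A p (x ∷ xs) = if A x then p ∷ positions A (suc p) xs else positions A (suc p) xs

starts-segments : ∀ A chr c k i p xs → map start (piecesFrom i p (segments A chr c k xs)) ≡ p ∷ positions A (p + k) xs
starts-segments A chr c k i p []       = refl
starts-segments A chr c k i p (x ∷ xs) with A x
... | true  = cong (p ∷_) (trans (starts-segments A chr (chr x) 1 (suc i) (p + k) xs)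
                (cong (λ q → p + k ∷ positions A q xs) (+-comm (p + k) 1)))
... | false = trans (starts-segments A chr c (suc k) i p xs) (cong (λ q → p ∷ positions A q xs) (+-suc p k))

-- Potential of a DBWT

∑-mono : ∀ {f g : ℕ → ℕ} xs → (∀ {x} → x ∈ xs → f x ≤ g x) → ∑ f xs ≤ ∑ g xs
∑-mono []       h = z≤n
∑-mono (x ∷ xs) h = +-mono-≤ (h (here refl)) (∑-mono xs (h ∘ there))

∑-cong : ∀ {f g : ℕ → ℕ} xs → (∀ {x} → x ∈ xs → f x ≡ g x) → ∑ f xs ≡ ∑ g xs
∑-cong []       h = refl
∑-cong (x ∷ xs) h = cong₂ _+_ (h (here refl)) (∑-cong xs (h ∘ there))

∑-++ : ∀ f xs ys → ∑ f (xs ++ ys) ≡ ∑ f xs + ∑ f ys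
∑-++ f []       ys = refl
∑-++ f (x ∷ xs) ys = trans (cong (f x +_) (∑-++ f xs ys)) (sym (+-assoc (f x) _ _))

∑-raise : ∀ {f g : ℕ → ℕ} {x xs} → Unique xs → (∀ {y} → y ∈ xs → y ≢ x → g y ≤ f y) → g x ≤ suc (f x) → ∑ g xs ≤ suc (∑ f xs)
∑-raise {xs = []} _ _ _ = z≤n
∑-raise {f} {g} {x} {y ∷ xs} (y∉ ∷ un) h hx with y ≟ x
... | yes refl = +-mono-≤ hx (∑-mono xs (λ z∈ → h (there z∈) (λ z≡y → All.lookup y∉ z∈ (sym z≡y))))
... | no y≢x = ≤-trans (+-mono-≤ (h (here refl) y≢x) (∑-raise un (h ∘ there) hx)) (≤-reflexive (+-suc (f y) _))

bit≤1 : ∀ b → bit b ≤ 1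
bit≤1 true  = ≤-refl
bit≤1 false = z≤n

headOr0 : List ℕ → ℕ
headOr0 []      = 0
headOr0 (x ∷ _) = x

headOr0-∷ : ∀ xs → xs ++ [ 0 ] ≡ headOr0 xs ∷ drop 1 (xs ++ [ 0 ])
headOr0-∷ []       = refl
headOr0-∷ (x ∷ xs) = refl

infixl 6 _∖_

_∖_ : (ℕ → Bool) → ℕ → ℕ → Bool
(A ∖ e) x = not (x ≡ᵇ e) ∧ A x

∖-same : ∀ A e → (A ∖ e) e ≡ false
∖-same A e rewrite ≡ᵇ-refl e = refl

∖-other : ∀ A {e x} → x ≢ e → (A ∖ e) x ≡ A x
∖-other A x≢e rewrite ≢⇒≡ᵇ x≢e = refl

∪-true : ∀ A e {x} → A x ≡ true → (A ∪ e) x ≡ true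
∪-true A e {x} Ax rewrite Ax with x ≡ᵇ e
... | true  = refl
... | false = refl

module Potential (ch : ℕ → ℕ) where

  open RowOrder ch

  -- Stage k is the situation for L_(k+1), with row k + 1 preceded by $. The
  -- set V holds the first rows of the repetitions, except row k + 1 and, if $
  -- splits a repetition, the row after it. Row k + 1 still has to be attached
  -- to the left or to the right, so the F-interval starting with row k + 1 is
  -- counted as if it started with the row after it (0 if there is none).
  top : ℕ → ℕ
  top k = headOr0 (upper k)

  -- The sentinel 0 is the place behind the last row; an F-interval counted behind the last row is
  -- counted there.
  list : ℕ → List ℕ
  list k = rows (suc k) ++ [ 0 ]

  weight : (ℕ → Bool) → ℕ → ℕ
  weight V m = bit (V m)

  landing : ℕ → (ℕ → Bool) → ℕ → ℕ
  landing k V m = if m ≡ᵇ suc k then 0 else bit (V (pred m)) + (if m ≡ᵇ top k then bit (V k) else 0)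

  -- The first `Φ` ranges over the repetitions and weighs starts of F-intervals, the second ranges
  -- over the F-intervals and weighs starts of repetitions; the sum is the size of `V`.
  Ψ : ℕ → (ℕ → Bool) → ℕ
  Ψ k V = Φ (weight V) (landing k V) 0 (list k) + Φ (landing k V) (weight V) 0 (list k) + ∑ (weight V) (rows (suc k))

  Valid : ℕ → (ℕ → Bool) → Set
  Valid k V = ∀ m → V m ≡ true → 1 ≤ m × m ≤ k

  invalid-above : ∀ {k V m} → Valid k V → k < m → V m ≡ false
  invalid-above {V = V} {m} val k<m with V m in eq
  ... | false = refl
  ... | true  = contradiction k<m (≤⇒≯ (proj₂ (val m eq)))

  invalid-0 : ∀ {k V} → Valid k V → V 0 ≡ false
  invalid-0 {V = V} val with V 0 in eq
  ... | false = refl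
  ... | true  = contradiction (proj₁ (val 0 eq)) λ ()

  list-≤ : ∀ {k m} → m ∈ list k → m ≤ suc k
  list-≤ {k} m∈ with ∈-++⁻ (rows (suc k)) m∈
  ... | inj₁ m∈r = proj₂ (rows-bounds (suc k) m∈r)
  ... | inj₂ (here refl) = z≤n

  list-unique : ∀ k → Unique (list k)
  list-unique k = AllPairs.++⁺ (rows-unique (suc k)) ([] ∷ [])
    (All.tabulate (λ m∈ → (λ e → contradiction (subst (1 ≤_) e (proj₁ (rows-bounds (suc k) m∈))) λ ()) ∷ []))

  after : ℕ → List ℕ
  after k = drop 1 (upper k ++ [ 0 ])

  list≡ : ∀ k → list k ≡ lower k ++ suc k ∷ top k ∷ after k
  list≡ k = trans (++-assoc (lower k) (suc k ∷ upper k) [ 0 ]) (cong (λ zs → lower k ++ suc k ∷ zs) (headOr0-∷ (upper k)))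

  top-≤ : ∀ k → top k ≤ k
  top-≤ k with upper k in eq
  ... | []     = z≤n
  ... | y ∷ ys = proj₂ (rows-bounds k (subst (y ∈_) (sym (rows-split k)) (∈-++⁺ʳ (lower k) (subst (y ∈_) (sym eq) (here refl)))))

  landing-new : ∀ k V → landing k V (suc k) ≡ 0
  landing-new k V rewrite ≡ᵇ-refl k = refl

  landing-top : ∀ k V → landing k V (top k) ≡ bit (V (pred (top k))) + bit (V k)
  landing-top k V rewrite ≢⇒≡ᵇ (<⇒≢ (s≤s (top-≤ k))) | ≡ᵇ-refl (top k) = refl

  landing-other : ∀ k V {m} → m ≢ suc k → m ≢ top k → landing k V m ≡ bit (V (pred m))
  landing-other k V {m} m≢ m≢′ rewrite ≢⇒≡ᵇ m≢ | ≢⇒≡ᵇ m≢′ = +-identityʳ _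

  landing-≤2 : ∀ k V m → landing k V m ≤ 2
  landing-≤2 k V m with m ≡ᵇ suc k | m ≡ᵇ top k
  ... | true  | _     = z≤n
  ... | false | true  = +-mono-≤ (bit≤1 (V (pred m))) (bit≤1 (V k))
  ... | false | false = +-mono-≤ (bit≤1 (V (pred m))) (z≤n {1})

  private
    θ≥1 : 1 ≤ θ
    θ≥1 = s≤s z≤n
    θ≥2 : 2 ≤ θ
    θ≥2 = s≤s (s≤s z≤n)

  -- The row that is new at the next stage carries nothing yet, so both stages can be compared on
  -- `list k`, wherever it was inserted.
  Φ-new : ∀ {a b : ℕ → ℕ} k → a (suc (suc k)) ≡ 0 → b (suc (suc k)) ≡ 0 → Φ a b 0 (list (suc k)) ≡ Φ a b 0 (list k)
  Φ-new {a} {b} k az bz = begin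
    Φ a b 0 (list (suc k))
      ≡⟨ cong (Φ a b 0) (++-assoc (lower (suc k)) (suc (suc k) ∷ upper (suc k)) [ 0 ]) ⟩
    Φ a b 0 (lower (suc k) ++ suc (suc k) ∷ upper (suc k) ++ [ 0 ])
      ≡⟨ Φ-neutral 0 (lower (suc k)) _ az bz ⟩
    Φ a b 0 (lower (suc k) ++ upper (suc k) ++ [ 0 ])
      ≡⟨ cong (Φ a b 0) (trans (sym (++-assoc (lower (suc k)) _ _)) (cong (_++ [ 0 ]) (sym (rows-split (suc k))))) ⟩
    Φ a b 0 (list k) ∎
    where open ≡-Reasoning

  ∑-new : ∀ {a : ℕ → ℕ} k → a (suc (suc k)) ≡ 0 → ∑ a (rows (suc (suc k))) ≡ ∑ a (rows (suc k))
  ∑-new {a} k az = begin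
    ∑ a (lower (suc k) ++ suc (suc k) ∷ upper (suc k)) ≡⟨ ∑-++ a (lower (suc k)) _ ⟩
    ∑ a (lower (suc k)) + (a (suc (suc k)) + ∑ a (upper (suc k))) ≡⟨ cong (λ z → ∑ a (lower (suc k)) + (z + ∑ a (upper (suc k)))) az ⟩
    ∑ a (lower (suc k)) + ∑ a (upper (suc k)) ≡⟨ ∑-++ a (lower (suc k)) _ ⟨
    ∑ a (lower (suc k) ++ upper (suc k)) ≡⟨ cong (∑ a) (rows-split (suc k)) ⟨
    ∑ a (rows (suc k)) ∎
    where open ≡-Reasoning

  private
    on-list : ∀ {k} {P : ℕ → Set} → (∀ {z} → z ∈ list k → z ≢ suc k → z ≢ top k → P z) →
              All P (lower k) × All P (after k)
    on-list {k} {P} h = All.tabulate (λ z∈ → h (in-list (∈-++⁺ˡ z∈)) (low z∈ (here refl)) (low z∈ (there (here refl))))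
                      , All.tabulate (λ z∈ → h (in-list (∈-++⁺ʳ (lower k) (there (there z∈))))
                                               (λ e → All.lookup (AllPairs.head un) (there z∈) (sym e))
                                               (λ e → All.lookup (AllPairs.head (AllPairs.tail un)) z∈ (sym e)))
      where
      in-list : ∀ {z} → z ∈ lower k ++ suc k ∷ top k ∷ after k → z ∈ list k
      in-list {z} = subst (z ∈_) (sym (list≡ k))
      un₀ : Unique (lower k ++ suc k ∷ top k ∷ after k)
      un₀ = subst Unique (list≡ k) (list-unique k)
      un : Unique (suc k ∷ top k ∷ after k)
      un = AllPairs-++⁻ʳ (lower k) un₀
      low : ∀ {z w} → z ∈ lower k → w ∈ suc k ∷ top k ∷ after k → z ≢ w
      low z∈ w∈ = AllPairs-across (lower k) un₀ z∈ w∈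

    Φ-tie : ∀ {a a′ b b′ : ℕ → ℕ} k →
            (∀ {z} → z ∈ list k → z ≢ suc k → z ≢ top k → a′ z ≡ a z × b′ z ≡ b z) →
            (∀ d → All (λ z → a′ z ≡ a z × b′ z ≡ b z) (after k) →
                   Φ a′ b′ d (suc k ∷ top k ∷ after k) ≤ Φ a b d (suc k ∷ top k ∷ after k)) →
            Φ a′ b′ 0 (list k) ≤ Φ a b 0 (list k)
    Φ-tie {a} {a′} {b} {b′} k same step =
      subst (λ zs → Φ a′ b′ 0 zs ≤ Φ a b 0 zs) (sym (list≡ k))
        (Φ-prefix {us = lower k} {xs = suc k ∷ top k ∷ after k} {ys = suc k ∷ top k ∷ after k} 0 0 0
          (proj₁ both) (λ d → step d (proj₂ both)))
      where
      both : All (λ z → a′ z ≡ a z × b′ z ≡ b z) (lower k) × All (λ z → a′ z ≡ a z × b′ z ≡ b z) (after k)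
      both = on-list {k} {λ z → a′ z ≡ a z × b′ z ≡ b z} same

  module _ {k : ℕ} {V : ℕ → Bool} (valid : Valid k V) where

    private
      plain : ℕ → ℕ
      plain m = bit (V (pred m))

      y : ℕ
      y = top k

    -- Row `suc k` joins its left neighbour, so `V` need not change. The F-interval that belongs to
    -- row `k`, so far counted at `top k`, now starts with row `suc k`: a tie between these two rows
    -- is broken.
    Ψ-left : Ψ (suc k) V ≤ Ψ k V
    Ψ-left = +-mono-≤ (+-mono-≤ Φ₁ Φ₂) (≤-reflexive (∑-new k (cong bit (invalid-above valid (m≤n⇒m≤1+n ≤-refl)))))
      where
      Vδ : V (suc k) ≡ false
      Vδ = invalid-above valid ≤-refl
      landing≡ : ∀ {z} → z ∈ list k → landing (suc k) V z ≡ plain z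
      landing≡ {z} z∈ rewrite Vδ | ≢⇒≡ᵇ (<⇒≢ (s≤s (list-≤ z∈))) with z ≡ᵇ top (suc k)
      ... | true  = +-identityʳ _
      ... | false = +-identityʳ _
      by : landing k V y ≡ plain y + plain (suc k)
      by = landing-top k V
      same : ∀ {z} → z ∈ list k → z ≢ suc k → z ≢ y → weight V z ≡ weight V z × plain z ≡ landing k V z
      same z∈ z≢ z≢′ = refl , sym (landing-other k V z≢ z≢′)
      same′ : ∀ {z} → z ∈ list k → z ≢ suc k → z ≢ y → plain z ≡ landing k V z × weight V z ≡ weight V z
      same′ z∈ z≢ z≢′ = swap (same z∈ z≢ z≢′)
      Φ₁ : Φ (weight V) (landing (suc k) V) 0 (list (suc k)) ≤ Φ (weight V) (landing k V) 0 (list k)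
      Φ₁ = begin
        Φ (weight V) (landing (suc k) V) 0 (list (suc k)) ≡⟨ Φ-new k (cong bit (invalid-above valid (m≤n⇒m≤1+n ≤-refl))) (landing-new (suc k) V) ⟩
        Φ (weight V) (landing (suc k) V) 0 (list k) ≡⟨ Φ-cong 0 (All.tabulate λ z∈ → refl , landing≡ z∈) ⟩
        Φ (weight V) plain 0 (list k) ≤⟨ Φ-tie k same (λ d → Φ-tieˡ (cong bit Vδ) (landing-new k V) by (cong bit Vδ) refl d (after k)) ⟩
        Φ (weight V) (landing k V) 0 (list k) ∎
        where open ≤-Reasoning
      Φ₂ : Φ (landing (suc k) V) (weight V) 0 (list (suc k)) ≤ Φ (landing k V) (weight V) 0 (list k)
      Φ₂ = begin
        Φ (landing (suc k) V) (weight V) 0 (list (suc k)) ≡⟨ Φ-new k (landing-new (suc k) V) (cong bit (invalid-above valid (m≤n⇒m≤1+n ≤-refl))) ⟩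
        Φ (landing (suc k) V) (weight V) 0 (list k) ≡⟨ Φ-cong 0 (All.tabulate λ z∈ → landing≡ z∈ , refl) ⟩
        Φ plain (weight V) 0 (list k) ≤⟨ Φ-tie k same′ (λ d → Φ-tieˡ′ (cong bit Vδ) (landing-new k V) by (≤-trans (bit≤1 (V y)) θ≥1) (cong bit Vδ) refl d (after k)) ⟩
        Φ (landing k V) (weight V) 0 (list k) ∎
        where open ≤-Reasoning

    module _ (1≤y : 1 ≤ y) (Vy : V y ≡ true) (next-top : top (suc k) ≡ suc y) where

      private
        V′ : ℕ → Bool
        V′ = V ∖ y ∪ suc k

        y≤k : y ≤ k
        y≤k = top-≤ k
        y≢δ : y ≢ suc k
        y≢δ = <⇒≢ (s≤s y≤k)
        V′δ : V′ (suc k) ≡ true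
        V′δ = ∪-same (V ∖ y) (suc k)
        V′y : V′ y ≡ false
        V′y = trans (∪-other (V ∖ y) y≢δ) (∖-same V y)
        V′other : ∀ {z} → z ≢ suc k → z ≢ y → V′ z ≡ V z
        V′other z≢ z≢′ = trans (∪-other (V ∖ y) z≢) (∖-other V z≢′)
        V′new : V′ (suc (suc k)) ≡ false
        V′new = trans (V′other (λ ()) (λ e → <⇒≢ (s≤s (m≤n⇒m≤1+n y≤k)) (sym e))) (invalid-above valid (m≤n⇒m≤1+n ≤-refl))
        Vδ : V (suc k) ≡ false
        Vδ = invalid-above valid ≤-refl

        landing≡ : ∀ {z} → z ∈ list k → landing (suc k) V′ z ≡ plain z
        landing≡ {z} z∈ with z ≟ suc y
        ... | yes refl = begin
          landing (suc k) V′ (suc y) ≡⟨ cong (landing (suc k) V′) next-top ⟨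
          landing (suc k) V′ (top (suc k)) ≡⟨ landing-top (suc k) V′ ⟩
          bit (V′ (pred (top (suc k)))) + bit (V′ (suc k)) ≡⟨ cong₂ (λ p q → bit (V′ (pred p)) + bit q) next-top V′δ ⟩
          bit (V′ y) + 1 ≡⟨ cong (λ p → bit p + 1) V′y ⟩
          1 ≡⟨ cong bit Vy ⟨
          bit (V y) ∎
          where open ≡-Reasoning
        ... | no z≢ = trans (landing-other (suc k) V′ (<⇒≢ (s≤s (list-≤ z∈))) (λ e → z≢ (trans e next-top)))
                            (cong bit (V′other (λ e → <⇒≢ (s≤s (pred-mono-≤ (list-≤ z∈))) e) (p≢ z z≢)))
          where
          p≢ : ∀ z → z ≢ suc y → pred z ≢ y
          p≢ zero    _  e = contradiction (subst (1 ≤_) (sym e) 1≤y) λ ()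
          p≢ (suc z) z≢ e = z≢ (cong suc e)

        by : landing k V y ≡ plain y + plain (suc k)
        by = landing-top k V
        same : ∀ {z} → z ∈ list k → z ≢ suc k → z ≢ y → weight V′ z ≡ weight V z × plain z ≡ landing k V z
        same z∈ z≢ z≢′ = cong bit (V′other z≢ z≢′) , sym (landing-other k V z≢ z≢′)
        same′ : ∀ {z} → z ∈ list k → z ≢ suc k → z ≢ y → plain z ≡ landing k V z × weight V′ z ≡ weight V z
        same′ z∈ z≢ z≢′ = swap (same z∈ z≢ z≢′)
        δ≡y : weight V′ (suc k) ≡ weight V y
        δ≡y = cong bit (trans V′δ (sym Vy))

      -- The repetition from `y` now starts one row earlier, with row `suc k`. Its F-interval starts
      -- with the new row and is thus counted at `top (suc k)`, that is at `suc y`, where it was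
      -- counted before. What remains is the tie between rows `suc k` and `y`.
      Ψ-right : Ψ (suc k) V′ ≤ Ψ k V
      Ψ-right = +-mono-≤ (+-mono-≤ Φ₁ Φ₂) (≤-reflexive ∑≡)
        where
        Φ₁ : Φ (weight V′) (landing (suc k) V′) 0 (list (suc k)) ≤ Φ (weight V) (landing k V) 0 (list k)
        Φ₁ = begin
          Φ (weight V′) (landing (suc k) V′) 0 (list (suc k)) ≡⟨ Φ-new k (cong bit V′new) (landing-new (suc k) V′) ⟩
          Φ (weight V′) (landing (suc k) V′) 0 (list k) ≡⟨ Φ-cong 0 (All.tabulate λ z∈ → refl , landing≡ z∈) ⟩
          Φ (weight V′) plain 0 (list k) ≤⟨ Φ-tie k same (λ d → Φ-tieʳ (cong bit Vδ) (landing-new k V) by δ≡y (cong bit V′y) d (after k)) ⟩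
          Φ (weight V) (landing k V) 0 (list k) ∎
          where open ≤-Reasoning
        Φ₂ : Φ (landing (suc k) V′) (weight V′) 0 (list (suc k)) ≤ Φ (landing k V) (weight V) 0 (list k)
        Φ₂ = begin
          Φ (landing (suc k) V′) (weight V′) 0 (list (suc k)) ≡⟨ Φ-new k (landing-new (suc k) V′) (cong bit V′new) ⟩
          Φ (landing (suc k) V′) (weight V′) 0 (list k) ≡⟨ Φ-cong 0 (All.tabulate λ z∈ → landing≡ z∈ , refl) ⟩
          Φ plain (weight V′) 0 (list k) ≤⟨ Φ-tie k same′ (λ d → Φ-tieʳ′ (cong bit Vδ) (landing-new k V) by (≤-trans (bit≤1 (V y)) θ≥1) δ≡y (cong bit V′y) d (after k)) ⟩
          Φ (landing k V) (weight V) 0 (list k) ∎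
          where open ≤-Reasoning
        ∑-list : ∀ {a : ℕ → ℕ} → a 0 ≡ 0 → ∑ a (rows (suc k)) ≡ ∑ a (lower k) + (a (suc k) + (a y + ∑ a (after k)))
        ∑-list {a} a0 = begin
          ∑ a (rows (suc k)) ≡⟨ +-identityʳ _ ⟨
          ∑ a (rows (suc k)) + 0 ≡⟨ cong (λ z → ∑ a (rows (suc k)) + (z + 0)) a0 ⟨
          ∑ a (rows (suc k)) + (a 0 + 0) ≡⟨ ∑-++ a (rows (suc k)) [ 0 ] ⟨
          ∑ a (list k) ≡⟨ cong (∑ a) (list≡ k) ⟩
          ∑ a (lower k ++ suc k ∷ top k ∷ after k) ≡⟨ ∑-++ a (lower k) _ ⟩
          ∑ a (lower k) + (a (suc k) + (a y + ∑ a (after k))) ∎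
          where open ≡-Reasoning
        V′0 : V′ 0 ≡ false
        V′0 = trans (V′other (λ ()) (<⇒≢ 1≤y)) (invalid-0 valid)
        ∑≡ : ∑ (weight V′) (rows (suc (suc k))) ≡ ∑ (weight V) (rows (suc k))
        ∑≡ = begin
          ∑ (weight V′) (rows (suc (suc k))) ≡⟨ ∑-new k (cong bit V′new) ⟩
          ∑ (weight V′) (rows (suc k)) ≡⟨ ∑-list (cong bit V′0) ⟩
          ∑ (weight V′) (lower k) + (weight V′ (suc k) + (weight V′ y + ∑ (weight V′) (after k)))
            ≡⟨ cong₂ _+_ (∑-cong (lower k) (λ z∈ → proj₁ (All.lookup (proj₁ (on-list same)) z∈)))
                 (cong₂ (λ p q → bit p + q) V′δ (cong₂ (λ p q → bit p + q) V′y (∑-cong (after k) (λ z∈ → proj₁ (All.lookup (proj₂ (on-list same)) z∈))))) ⟩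
          ∑ (weight V) (lower k) + (1 + (0 + ∑ (weight V) (after k)))
            ≡⟨ cong₂ (λ p q → ∑ (weight V) (lower k) + (bit p + (bit q + ∑ (weight V) (after k)))) Vδ Vy ⟨
          ∑ (weight V) (lower k) + (weight V (suc k) + (weight V y + ∑ (weight V) (after k))) ≡⟨ ∑-list (cong bit (invalid-0 valid)) ⟨
          ∑ (weight V) (rows (suc k)) ∎
          where open ≡-Reasoning

  -- The row at which `landing` counts the F-interval of a repetition that starts at row `e`.
  landing-row : ℕ → ℕ → ℕ
  landing-row k e = if e ≡ᵇ k then top k else suc e

  landing-row-last : ∀ k → landing-row k k ≡ top k
  landing-row-last k rewrite ≡ᵇ-refl k = refl

  landing-row-other : ∀ {k e} → e ≢ k → landing-row k e ≡ suc e
  landing-row-other e≢k rewrite ≢⇒≡ᵇ e≢k = refl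

  module _ {k e : ℕ} {V : ℕ → Bool} (1≤e : 1 ≤ e) (e≤k : e ≤ k) where

    private
      V′ : ℕ → Bool
      V′ = V ∪ e

      t : ℕ
      t = landing-row k e

      pred≢ : ∀ {z} → z ≢ suc e → pred z ≢ e
      pred≢ {zero}  z≢ p = <⇒≢ 1≤e p
      pred≢ {suc z} z≢ p = z≢ (cong suc p)

    landing-∪-other : ∀ {z} → z ≢ t → landing k V′ z ≡ landing k V z
    landing-∪-other {z} z≢t with z ≟ suc k
    ... | yes refl = trans (landing-new k V′) (sym (landing-new k V))
    ... | no z≢ with e ≟ k
    ...   | yes refl = trans (landing-other k V′ z≢ z≢top) (trans (cong bit (∪-other V (pred≢ z≢))) (sym (landing-other k V z≢ z≢top)))
      where
      z≢top : z ≢ top k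
      z≢top p = z≢t (trans p (sym (landing-row-last k)))
    ...   | no e≢k rewrite ≢⇒≡ᵇ z≢ | ∪-other V {e} {k} (λ p → e≢k (sym p))
                         | ∪-other V {e} {pred z} (pred≢ (λ p → z≢t (trans p (sym (landing-row-other e≢k))))) = refl

    landing-∪ : landing k V′ t ≤ suc (landing k V t) × 1 ≤ landing k V′ t
    landing-∪ with e ≟ k
    ... | yes refl rewrite landing-row-last k | landing-top k V′ | landing-top k V | ∪-same V k
                         | ∪-other V {k} {pred (top k)} (pred≢ (<⇒≢ (s≤s (top-≤ k))))
                         = ≤-trans (≤-reflexive (+-comm (bit (V (pred (top k)))) 1)) (s≤s (m≤m+n _ _)) , m≤n+m 1 _
    ... | no e≢k rewrite landing-row-other e≢k | ≢⇒≡ᵇ e≢k | ∪-same V e | ∪-other V {e} {k} (λ p → e≢k (sym p)) =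
          s≤s (m≤n+m _ (bit (V e))) , s≤s z≤n

    private
      weight-∪-other : ∀ {z} → z ≢ e → weight V′ z ≡ weight V z
      weight-∪-other z≢e = cong bit (∪-other V z≢e)

      weight-∪ : weight V′ e ≤ suc (weight V e)
      weight-∪ = ≤-trans (bit≤1 (V′ e)) (s≤s z≤n)

      weight-zero : ∀ {z} → weight V′ z ≡ 0 → weight V z ≡ 0
      weight-zero {z} eq with z ≟ e
      ... | no z≢e = trans (sym (weight-∪-other z≢e)) eq
      ... | yes refl = contradiction (trans (sym eq) (cong bit (∪-same V e))) λ ()

      landing-zero : ∀ {z} → landing k V′ z ≡ 0 → landing k V z ≡ 0
      landing-zero {z} eq with z ≟ t
      ... | no z≢t = trans (sym (landing-∪-other z≢t)) eq
      ... | yes refl = contradiction (subst (1 ≤_) eq (proj₂ landing-∪)) λ ()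

      weight-≤θ : ∀ V {z} → weight V z ≤ θ
      weight-≤θ V {z} = ≤-trans (bit≤1 (V z)) θ≥1

      landing-≤θ : ∀ V {z} → landing k V z ≤ θ
      landing-≤θ V {z} = ≤-trans (landing-≤2 k V z) θ≥2

      raise-landing : Φ (weight V′) (landing k V′) 0 (list k) ≤ 2 + Φ (weight V′) (landing k V) 0 (list k)
      raise-landing = Φ-raise 0 (list-unique k) (λ _ → landing-∪-other) (proj₁ landing-∪)

      raise-weight : Φ (landing k V′) (weight V′) 0 (list k) ≤ 2 + Φ (landing k V′) (weight V) 0 (list k)
      raise-weight = Φ-raise 0 (list-unique k) (λ _ → weight-∪-other) weight-∪

      more-weight : Φ (weight V′) (landing k V) 0 (list k) ≤ Φ (weight V) (landing k V) 0 (list k)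
      more-weight = Φ-mono 0 (list k) (λ {z} _ → weight-zero {z}) (λ _ → ≤-refl) (λ {z} _ → landing-≤θ V {z})

      more-landing : Φ (landing k V′) (weight V) 0 (list k) ≤ Φ (landing k V) (weight V) 0 (list k)
      more-landing = Φ-mono 0 (list k) (λ {z} _ → landing-zero {z}) (λ _ → ≤-refl) (λ {z} _ → weight-≤θ V {z})

      total : ∑ (weight V′) (rows (suc k)) ≤ suc (∑ (weight V) (rows (suc k)))
      total = ∑-raise (rows-unique (suc k)) (λ _ z≢e → ≤-reflexive (weight-∪-other z≢e)) weight-∪

    -- Row `e` is an additional weight in the second `Φ`, its landing row one in the first, and each
    -- costs 2 by `Φ-raise`. As borders they cost nothing, and the sum grows by 1.
    Ψ-∪ : Ψ k V′ ≤ 5 + Ψ k V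
    Ψ-∪ = ≤-trans (+-mono-≤ (+-mono-≤ (≤-trans raise-landing (+-monoʳ-≤ 2 more-weight)) (≤-trans raise-weight (+-monoʳ-≤ 2 more-landing))) total)
            (≤-reflexive (lem (Φ (weight V) (landing k V) 0 (list k)) (Φ (landing k V) (weight V) 0 (list k)) _))
      where
      lem : ∀ p q s → 2 + p + (2 + q) + suc s ≡ 5 + (p + q + s)
      lem = solve-∀

    private
      -- On the left stand `θ` and on the right the weight of the cutting row, at most 1; the
      -- difference 5 is the price of a new row.
      gained : ∀ {p q} → θ + p ≤ 1 + q → 2 + p + 3 ≤ q
      gained {p} h = s≤s⁻¹ (≤-trans (≤-reflexive (cong suc (+-comm (2 + p) 3))) h)

    -- Only the first `Φ` gains, as a repetition is a piece there. In the second, the start of the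
    -- new F-interval is merely one more border.
    Ψ-cut-repetition : ∀ us f ms ns vs → list k ≡ us ++ f ∷ ms ++ e ∷ ns ++ vs →
                       All (λ m → V m ≡ false) ms → V e ≡ false → All (λ m → V m ≡ false) ns → landing k V e ≤ 1 →
                       θ ≤ landing k V f + ∑ (landing k V) ms + landing k V e → θ ≤ landing k V e + ∑ (landing k V) ns →
                       Ψ k V′ ≤ Ψ k V
    Ψ-cut-repetition us f ms ns vs eq Vms Ve Vns le left right =
      ≤-trans (+-mono-≤ (+-mono-≤ raise-landing (≤-trans raise-weight (+-monoʳ-≤ 2 more-landing))) total)
        (≤-trans (≤-reflexive (lem (Φ (weight V′) (landing k V) 0 (list k)) _ _)) (+-monoˡ-≤ _ (+-monoˡ-≤ _ (gained (≤-trans gain (+-monoˡ-≤ _ le))))))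
      where
      lem : ∀ p q s → 2 + p + (2 + q) + suc s ≡ 2 + p + 3 + q + s
      lem = solve-∀
      gain : θ + Φ (weight V′) (landing k V) 0 (list k) ≤ landing k V e + Φ (weight V) (landing k V) 0 (list k)
      gain = subst (λ zs → θ + Φ (weight V′) (landing k V) 0 zs ≤ landing k V e + Φ (weight V) (landing k V) 0 zs) (sym eq)
               (Φ-gain 0 us f ms ns vs (λ _ → weight-∪-other) (≤-reflexive (sym (cong bit (∪-same V e)))) (cong bit Ve)
                 (subst Unique eq (list-unique k)) (All.map (cong bit) Vms) (All.map (cong bit) Vns) left right)

    Ψ-cut-interval : ∀ us f ms ns vs → list k ≡ us ++ f ∷ ms ++ t ∷ ns ++ vs →
                     All (λ m → landing k V m ≡ 0) ms → landing k V t ≡ 0 → All (λ m → landing k V m ≡ 0) ns →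
                     θ ≤ weight V f + ∑ (weight V) ms + weight V t → θ ≤ weight V t + ∑ (weight V) ns →
                     Ψ k V′ ≤ Ψ k V
    Ψ-cut-interval us f ms ns vs eq Lms Lt Lns left right =
      ≤-trans (+-mono-≤ (+-mono-≤ (≤-trans raise-landing (+-monoʳ-≤ 2 more-weight)) raise-weight) total)
        (≤-trans (≤-reflexive (lem (Φ (weight V) (landing k V) 0 (list k)) (Φ (landing k V′) (weight V) 0 (list k)) _))
          (+-monoˡ-≤ _ (+-monoʳ-≤ (Φ (weight V) (landing k V) 0 (list k)) (gained (≤-trans gain (+-monoˡ-≤ _ (bit≤1 (V t))))))))
      where
      lem : ∀ p q s → 2 + p + (2 + q) + suc s ≡ p + (2 + q + 3) + s
      lem = solve-∀
      gain : θ + Φ (landing k V′) (weight V) 0 (list k) ≤ weight V t + Φ (landing k V) (weight V) 0 (list k)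
      gain = subst (λ zs → θ + Φ (landing k V′) (weight V) 0 zs ≤ weight V t + Φ (landing k V) (weight V) 0 zs) (sym eq)
               (Φ-gain 0 us f ms ns vs (λ _ → landing-∪-other) (proj₂ landing-∪) Lt
                 (subst Unique eq (list-unique k)) Lms Lns left right)

-- Updates

runCount : List ℕ → ℕ
runCount xs = length (derun _≟_ xs)

changes : ℕ → List ℕ → ℕ
changes c []       = 0
changes c (x ∷ xs) = (if c ≡ᵇ x then 0 else 1) + changes x xs

runCount-∷ : ∀ c xs → runCount (c ∷ xs) ≡ suc (changes c xs)
runCount-∷ c []       = refl
runCount-∷ c (x ∷ xs) with c ≟ x | runCount-∷ x xs
... | yes refl | ih rewrite ≡ᵇ-refl c = ih
... | no c≢x   | ih rewrite ≢⇒≡ᵇ c≢x = cong suc ih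

changes-insert : ∀ p us c vs → changes p (us ++ vs) ≤ changes p (us ++ c ∷ vs)
changes-insert p [] c []       = z≤n
changes-insert p [] c (y ∷ vs) with p ≟ c
... | yes refl rewrite ≡ᵇ-refl p = ≤-refl
... | no p≢c rewrite ≢⇒≡ᵇ p≢c = +-monoˡ-≤ (changes y vs) (le (p ≡ᵇ y) (c ≡ᵇ y))
  where
  le : ∀ q r → (if q then 0 else 1) ≤ 1 + (if r then 0 else 1)
  le true  r = z≤n
  le false r = s≤s z≤n
changes-insert p (w ∷ us) c vs = +-monoʳ-≤ (if p ≡ᵇ w then 0 else 1) (changes-insert w us c vs)

-- Between two letters the new one brings two changes and removes at most one; at the end it brings
-- one.
changes-insert-new : ∀ p us c vs → lastChar id p us ≢ c → headIs id c vs ≡ false →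
                     suc (changes p (us ++ vs)) ≤ changes p (us ++ c ∷ vs)
changes-insert-new p [] c [] p≢c _ rewrite ≢⇒≡ᵇ p≢c = ≤-refl
changes-insert-new p [] c (y ∷ vs) p≢c q rewrite ≢⇒≡ᵇ p≢c | ≢⇒≡ᵇ {c} {y} (λ e → contradiction (trans (sym q) (subst (λ d → (y ≡ᵇ d) ≡ true) (sym e) (≡ᵇ-refl y))) λ ()) =
  s≤s (+-monoˡ-≤ (changes y vs) (le (p ≡ᵇ y)))
  where
  le : ∀ q → (if q then 0 else 1) ≤ 1
  le true  = z≤n
  le false = ≤-refl
changes-insert-new p (w ∷ us) c vs h q = ≤-trans (≤-reflexive (sym (+-suc (if p ≡ᵇ w then 0 else 1) _)))
  (+-monoʳ-≤ (if p ≡ᵇ w then 0 else 1) (changes-insert-new w us c vs h q))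

runCount-insert : ∀ p us c vs → runCount (p ∷ us ++ vs) ≤ runCount (p ∷ us ++ c ∷ vs)
runCount-insert p us c vs rewrite runCount-∷ p (us ++ vs) | runCount-∷ p (us ++ c ∷ vs) = s≤s (changes-insert p us c vs)

runCount-insert-new : ∀ p us c vs → lastChar id p us ≢ c → headIs id c vs ≡ false →
                      suc (runCount (p ∷ us ++ vs)) ≤ runCount (p ∷ us ++ c ∷ vs)
runCount-insert-new p us c vs h q rewrite runCount-∷ p (us ++ vs) | runCount-∷ p (us ++ c ∷ vs) = s≤s (changes-insert-new p us c vs h q)

lastChar-map : ∀ f p us → lastChar id (f p) (map f us) ≡ lastChar f (f p) us
lastChar-map f p []       = refl
lastChar-map f p (w ∷ us) = lastChar-map f w us

headIs-map : ∀ f c vs → headIs id c (map f vs) ≡ headIs f c vs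
headIs-map f c []       = refl
headIs-map f c (y ∷ vs) = refl

lastChar-cong : ∀ {f g : ℕ → ℕ} p {us} → All (λ x → f x ≡ g x) us → f p ≡ g p → lastChar f (f p) us ≡ lastChar g (g p) us
lastChar-cong p []       e = e
lastChar-cong p (e′ ∷ es) e = lastChar-cong _ es e′

lastChar-∷ʳ : ∀ f c us x → lastChar f c (us ++ [ x ]) ≡ f x
lastChar-∷ʳ f c []       x = refl
lastChar-∷ʳ f c (w ∷ us) x = lastChar-∷ʳ f (f w) us x

lastChar-++ : ∀ f c us w ws → lastChar f c (us ++ w ∷ ws) ≡ lastChar f (f w) ws
lastChar-++ f c []       w ws = refl
lastChar-++ f c (z ∷ us) w ws = lastChar-++ f (f z) us w ws

last-exists : ∀ (f : ℕ → ℕ) p us → ∃[ ws ] ∃[ x ] (p ∷ us ≡ ws ++ [ x ] × lastChar f (f p) us ≡ f x)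
last-exists f p []       = [] , p , refl , refl
last-exists f p (w ∷ us) with last-exists f w us
... | ws , x , eq , eq′ = p ∷ ws , x , cong (p ∷_) eq , eq′

module _ {A : ℕ → Bool} {chr : ℕ → Char} where

  Coherent-++ˡ : ∀ {c} us {vs} → Coherent A chr c (us ++ vs) → Coherent A chr c us
  Coherent-++ˡ []       co       = []
  Coherent-++ˡ (w ∷ us) (h ∷ co) = h ∷ Coherent-++ˡ us co

  Coherent-at : ∀ {c} us {z vs} → Coherent A chr c (us ++ z ∷ vs) → A z ≡ false → chr z ≡ lastChar chr c us
  Coherent-at []       (h ∷ _)  Az = h Az
  Coherent-at (w ∷ us) (_ ∷ co) Az = Coherent-at us co Az

  Coherent-rechar : ∀ {chr′ c} us {w vs} → Coherent A chr c (us ++ w ∷ vs) → A w ≡ true → Stops A vs →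
                    All (λ x → chr x ≡ chr′ x) us → All (λ x → chr x ≡ chr′ x) vs → Coherent A chr′ c (us ++ w ∷ vs)
  Coherent-rechar [] (h ∷ co) Aw [] _ _ = (λ e → contradiction (trans (sym Aw) e) λ ()) ∷ []
  Coherent-rechar {chr′} [] {w} (h ∷ (h′ ∷ co)) Aw (_∷_ {y} Ay vs) _ (e ∷ es) =
    (λ p → contradiction (trans (sym Aw) p) λ ()) ∷ ((λ p → contradiction (trans (sym Ay) p) λ ())
      ∷ subst (λ d → Coherent A chr′ d vs) e (Coherent-cong (All.map (refl ,_) es) co))
  Coherent-rechar {chr′} (x ∷ us) (h ∷ co) Aw st (e ∷ es) evs =
    (λ p → trans (sym e) (h p)) ∷ subst (λ d → Coherent A chr′ d _) e (Coherent-rechar us co Aw st es evs)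

  Coherent-insert : ∀ {A′ c} us {w vs} → Coherent A chr c (us ++ vs) → All (λ x → A x ≡ A′ x) us → A′ w ≡ true →
                    Stops A′ vs → All (λ x → A x ≡ A′ x) (drop 1 vs) → Coherent A′ chr c (us ++ w ∷ vs)
  Coherent-insert [] co _ A′w [] _ = (λ p → contradiction (trans (sym A′w) p) λ ()) ∷ []
  Coherent-insert [] (h ∷ co) _ A′w (A′y ∷ vs) es = (λ p → contradiction (trans (sym A′w) p) λ ())
    ∷ ((λ p → contradiction (trans (sym A′y) p) λ ()) ∷ Coherent-cong (All.map (_, refl) es) co)
  Coherent-insert (x ∷ us) (h ∷ co) (e ∷ es) A′w st es′ = (λ p → h (trans e p)) ∷ Coherent-insert us co es A′w st es′

  Coherent-merge : ∀ {A′ c} us {w vs} → Coherent A chr c (us ++ w ∷ vs) → lastChar chr c us ≡ chr w →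
                   All (λ x → A x ≡ A′ x) us → All (λ x → A x ≡ A′ x) vs → Coherent A′ chr c (us ++ w ∷ vs)
  Coherent-merge []       (h ∷ co) e _         es  = (λ _ → sym e) ∷ Coherent-cong (All.map (_, refl) es) co
  Coherent-merge (x ∷ us) (h ∷ co) e (e′ ∷ es) es′ = (λ p → h (trans e′ p)) ∷ Coherent-merge us co e es es′

-- The exceptional rows are treated one at a time: `h₁` takes the value of `g` at `x` and that of
-- `f` elsewhere.
∑-raise₂ : ∀ {f g : ℕ → ℕ} x y {xs} → Unique xs → (∀ {z} → z ∈ xs → z ≢ x → z ≢ y → g z ≤ f z) →
           (∀ z → g z ≤ 1) → ∑ g xs ≤ 2 + ∑ f xs
∑-raise₂ {f} {g} x y {xs} un h g≤1 =
  ≤-trans (∑-raise {h₁} {g} {y} un (λ z∈ z≢y → below z∈ z≢y) (≤-trans (g≤1 y) (s≤s z≤n)))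
          (s≤s (∑-raise {f} {h₁} {x} un (λ z∈ z≢x → h₁-other z≢x) h₁-x))
  where
  h₁ : ℕ → ℕ
  h₁ z = if z ≡ᵇ x then g z else f z
  h₁-other : ∀ {z} → z ≢ x → h₁ z ≤ f z
  h₁-other z≢x rewrite ≢⇒≡ᵇ z≢x = ≤-refl
  h₁-x : h₁ x ≤ suc (f x)
  h₁-x rewrite ≡ᵇ-refl x = ≤-trans (g≤1 x) (s≤s z≤n)
  below : ∀ {z} → z ∈ xs → z ≢ y → g z ≤ h₁ z
  below {z} z∈ z≢y with z ≟ x
  ... | yes refl rewrite ≡ᵇ-refl z = ≤-refl
  ... | no z≢x rewrite ≢⇒≡ᵇ z≢x = h z∈ z≢x z≢y

last-∈ : ∀ us {x : ℕ} xs {ws y} → us ++ x ∷ xs ≡ ws ++ [ y ] → y ∈ x ∷ xs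
last-∈ us {x} xs {ws} eq with last-exists id x xs
... | zs , l , eq′ , _ with ∷ʳ-injectiveʳ (us ++ zs) ws (trans (++-assoc us zs [ l ]) (trans (cong (us ++_) (sym eq′)) eq))
...   | refl = subst (l ∈_) (sym eq′) (∈-++⁺ʳ zs (here refl))

-- The invariant

module UpdateStep (n : ℕ) (ch : ℕ → ℕ) (ch-zero : ch 0 ≡ 1) (ch-pos : ∀ {m} → 1 ≤ m → m < n → 1 < ch m) where

  open RowFacts n ch ch-zero ch-pos public
  open Potential ch public

  1⊏ : ∀ {m} → 2 ≤ m → m ≤ n → 1 ⊏ m
  1⊏ {suc m} (s≤s 1≤m) m<n = char< (subst (_< ch m) (sym ch-zero) (ch-pos 1≤m m<n))

  -- Row 1 is the suffix `$`, the smallest of all.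
  rows-head : ∀ {δ} → 1 ≤ δ → δ ≤ n → ∃[ tl ] rows δ ≡ 1 ∷ tl
  rows-head {δ} 1≤δ δ≤n with rows δ | rows-sorted δ | rows⁺ δ ≤-refl 1≤δ | (λ {m} → rows-bounds {m} δ)
  ... | x ∷ xs | s | here refl | _ = xs , refl
  ... | x ∷ xs | (p ∷ _) | there 1∈ | bd with bd (here refl)
  ...   | 1≤x , x≤δ with x ≟ 1
  ...     | yes refl = contradiction (All.lookup p 1∈) ⊏-irrefl
  ...     | no x≢1 = contradiction (All.lookup p 1∈) (⊏-asym (1⊏ (≤∧≢⇒< 1≤x (λ e → x≢1 (sym e))) (≤-trans x≤δ δ≤n)))

  lower-head : ∀ {k} → 1 ≤ k → k < n → ∃[ tl ] lower k ≡ 1 ∷ tl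
  lower-head {k} 1≤k k<n with rows-head 1≤k (<⇒≤ k<n)
  ... | tl , eq rewrite eq with 1 ⊏? suc k
  ...   | yes _ = _ , refl
  ...   | no ¬p = contradiction (1⊏ (s≤s 1≤k) k<n) ¬p

  lower-⊏ : ∀ k → All (_⊏ suc k) (lower k)
  lower-⊏ k = All.all-filter (_⊏? suc k) (rows k)

  upper-⊏ : ∀ k → All (suc k ⊏_) (upper k)
  upper-⊏ k = All.all-filter (suc k ⊏?_) (rows k)

  lower-∈ : ∀ {k z} → z ∈ lower k → z ∈ rows k
  lower-∈ {k} {z} z∈ = subst (z ∈_) (sym (rows-split k)) (∈-++⁺ˡ z∈)

  upper-∈ : ∀ {k z} → z ∈ upper k → z ∈ rows k
  upper-∈ {k} {z} z∈ = subst (z ∈_) (sym (rows-split k)) (∈-++⁺ʳ (lower k) z∈)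

  -- The marks that the DBWT really has: `V`, the row of `$` and the row after it. If `$` is in the
  -- last row, `top k` is 0, which is not a row, so the mark there has no effect.
  starts : ℕ → (ℕ → Bool) → ℕ → Bool
  starts k V = V ∪ suc k ∪ top k

  record Represents (A : ℕ → Bool) (δ : ℕ) (D : DBWT) : Set where
    field
      D≡       : D ≡ toDBWT A (chr δ) (rows δ)
      coherent : ∀ {tl} → rows δ ≡ 1 ∷ tl → Coherent A (chr δ) (chr δ 1) tl

  -- The bit tells apart a row after `$` that starts a repetition of its own from one that became a
  -- start only through `$`. In the latter case both neighbours of `$` have the same character, on
  -- which the choice of merges depends.
  data Flag (k : ℕ) (V : ℕ → Bool) : Bool → Set where
    whole : (∀ {y ys} → upper k ≡ y ∷ ys → V y ≡ true) → Flag k V false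
    split : ∀ us x y vs → lower k ≡ us ++ [ x ] → upper k ≡ y ∷ vs → V y ≡ false → ch x ≡ ch y → Flag k V true

  -- The runs in `bound` are those of `L_(k+1)` with `$` removed. In this string an update inserts
  -- just the letter `ch (suc k)`, at the place of the old `$`. The factor 10 pays for two new rows
  -- of `V`.
  record State (k : ℕ) (D : DBWT) (s : Bool) : Set where
    field
      V          : ℕ → Bool
      valid      : Valid k V
      represents : Represents (starts k V) (suc k) D
      first      : 1 ≤ k → V 1 ≡ true
      flag       : Flag k V s
      bound      : Ψ k V ≤ 10 * runCount (map ch (rows k))

  -- The new row comes before or behind row `suc k`, and `mid` are the rows between the two.
  data Side (k : ℕ) : Set where
    before : ∀ mid → lower k ≡ lower (suc k) ++ mid → upper (suc k) ≡ mid ++ suc k ∷ upper k → suc (suc k) ⊏ suc k → Side k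
    behind : ∀ mid → lower (suc k) ≡ lower k ++ suc k ∷ mid → upper k ≡ mid ++ upper (suc k) → suc k ⊏ suc (suc k) → Side k

  side : ∀ k → Side k
  side k with ⊏-cmp (suc k) (suc (suc k))
  ... | tri≈ _ () _
  ... | tri< p _ _ = behind (filter (_⊏? suc (suc k)) (upper k)) lower≡ (trans split≡ (cong (filter (_⊏? suc (suc k)) (upper k) ++_) (sym upper≡))) p
    where
    lower≡ : lower (suc k) ≡ lower k ++ suc k ∷ filter (_⊏? suc (suc k)) (upper k)
    lower≡ = trans (filter-++ (_⊏? suc (suc k)) (lower k) (suc k ∷ upper k))
      (cong₂ _++_ (filter-all (_⊏? suc (suc k)) (All.map (λ q → ⊏-trans q p) (lower-⊏ k))) (here-yes (suc k ⊏? suc (suc k))))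
      where
      here-yes : ∀ d → filter (_⊏? suc (suc k)) (suc k ∷ upper k) ≡ suc k ∷ filter (_⊏? suc (suc k)) (upper k)
      here-yes _ with suc k ⊏? suc (suc k)
      ... | yes _ = refl
      ... | no ¬p = contradiction p ¬p
    upper≡ : upper (suc k) ≡ filter (suc (suc k) ⊏?_) (upper k)
    upper≡ = trans (filter-++ (suc (suc k) ⊏?_) (lower k) (suc k ∷ upper k))
      (cong₂ _++_ (filter-none (suc (suc k) ⊏?_) (All.map (λ q → ⊏-asym (⊏-trans q p)) (lower-⊏ k))) here-no)
      where
      here-no : filter (suc (suc k) ⊏?_) (suc k ∷ upper k) ≡ filter (suc (suc k) ⊏?_) (upper k)
      here-no with suc (suc k) ⊏? suc k
      ... | yes q = contradiction q (⊏-asym p)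
      ... | no _  = refl
    split≡ : upper k ≡ filter (_⊏? suc (suc k)) (upper k) ++ filter (suc (suc k) ⊏?_) (upper k)
    split≡ = sorted-split (suc (suc k)) (AllPairs.tail (AllPairs-++⁻ʳ (lower k) (rows-sorted (suc k))))
               (All.tabulate λ z∈ e → <⇒≢ (s≤s (m≤n⇒m≤1+n (proj₂ (rows-bounds k (upper-∈ {k} z∈))))) e)
  ... | tri> _ _ p = before (filter (suc (suc k) ⊏?_) (lower k)) (trans split≡ (cong (_++ filter (suc (suc k) ⊏?_) (lower k)) (sym lower≡))) upper≡ p
    where
    lower≡ : lower (suc k) ≡ filter (_⊏? suc (suc k)) (lower k)
    lower≡ = trans (filter-++ (_⊏? suc (suc k)) (lower k) (suc k ∷ upper k))
      (trans (cong (filter (_⊏? suc (suc k)) (lower k) ++_) (filter-none (_⊏? suc (suc k)) (⊏-asym p ∷ All.map (λ q → ⊏-asym (⊏-trans p q)) (upper-⊏ k))))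
        (++-identityʳ _))
    upper≡ : upper (suc k) ≡ filter (suc (suc k) ⊏?_) (lower k) ++ suc k ∷ upper k
    upper≡ = trans (filter-++ (suc (suc k) ⊏?_) (lower k) (suc k ∷ upper k))
      (cong (filter (suc (suc k) ⊏?_) (lower k) ++_) (filter-all (suc (suc k) ⊏?_) (p ∷ All.map (⊏-trans p) (upper-⊏ k))))
    split≡ : lower k ≡ filter (_⊏? suc (suc k)) (lower k) ++ filter (suc (suc k) ⊏?_) (lower k)
    split≡ = sorted-split (suc (suc k)) (AllPairs-++⁻ˡ (lower k) (rows-sorted (suc k)))
               (All.tabulate λ z∈ e → <⇒≢ (s≤s (m≤n⇒m≤1+n (proj₂ (rows-bounds k (lower-∈ {k} z∈))))) e)

  -- Neighbours of the replaced `$` once the new one is inserted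

  module _ {k : ℕ} (δ<n : suc k < n) where

    private
      δ : ℕ
      δ = suc k

      chr′ : ℕ → Char
      chr′ = chr (suc δ)

      chr-old : ∀ {z} → z ≤ δ → chr′ z ≡ ch z
      chr-old z≤δ = chr-other (<⇒≢ (s≤s z≤δ))

      ch-δ : ch δ ≢ $
      ch-δ e = <⇒≢ (ch-pos (s≤s z≤n) δ<n) (sym e)

      $≢ : chr′ (suc δ) ≢ ch δ
      $≢ e = ch-δ (trans (sym e) (chr-last (suc δ)))

      top-lower : ∀ {z} → z ∈ lower δ → 1 ≤ z → top δ ≢ z
      top-lower {z} z∈ 1≤z e with upper δ in eq
      ... | [] = contradiction (subst (1 ≤_) (sym e) 1≤z) λ ()
      ... | y ∷ ys = ⊏-irrefl (subst (z ⊏_) e (⊏-trans (All.lookup (lower-⊏ δ) z∈) (All.lookup (upper-⊏ δ) (subst (y ∈_) (sym eq) (here refl)))))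

    -- The new repetition `c` is in row `δ`, and `$` now is in row `suc δ`. The fields say that an
    -- old neighbour of row `δ` with character `c` is still its neighbour, that no such neighbour is
    -- new, and, by the inequalities with `top δ`, that the mark to be removed in a merge is not one
    -- that the new `$` requires.
    record Around : Set where
      field
        l₂ vs₂  : List ℕ
        rows≡   : rows (suc δ) ≡ (1 ∷ l₂) ++ δ ∷ vs₂
        place   : (if suc (length (lower k)) <ᵇ suc (length (lower δ)) then length (lower k) else suc (length (lower k))) ≡ suc (length l₂)
        left⇒   : ∀ {l′} → lower k ≡ 1 ∷ l′ → lastChar chr′ (chr′ 1) l₂ ≡ ch δ → lastChar ch (ch 1) l′ ≡ ch δ
        left⇐   : ∀ {l′} → lower k ≡ 1 ∷ l′ → lastChar ch (ch 1) l′ ≡ ch δ → lastChar chr′ (chr′ 1) l₂ ≡ ch δ × top δ ≢ δ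
        right≡  : headIs chr′ (ch δ) vs₂ ≡ headIs ch (ch δ) (upper k)
        right-∷ : ∀ {y ys} → upper k ≡ y ∷ ys → ch y ≡ ch δ → (∃[ zs ] vs₂ ≡ y ∷ zs) × top δ ≢ y
        stops   : ∀ {A} → A (suc δ) ≡ true → A (top k) ≡ true → Stops A vs₂

    around : 1 ≤ k → Around
    around 1≤k with side k | lower-head {k} 1≤k (<-trans (n<1+n k) δ<n) | lower-head {δ} (s≤s z≤n) δ<n
    ... | before mid low≡ up≡ sδ⊏δ | l′ , low₁ | l″ , low₂ = record
      { l₂ = l″ ++ suc δ ∷ mid ; vs₂ = upper k
      ; rows≡ = trans (cong₂ (λ p q → p ++ suc δ ∷ q) low₂ up≡) (cong (1 ∷_) (sym (++-assoc l″ (suc δ ∷ mid) (δ ∷ upper k))))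
      ; place = place′
      ; left⇒ = left⇒′ mid refl
      ; left⇐ = left⇐′ up≡
      ; right≡ = right≡′ (upper k) (λ z∈ → upper-∈ {k} z∈)
      ; right-∷ = λ {y} {ys} eq _ → (ys , eq) , top≢ mid up≡ y (subst (y ∈_) (sym eq) (here refl))
      ; stops = λ _ At → stops′ (upper k) At refl
      }
      where
      stops′ : ∀ {A} vs → A (top k) ≡ true → upper k ≡ vs → Stops A vs
      stops′ [] At eq = []
      stops′ {A} (y ∷ ys) At eq = subst (λ zs → A (headOr0 zs) ≡ true) eq At ∷ ys
      place′ : (if suc (length (lower k)) <ᵇ suc (length (lower δ)) then length (lower k) else suc (length (lower k))) ≡ suc (length (l″ ++ suc δ ∷ mid))
      place′ with suc (length (lower k)) <ᵇ suc (length (lower δ)) in eq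
      ... | true = contradiction (<ᵇ⇒< (suc (length (lower k))) (suc (length (lower δ))) (subst IsTrue (sym eq) _))
                     (≤⇒≯ (s≤s (≤-trans (m≤m+n (length (lower δ)) (length mid)) (≤-reflexive (sym (trans (cong length low≡) (length-++ (lower δ))))))))
      ... | false = cong suc (begin
            length (lower k) ≡⟨ trans (cong length low≡) (length-++ (lower δ)) ⟩
            length (lower δ) + length mid ≡⟨ cong (λ p → length p + length mid) low₂ ⟩
            suc (length l″ + length mid) ≡⟨ +-suc (length l″) (length mid) ⟨
            length l″ + suc (length mid) ≡⟨ length-++ l″ ⟨
            length (l″ ++ suc δ ∷ mid) ∎)
        where open ≡-Reasoning
      mid-≤ : ∀ {m ms} → mid ≡ m ∷ ms → All (λ z → chr′ z ≡ ch z) (m ∷ ms)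
      mid-≤ eq = All.tabulate (λ {z} z∈ → chr-old (m≤n⇒m≤1+n (proj₂ (rows-bounds k (lower-∈ {k} (subst (z ∈_) (sym low≡) (∈-++⁺ʳ (lower δ) (subst (z ∈_) (sym eq) z∈))))))))
      last-mid : ∀ {m ms l′} → mid ≡ m ∷ ms → lower k ≡ 1 ∷ l′ → lastChar chr′ (chr′ 1) (l″ ++ suc δ ∷ m ∷ ms) ≡ lastChar ch (ch 1) l′
      last-mid {m} {ms} {l′} eq low₁ = begin
        lastChar chr′ (chr′ 1) (l″ ++ suc δ ∷ m ∷ ms) ≡⟨ lastChar-++ chr′ (chr′ 1) l″ (suc δ) (m ∷ ms) ⟩
        lastChar chr′ (chr′ m) ms ≡⟨ lastChar-cong m (All.tail (mid-≤ eq)) (All.head (mid-≤ eq)) ⟩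
        lastChar ch (ch m) ms ≡⟨ lastChar-++ ch (ch 1) l″ m ms ⟨
        lastChar ch (ch 1) (l″ ++ m ∷ ms) ≡⟨ cong (lastChar ch (ch 1)) (proj₂ (∷-injective (trans (sym low₁) (trans low≡ (cong₂ _++_ low₂ eq))))) ⟨
        lastChar ch (ch 1) l′ ∎
        where open ≡-Reasoning
      left⇒′ : ∀ ms → mid ≡ ms → ∀ {l′} → lower k ≡ 1 ∷ l′ →
               lastChar chr′ (chr′ 1) (l″ ++ suc δ ∷ mid) ≡ ch δ → lastChar ch (ch 1) l′ ≡ ch δ
      left⇒′ []       eq _ e = contradiction (trans (sym (trans (cong (λ zs → lastChar chr′ (chr′ 1) (l″ ++ suc δ ∷ zs)) eq) (lastChar-++ chr′ (chr′ 1) l″ (suc δ) []))) e) $≢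
      left⇒′ (m ∷ ms) eq low₁ e = trans (sym (trans (cong (λ zs → lastChar chr′ (chr′ 1) (l″ ++ suc δ ∷ zs)) eq) (last-mid eq low₁))) e
      -- With nothing between the new row and row `δ`, the new row would separate row `δ` from its
      -- left neighbour `x`, which is impossible if `x` has the same character.
      no-left : mid ≡ [] → ∀ {l′} → lower k ≡ 1 ∷ l′ → lastChar ch (ch 1) l′ ≢ ch δ
      no-left refl {l′} low₁ e with last-exists ch 1 l′
      ... | ws , x , eq , ex = new-row-not-right-of (s≤s z≤n) δ<n {x} x∈
              (λ w∈ → no-gap ws (subst Sorted rows-x (rows-sorted δ)) (subst (_ ∈_) rows-x w∈))
              (trans (sym ex) e) (All.lookup (lower-⊏ k) x∈lower) (All.lookup (lower-⊏ δ) (subst (x ∈_) (trans low≡ (++-identityʳ (lower δ))) x∈lower)) sδ⊏δ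
        where
        lower≡ : lower k ≡ ws ++ [ x ]
        lower≡ = trans low₁ eq
        x∈lower : x ∈ lower k
        x∈lower = subst (x ∈_) (sym lower≡) (∈-++⁺ʳ ws (here refl))
        x∈ : x ∈ rows δ
        x∈ = ∈-++⁺ˡ x∈lower
        rows-x : rows δ ≡ ws ++ x ∷ δ ∷ upper k
        rows-x = trans (cong (_++ δ ∷ upper k) lower≡) (++-assoc ws [ x ] (δ ∷ upper k))
      left⇐′ : upper δ ≡ mid ++ δ ∷ upper k → ∀ {l′} → lower k ≡ 1 ∷ l′ →
               lastChar ch (ch 1) l′ ≡ ch δ → lastChar chr′ (chr′ 1) (l″ ++ suc δ ∷ mid) ≡ ch δ × top δ ≢ δ
      left⇐′ up≡ low₁ e = helper mid refl
        where
        helper : ∀ ms → mid ≡ ms → lastChar chr′ (chr′ 1) (l″ ++ suc δ ∷ mid) ≡ ch δ × top δ ≢ δ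
        helper []       eq = contradiction e (no-left eq low₁)
        helper (m ∷ ms) eq = trans (cong (λ zs → lastChar chr′ (chr′ 1) (l″ ++ suc δ ∷ zs)) eq) (trans (last-mid eq low₁) e)
          , λ t → <⇒≢ (s≤s (proj₂ (rows-bounds k (lower-∈ {k} (subst (m ∈_) (sym low≡) (∈-++⁺ʳ (lower δ) (subst (m ∈_) (sym eq) (here refl))))))))
                    (trans (sym (cong headOr0 (trans up≡ (cong (_++ δ ∷ upper k) eq)))) t)
      right≡′ : ∀ vs → (∀ {z} → z ∈ vs → z ∈ rows k) → headIs chr′ (ch δ) vs ≡ headIs ch (ch δ) vs
      right≡′ []       _ = refl
      right≡′ (y ∷ ys) h = cong (_≡ᵇ ch δ) (chr-old (m≤n⇒m≤1+n (proj₂ (rows-bounds k (h (here refl))))))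
      top≢ : ∀ mid → upper δ ≡ mid ++ δ ∷ upper k → ∀ y → y ∈ upper k → top δ ≢ y
      top≢ [] up≡ y y∈ t = <⇒≢ (s≤s (proj₂ (rows-bounds k (upper-∈ {k} y∈)))) (trans (sym t) (cong headOr0 up≡))
      top≢ (m ∷ ms) up≡ y y∈ t with subst Sorted up≡ (AllPairs-++⁻ʳ (lower δ) (subst Sorted (rows-split δ) (rows-sorted δ)))
      ... | p ∷ _ = ⊏⇒≢ (All.lookup p (∈-++⁺ʳ ms (there y∈))) (trans (sym (cong headOr0 up≡)) t)
    ... | behind mid low≡ up≡ δ⊏sδ | l′ , low₁ | l″ , low₂ = record
      { l₂ = l′ ; vs₂ = mid ++ suc δ ∷ upper δ
      ; rows≡ = trans (cong (_++ suc δ ∷ upper δ) (trans low≡ (cong (_++ δ ∷ mid) low₁))) (++-assoc (1 ∷ l′) (δ ∷ mid) (suc δ ∷ upper δ))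
      ; place = place′
      ; left⇒ = λ low₃ e → trans (sym (last≡ low₃)) e
      ; left⇐ = λ low₃ e → trans (last≡ low₃) e
                         , top-lower (subst (δ ∈_) (sym low≡) (∈-++⁺ʳ (lower k) (here refl))) (s≤s z≤n)
      ; right≡ = right≡′ mid refl
      ; right-∷ = λ eq e → right-∷′ mid refl eq e
      ; stops = λ {A} As At → stops′ {A} mid refl As At
      }
      where
      place′ : (if suc (length (lower k)) <ᵇ suc (length (lower δ)) then length (lower k) else suc (length (lower k))) ≡ suc (length l′)
      place′ with suc (length (lower k)) <ᵇ suc (length (lower δ)) in eq
      ... | true  = cong length low₁
      ... | false = contradiction (<⇒<ᵇ (s≤s lt)) (subst IsTrue eq)
        where
        lt : length (lower k) < length (lower δ)
        lt = ≤-trans (≤-reflexive (+-comm 1 _)) (≤-trans (+-monoʳ-≤ (length (lower k)) (s≤s z≤n)) (≤-reflexive (sym (trans (cong length low≡) (length-++ (lower k))))))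
      last≡ : ∀ {l‴} → lower k ≡ 1 ∷ l‴ → lastChar chr′ (chr′ 1) l′ ≡ lastChar ch (ch 1) l‴
      last≡ low₃ with trans (sym low₁) low₃
      ... | refl = lastChar-cong 1 (All.tabulate (λ {z} z∈ → chr-old (m≤n⇒m≤1+n (proj₂ (rows-bounds k (lower-∈ {k} (subst (z ∈_) (sym low₁) (there z∈))))))))
                     (chr-old (s≤s z≤n))
      no-right : mid ≡ [] → ∀ {y ys} → upper k ≡ y ∷ ys → ch y ≢ ch δ
      no-right refl {y} {ys} eq e = new-row-not-left-of (s≤s z≤n) δ<n {y} (∈-++⁺ʳ (lower k) (there y∈))
          (λ w∈ → no-gap (lower k) (subst Sorted rows-y (rows-sorted δ)) (subst (_ ∈_) rows-y w∈)) e
          (All.lookup (upper-⊏ k) y∈) (All.lookup (upper-⊏ δ) (subst (y ∈_) up≡ y∈)) δ⊏sδ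
        where
        y∈ : y ∈ upper k
        y∈ = subst (y ∈_) (sym eq) (here refl)
        rows-y : rows δ ≡ lower k ++ δ ∷ y ∷ ys
        rows-y = cong (λ zs → lower k ++ δ ∷ zs) eq
      right≡′ : ∀ ms → mid ≡ ms → headIs chr′ (ch δ) (mid ++ suc δ ∷ upper δ) ≡ headIs ch (ch δ) (upper k)
      right≡′ [] refl = trans (≢⇒≡ᵇ $≢) (sym (none (upper k) refl))
        where
        none : ∀ zs → upper k ≡ zs → headIs ch (ch δ) zs ≡ false
        none []       _  = refl
        none (y ∷ ys) eq = ≢⇒≡ᵇ (no-right refl eq)
      right≡′ (m ∷ ms) refl = trans (cong (_≡ᵇ ch δ) (chr-old (m≤n⇒m≤1+n (proj₂ (rows-bounds k (upper-∈ {k} (subst (m ∈_) (sym up≡) (here refl))))))))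
                                (cong (headIs ch (ch δ)) (sym up≡))
      right-∷′ : ∀ ms → mid ≡ ms → ∀ {y ys} → upper k ≡ y ∷ ys → ch y ≡ ch δ → (∃[ zs ] mid ++ suc δ ∷ upper δ ≡ y ∷ zs) × top δ ≢ y
      right-∷′ [] refl eq e = contradiction e (no-right refl eq)
      right-∷′ (m ∷ ms) refl {y} eq e with ∷-injective (trans (sym up≡) eq)
      ... | refl , _ = (_ , refl) , top-lower (subst (m ∈_) (sym low≡) (∈-++⁺ʳ (lower k) (there (here refl))))
                                      (proj₁ (rows-bounds k (upper-∈ {k} (subst (m ∈_) (sym up≡) (here refl)))))
      stops′ : ∀ {A} ms → mid ≡ ms → A (suc δ) ≡ true → A (top k) ≡ true → Stops A (mid ++ suc δ ∷ upper δ)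
      stops′ [] refl As _ = As ∷ _
      stops′ {A} (m ∷ ms) refl _ At = subst (λ z → A z ≡ true) (cong headOr0 up≡) At ∷ _

  -- The operations of the algorithm with positions expressed by rows: `lower δ` has `ins - 1` rows
  -- and `lower k` has `rep - 1`. They are identified with the original ones once the text is
  -- related to `ch`.
  updated : ℕ → DBWT → DBWT
  updated δ D = insert$ (length (lower δ)) (replace$ (ch δ) D)

  splitting : ℕ → DBWT → Bool
  splitting δ D = insert$Splits (length (lower δ)) (replace$ (ch δ) D)

  merged : ℕ → Bool → DBWT → DBWT
  merged k s D =
    if adjacentTo$ (ch (suc k)) D
    then mergeAt s (if suc (length (lower k)) <ᵇ suc (length (lower (suc k))) then length (lower k) else suc (length (lower k))) (updated (suc k) D)
    else updated (suc k) D

  Stops-top : ∀ {A} k → A (top k) ≡ true → Stops A (upper k)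
  Stops-top k At with upper k
  ... | []     = []
  ... | y ∷ ys = At ∷ ys

  module _ {k : ℕ} (δ<n : suc k < n) {V : ℕ → Bool} {D : DBWT} (rep : Represents (starts k V) (suc k) D) where

    private
      δ : ℕ
      δ = suc k

      chr′ : ℕ → Char
      chr′ = chr (suc δ)

      A A₂ : ℕ → Bool
      A = starts k V
      A₂ = A ∪ suc δ ∪ top δ

      k<n : k < n
      k<n = <-trans (n<1+n k) δ<n

      chr-old : ∀ {z} → z ≤ δ → chr′ z ≡ ch z
      chr-old z≤δ = chr-other (<⇒≢ (s≤s z≤δ))

      chr-rec : ∀ {z} → z ∈ rows k → chr δ z ≡ chr′ z
      chr-rec z∈ with rows-bounds k z∈
      ... | _ , z≤k = trans (chr-other (<⇒≢ (s≤s z≤k))) (sym (chr-old (m≤n⇒m≤1+n z≤k)))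

      chr-≢$ : ∀ {z} → z ∈ rows k → chr δ z ≢ $
      chr-≢$ z∈ e with rows-bounds k z∈
      ... | 1≤z , z≤k = <⇒≢ (chr-pos (<⇒≤ δ<n) (rows⁺ δ 1≤z (m≤n⇒m≤1+n z≤k)) (<⇒≢ (s≤s z≤k))) (sym e)

      Aδ : A δ ≡ true
      Aδ = ∪-true (V ∪ δ) (top k) (∪-same V δ)

      At : A (top k) ≡ true
      At = ∪-same (V ∪ δ) (top k)

      lower-tail : ∀ {l′} → lower k ≡ 1 ∷ l′ → ∀ {P : ℕ → Set} → (∀ {z} → z ∈ rows k → P z) → All P l′
      lower-tail low h = All.tabulate (λ {z} z∈ → h (lower-∈ {k} (subst (z ∈_) (sym low) (there z∈))))

      upper-all : ∀ {P : ℕ → Set} → (∀ {z} → z ∈ rows k → P z) → All P (upper k)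
      upper-all h = All.tabulate (λ z∈ → h (upper-∈ {k} z∈))

      rows-∷ : ∀ {l′} → lower k ≡ 1 ∷ l′ → rows δ ≡ 1 ∷ l′ ++ δ ∷ upper k
      rows-∷ low = cong (_++ δ ∷ upper k) low

      one : ∀ {l′} → lower k ≡ 1 ∷ l′ → 1 ∈ rows k
      one low = lower-∈ {k} (subst (1 ∈_) (sym low) (here refl))

    replaced : replace$ (ch δ) D ≡ toDBWT A chr′ (rows δ) × (∀ {tl} → rows δ ≡ 1 ∷ tl → Coherent A chr′ (chr′ 1) tl)
    replaced = by-cases k refl
      where
      open Represents rep
      by-cases : ∀ j → k ≡ j → replace$ (ch δ) D ≡ toDBWT A chr′ (rows δ) × (∀ {tl} → rows δ ≡ 1 ∷ tl → Coherent A chr′ (chr′ 1) tl)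
      by-cases zero refl = trans (cong (replace$ (ch δ)) D≡) (only (ch 0) ch-zero) , λ { refl → [] }
        where
        only : ∀ c → c ≡ 1 → replace$ (ch 1) ((c ^^ 1) ∷ []) ≡ (ch 1 ^^ 1) ∷ []
        only _ refl = refl
      by-cases (suc _) eqk with lower-head {k} (subst (1 ≤_) (sym eqk) (s≤s z≤n)) k<n
      ... | l′ , low = (begin
          replace$ (ch δ) D ≡⟨ cong (replace$ (ch δ)) (trans D≡ (cong (toDBWT A (chr δ)) (rows-∷ low))) ⟩
          replace$ (ch δ) (segments A (chr δ) (chr δ 1) 1 (l′ ++ δ ∷ upper k)) ≡⟨ replace$-at A (chr δ) chr′ (chr δ 1) 1 l′ (chr-≢$ (one low)) (lower-tail low chr-≢$) (upper-all chr-≢$)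
                                                                                  (chr-last δ) Aδ (Stops-top k At) (chr-old ≤-refl) (lower-tail low chr-rec) (upper-all chr-rec) ⟩
          segments A chr′ (chr δ 1) 1 (l′ ++ δ ∷ upper k) ≡⟨ cong (λ c → segments A chr′ c 1 (l′ ++ δ ∷ upper k)) (chr-rec (one low)) ⟩
          toDBWT A chr′ (1 ∷ l′ ++ δ ∷ upper k) ≡⟨ cong (toDBWT A chr′) (rows-∷ low) ⟨
          toDBWT A chr′ (rows δ) ∎)
        , λ eq → subst₂ (Coherent A chr′) (chr-rec (one low)) (proj₂ (∷-injective (trans (sym (rows-∷ low)) eq)))
                   (Coherent-rechar l′ (coherent (rows-∷ low)) Aδ (Stops-top k At) (lower-tail low chr-rec) (upper-all chr-rec))
        where open ≡-Reasoning

    private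
      A₂-old : ∀ {z} → z ≤ δ → z ≢ top δ → A z ≡ A₂ z
      A₂-old {z} z≤δ z≢ = sym (trans (∪-other (A ∪ suc δ) z≢) (∪-other A (<⇒≢ (s≤s z≤δ))))

      A₂-new : A₂ (suc δ) ≡ true
      A₂-new = ∪-true (A ∪ suc δ) (top δ) {suc δ} (∪-same A (suc δ))

      top-first : ∀ {z} → z ∈ lower δ → z ≢ top δ
      top-first {z} z∈ e = by-cases (upper δ) refl
        where
        by-cases : ∀ zs → upper δ ≡ zs → ⊥
        by-cases [] eq = contradiction (subst (1 ≤_) (trans e (cong headOr0 eq)) (proj₁ (rows-bounds δ (lower-∈ {δ} z∈)))) λ ()
        by-cases (y ∷ ys) eq = ⊏⇒≢ (⊏-trans (All.lookup (lower-⊏ δ) z∈) (All.lookup (upper-⊏ δ) (subst (y ∈_) (sym eq) (here refl)))) (trans e (cong headOr0 eq))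

      top-not-later : All (λ z → A z ≡ A₂ z) (drop 1 (upper δ))
      top-not-later = by-cases (upper δ) refl
        where
        by-cases : ∀ zs → upper δ ≡ zs → All (λ z → A z ≡ A₂ z) (drop 1 zs)
        by-cases []       eq = []
        by-cases (y ∷ ys) eq = All.tabulate λ {z} z∈ → A₂-old (proj₂ (rows-bounds δ (upper-∈ {δ} (subst (z ∈_) (sym eq) (there z∈)))))
          (λ e → All.lookup (AllPairs.head (subst Unique eq (AllPairs-++⁻ʳ (lower δ) (subst Unique (rows-split δ) (rows-unique δ))))) z∈ (trans (sym (cong headOr0 eq)) (sym e)))

      lower-δ : ∃[ l″ ] lower δ ≡ 1 ∷ l″
      lower-δ = lower-head (s≤s z≤n) δ<n

      rows-δ : rows δ ≡ 1 ∷ proj₁ lower-δ ++ upper δ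
      rows-δ = trans (rows-split δ) (cong (_++ upper δ) (proj₂ lower-δ))

      lower-same : All (λ z → A z ≡ A₂ z) (proj₁ lower-δ)
      lower-same = All.tabulate λ {z} z∈ → let z∈l = subst (z ∈_) (sym (proj₂ lower-δ)) (there z∈) in
        A₂-old (proj₂ (rows-bounds δ (lower-∈ {δ} z∈l))) (top-first z∈l)

    updated-represents : Represents A₂ (suc δ) (updated δ D)
    updated-represents = record
      { D≡ = begin
          insert$ (length (lower δ)) (replace$ (ch δ) D) ≡⟨ cong₂ insert$ (cong length (proj₂ lower-δ)) (trans (proj₁ replaced) (cong (toDBWT A chr′) rows-δ)) ⟩
          insert$ (suc (length l″)) (segments A chr′ (chr′ 1) 1 (l″ ++ upper δ))
            ≡⟨ insert$-segments A A₂ chr′ (chr′ 1) 0 l″ (proj₂ replaced rows-δ) lower-same A₂-new (chr-last (suc δ))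
                 (Stops-top δ (∪-same (A ∪ suc δ) (top δ))) top-not-later ⟩
          toDBWT A₂ chr′ (1 ∷ l″ ++ suc δ ∷ upper δ) ≡⟨ cong (λ zs → toDBWT A₂ chr′ (zs ++ suc δ ∷ upper δ)) (proj₂ lower-δ) ⟨
          toDBWT A₂ chr′ (rows (suc δ)) ∎
      ; coherent = λ eq → subst (Coherent A₂ chr′ (chr′ 1)) (proj₂ (∷-injective (trans (sym (cong (_++ suc δ ∷ upper δ) (proj₂ lower-δ))) eq)))
          (Coherent-insert l″ (proj₂ replaced rows-δ) lower-same A₂-new (Stops-top δ (∪-same (A ∪ suc δ) (top δ))) top-not-later)
      }
      where
      open ≡-Reasoning
      l″ : List ℕ
      l″ = proj₁ lower-δ

    splitting≡ : splitting δ D ≡ splits A (upper δ)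
    splitting≡ = trans (cong₂ insert$Splits (cong length (proj₂ lower-δ)) (trans (proj₁ replaced) (cong (toDBWT A chr′) rows-δ)))
                   (insert$Splits-segments A chr′ (chr′ 1) 0 (proj₁ lower-δ) (upper δ))

    -- The row `z` after the new `$` is unmarked in `A` exactly if `$` splits a repetition, and then
    -- coherence gives the row before `$` the same character.
    new-flag : ∀ {V′} → (∀ {z zs} → upper δ ≡ z ∷ zs → A z ≡ true → V′ z ≡ true) →
               (∀ {z zs} → upper δ ≡ z ∷ zs → A z ≡ false → V′ z ≡ false) → Flag δ V′ (splitting δ D)
    new-flag {V′} keep drop′ = subst (Flag δ V′) (sym splitting≡) (by-cases (upper δ) refl)
      where
      by-cases : ∀ zs → upper δ ≡ zs → Flag δ V′ (splits A zs)
      by-cases [] eq = whole (λ eq′ → contradiction (trans (sym eq) eq′) λ ())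
      by-cases (z ∷ zs) eq with A z in Az
      ... | true = whole λ eq′ → subst (λ w → V′ w ≡ true) (proj₁ (∷-injective (trans (sym eq) eq′))) (keep eq Az)
      ... | false with last-exists chr′ 1 (proj₁ lower-δ)
      ...   | ws , x , eqx , last≡ = split ws x z zs (trans (proj₂ lower-δ) eqx) eq (drop′ eq Az) (begin
              ch x ≡⟨ chr-old (proj₂ (rows-bounds δ (lower-∈ {δ} (subst (x ∈_) (sym (trans (proj₂ lower-δ) eqx)) (∈-++⁺ʳ ws (here refl)))))) ⟨
              chr′ x ≡⟨ last≡ ⟨
              lastChar chr′ (chr′ 1) (proj₁ lower-δ) ≡⟨ Coherent-at (proj₁ lower-δ) (proj₂ replaced (trans rows-δ (cong (λ ys → 1 ∷ proj₁ lower-δ ++ ys) eq))) Az ⟨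
              chr′ z ≡⟨ chr-old (proj₂ (rows-bounds δ (upper-∈ {δ} (subst (z ∈_) (sym eq) (here refl))))) ⟩
              ch z ∎)
        where open ≡-Reasoning

    adjacent≡ : ∀ {l′} → lower k ≡ 1 ∷ l′ → adjacentTo$ (ch δ) D ≡ (lastChar ch (ch 1) l′ ≡ᵇ ch δ) ∨ headIs ch (ch δ) (upper k)
    adjacent≡ {l′} low = begin
      adjacentTo$ (ch δ) D ≡⟨ cong (adjacentTo$ (ch δ)) (trans D≡ (cong (toDBWT A (chr δ)) (rows-∷ low))) ⟩
      adjacentTo$ (ch δ) (segments A (chr δ) (chr δ 1) 1 (l′ ++ δ ∷ upper k))
        ≡⟨ adjacentTo$-segments (ch δ) A (chr δ) (chr δ 1) 1 l′ (Coherent-++ˡ l′ (coherent (rows-∷ low))) (chr-≢$ (one low))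
             (λ e → <⇒≢ (ch-pos (s≤s z≤n) δ<n) (sym e)) (lower-tail low chr-≢$) (upper-all chr-≢$) (chr-last δ) Aδ (Stops-top k At) ⟩
      (lastChar (chr δ) (chr δ 1) l′ ≡ᵇ ch δ) ∨ headIs (chr δ) (ch δ) (upper k)
        ≡⟨ cong₂ (λ p q → (p ≡ᵇ ch δ) ∨ q) (lastChar-cong 1 (lower-tail low chr-ch) (chr-ch (one low))) (heads (upper k) refl) ⟩
      (lastChar ch (ch 1) l′ ≡ᵇ ch δ) ∨ headIs ch (ch δ) (upper k) ∎
      where
      open ≡-Reasoning
      open Represents rep
      chr-ch : ∀ {z} → z ∈ rows k → chr δ z ≡ ch z
      chr-ch z∈ = chr-other (<⇒≢ (s≤s (proj₂ (rows-bounds k z∈))))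
      heads : ∀ zs → upper k ≡ zs → headIs (chr δ) (ch δ) zs ≡ headIs ch (ch δ) zs
      heads []       _  = refl
      heads (y ∷ ys) eq = cong (_≡ᵇ ch δ) (chr-ch (upper-∈ {k} (subst (y ∈_) (sym eq) (here refl))))

  Represents-cong : ∀ {A A′ δ D} → (∀ {z} → z ∈ rows δ → A z ≡ A′ z) → 1 ≤ δ → δ ≤ n → Represents A δ D → Represents A′ δ D
  Represents-cong {A} {A′} {δ} same 1≤δ δ≤n rep with rows-head 1≤δ δ≤n
  ... | tl , eq = record
    { D≡ = trans D≡ (trans (cong (toDBWT A (chr δ)) eq) (trans (segments-cong (All.map (_, refl) tail-same)) (sym (cong (toDBWT A′ (chr δ)) eq))))
    ; coherent = λ eq′ → subst (Coherent A′ (chr δ) (chr δ 1)) (proj₂ (∷-injective (trans (sym eq) eq′))) (Coherent-cong (All.map (_, refl) tail-same) (coherent eq))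
    }
    where
    open Represents rep
    tail-same : All (λ z → A z ≡ A′ z) tl
    tail-same = All.tabulate λ {z} z∈ → same (subst (z ∈_) (sym eq) (there z∈))

  next-top : ∀ {k y ys} → suc k < n → upper k ≡ y ∷ ys → ch y ≡ ch (suc k) → top (suc k) ≡ suc y
  next-top {k} {y} {ys} δ<n eq e with adjacent (rows (suc δ)) (rows-sorted (suc δ)) (rows⁺ (suc δ) (s≤s z≤n) ≤-refl)
      (rows⁺ (suc δ) (s≤s z≤n) (s≤s (m≤n⇒m≤1+n (proj₂ (rows-bounds k y∈k))))) (char≡ (sym e) (All.lookup (upper-⊏ k) y∈))
      (new-row-adjacent (s≤s z≤n) δ<n (∈-++⁺ʳ (lower k) (there y∈)) (λ w∈ → no-gap (lower k) (subst Sorted rows-y (rows-sorted δ)) (subst (_ ∈_) rows-y w∈)) e)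
    where
    δ : ℕ
    δ = suc k
    y∈ : y ∈ upper k
    y∈ = subst (y ∈_) (sym eq) (here refl)
    y∈k : y ∈ rows k
    y∈k = upper-∈ {k} y∈
    rows-y : rows δ ≡ lower k ++ δ ∷ y ∷ ys
    rows-y = cong (λ zs → lower k ++ δ ∷ zs) eq
  ... | ws , zs , rows≡ = cong headOr0 (proj₂ (unique-split (lower (suc k)) ws (rows-unique (suc (suc k))) rows≡))

  -- An update preserves the invariant

  module _ {k : ℕ} (δ<n : suc k < n) {D : DBWT} {s : Bool} (state : State k D s) where

    open State state

    private
      δ : ℕ
      δ = suc k

      chr′ : ℕ → Char
      chr′ = chr (suc δ)

      k<n : k < n
      k<n = <-trans (n<1+n k) δ<n

      A A₂ : ℕ → Bool
      A = starts k V
      A₂ = A ∪ suc δ ∪ top δ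

      V↑ : Valid δ V
      V↑ m Vm = map₂ m≤n⇒m≤1+n (valid m Vm)

      Vδ : V δ ≡ false
      Vδ = invalid-above valid ≤-refl

      lift-same : ∀ {V′ z} → A z ≡ V′ z → A₂ z ≡ starts δ V′ z
      lift-same {V′} {z} e = cong (λ b → (z ≡ᵇ top δ) ∨ ((z ≡ᵇ suc δ) ∨ b)) e

      lift-false : ∀ {V′ z} → V′ z ≡ false → z ≢ suc δ → z ≢ top δ → starts δ V′ z ≡ false
      lift-false {V′} e z≢ z≢′ = trans (∪-other (V′ ∪ suc δ) z≢′) (trans (∪-other V′ z≢) e)

      A-other : ∀ {z} → z ≢ δ → z ≢ top k → A z ≡ V z
      A-other z≢ z≢′ = trans (∪-other (V ∪ δ) z≢′) (∪-other V z≢)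

      Aδ : A δ ≡ true
      Aδ = ∪-true (V ∪ δ) (top k) {δ} (∪-same V δ)

      A-top : A (top k) ≡ true
      A-top = ∪-same (V ∪ δ) (top k)

      Valid-∪ : ∀ {V′ e} → 1 ≤ e → e ≤ δ → Valid δ V′ → Valid δ (V′ ∪ e)
      Valid-∪ {V′} {e} 1≤e e≤δ val m Vm with m ≟ e
      ... | yes refl = 1≤e , e≤δ
      ... | no m≢e = val m (trans (sym (∪-other V′ m≢e)) Vm)

      upd : Represents A₂ (suc δ) (updated δ D)
      upd = updated-represents δ<n represents

      rows-1≤ : ∀ {m z} → z ∈ rows m → z ≢ 0
      rows-1≤ {m} z∈ e = contradiction (subst (1 ≤_) e (proj₁ (rows-bounds m z∈))) λ ()

    -- Without a merge the borders around the old `$` become permanent: `V` gains row `δ` and, if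
    -- there is one, the row after it, at a price of 5 each. The additional run provides 10.
    slow : merged k s D ≡ updated δ D → suc (runCount (map ch (rows k))) ≤ runCount (map ch (rows δ)) →
           State δ (merged k s D) (splitting δ D)
    slow eq more rewrite eq = by-cases (upper k) refl
      where
      more′ : 10 + 10 * runCount (map ch (rows k)) ≤ 10 * runCount (map ch (rows δ))
      more′ = ≤-trans (≤-reflexive (sym (*-suc 10 _))) (*-monoʳ-≤ 10 more)
      first′ : ∀ (V′ : ℕ → Bool) → (∀ {z} → z ≢ 0 → A z ≡ true → V′ z ≡ true) → V′ 1 ≡ true
      first′ V′ h = h (λ ()) (one k refl)
        where
        one : ∀ j → k ≡ j → A 1 ≡ true
        one zero    refl = ∪-true (V ∪ 1) (top 0) {1} (∪-same V 1)
        one (suc _) eqk = ∪-true (V ∪ δ) (top k) {1} (∪-true V δ {1} (first (subst (1 ≤_) (sym eqk) (s≤s z≤n))))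
      state′ : ∀ V′ → Valid δ V′ → (∀ {z} → z ≢ 0 → A z ≡ V′ z) → Ψ δ V′ ≤ 10 * runCount (map ch (rows δ)) → State δ (updated δ D) (splitting δ D)
      state′ V′ val same bd = record
        { V = V′ ; valid = val
        ; represents = Represents-cong (λ {z} z∈ → lift-same {V′} {z} (same (rows-1≤ {suc δ} z∈))) (s≤s z≤n) δ<n upd
        ; first = λ _ → first′ V′ (λ z≢0 Az → trans (sym (same z≢0)) Az)
        ; flag = new-flag δ<n represents (λ {z} eq Az → trans (sym (same (nz eq))) Az) (λ {z} eq Az → trans (sym (same (nz eq))) Az)
        ; bound = bd }
        where
        nz : ∀ {z zs} → upper δ ≡ z ∷ zs → z ≢ 0
        nz {z} eq = rows-1≤ {δ} (upper-∈ {δ} (subst (z ∈_) (sym eq) (here refl)))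
      by-cases : ∀ zs → upper k ≡ zs → State δ (updated δ D) (splitting δ D)
      by-cases [] eq = state′ (V ∪ δ) (Valid-∪ (s≤s z≤n) ≤-refl V↑)
        (λ {z} z≢0 → ∪-other (V ∪ δ) (λ e → z≢0 (trans e (cong headOr0 eq))))
        (≤-trans (Ψ-∪ {δ} {δ} {V} (s≤s z≤n) ≤-refl) (≤-trans (+-mono-≤ (m≤m+n 5 5) (≤-trans (Ψ-left valid) bound)) more′))
      by-cases (y ∷ ys) eq = state′ A (Valid-∪ 1≤top (m≤n⇒m≤1+n (top-≤ k)) (Valid-∪ (s≤s z≤n) ≤-refl V↑)) (λ _ → refl)
        (≤-trans (Ψ-∪ {δ} {top k} {V ∪ δ} 1≤top (m≤n⇒m≤1+n (top-≤ k))) (≤-trans (+-monoʳ-≤ 5 (≤-trans (Ψ-∪ {δ} {δ} {V} (s≤s z≤n) ≤-refl) (+-monoʳ-≤ 5 (≤-trans (Ψ-left valid) bound)))) more′))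
        where
        1≤top : 1 ≤ top k
        1≤top = subst (1 ≤_) (sym (cong headOr0 eq)) (proj₁ (rows-bounds k (upper-∈ {k} (subst (y ∈_) (sym eq) (here refl)))))

    module _ (1≤k : 1 ≤ k) (merges : adjacentTo$ (ch δ) D ≡ true) where

      open Around (around δ<n 1≤k)

      private
        l′ : List ℕ
        l′ = proj₁ (lower-head 1≤k k<n)

        low : lower k ≡ 1 ∷ l′
        low = proj₂ (lower-head 1≤k k<n)

        chr-δ : chr′ δ ≡ ch δ
        chr-δ = chr-other (<⇒≢ ≤-refl)

        unique₂ : Unique ((1 ∷ l₂) ++ δ ∷ vs₂)
        unique₂ = subst Unique rows≡ (rows-unique (suc δ))

        in-rows : ∀ {z} → z ∈ (1 ∷ l₂) ++ δ ∷ vs₂ → z ∈ rows (suc δ)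
        in-rows {z} = subst (z ∈_) (sym rows≡)

        coherent₂ : Coherent A₂ chr′ (chr′ 1) (l₂ ++ δ ∷ vs₂)
        coherent₂ = Represents.coherent upd rows≡

        merged≡ : merged k s D ≡ mergeAt s (suc (length l₂)) (segments A₂ chr′ (chr′ 1) 1 (l₂ ++ δ ∷ vs₂))
        merged≡ rewrite merges = cong₂ (mergeAt s) place (trans (Represents.D≡ upd) (cong (toDBWT A₂ chr′) rows≡))

        l₂-in : ∀ {z} → z ∈ l₂ → z ∈ rows (suc δ) × z ≢ δ
        l₂-in z∈ = in-rows (there (∈-++⁺ˡ z∈)) , AllPairs-across (1 ∷ l₂) unique₂ (there z∈) (here refl)

        vs₂-in : ∀ {z} → z ∈ vs₂ → z ∈ rows (suc δ) × z ≢ δ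
        vs₂-in z∈ = in-rows (∈-++⁺ʳ (1 ∷ l₂) (there z∈)) , λ e → All.lookup (AllPairs.head (AllPairs-++⁻ʳ (1 ∷ l₂) unique₂)) z∈ (sym e)

        fewer : 10 * runCount (map ch (rows k)) ≤ 10 * runCount (map ch (rows δ))
        fewer = *-monoʳ-≤ 10 (subst₂ (λ p q → runCount p ≤ runCount q)
          (sym (trans (cong (map ch) (trans (rows-split k) (cong (_++ upper k) low))) (cong (ch 1 ∷_) (map-++ ch l′ (upper k)))))
          (sym (trans (cong (λ zs → map ch (zs ++ δ ∷ upper k)) low) (cong (ch 1 ∷_) (map-++ ch l′ (δ ∷ upper k)))))
          (runCount-insert (ch 1) (map ch l′) (ch δ) (map ch (upper k))))

        A₂δ : A₂ δ ≡ true
        A₂δ = ∪-true (A ∪ suc δ) (top δ) {δ} (∪-true A (suc δ) {δ} Aδ)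

        -- What the three kinds of merge have in common. They differ in `V′` and in the effect
        -- `base` at row `δ`. Since runs do not disappear, the old bound suffices as soon as `Ψ` has
        -- not increased.
        result : ∀ V′ → Valid δ V′ → (∀ {z} → z ∈ l₂ → A₂ z ≡ starts δ V′ z) →
                 (∀ j → mergeBoth s (lastChar chr′ (chr′ 1) l₂ ^^ suc j) (chr′ δ ^^ 1) (laterSegments A₂ chr′ vs₂) ≡
                        segments (starts δ V′) chr′ (lastChar chr′ (chr′ 1) l₂) (suc j) (δ ∷ vs₂)) →
                 Coherent (starts δ V′) chr′ (chr′ 1) (l₂ ++ δ ∷ vs₂) →
                 (1 ≢ top k → V′ 1 ≡ true) → (∀ {z zs} → upper δ ≡ z ∷ zs → A z ≡ V′ z) →
                 Ψ δ V′ ≤ Ψ k V → State δ (merged k s D) (splitting δ D)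
        result V′ val same base co first′ keep bd = record
          { V = V′ ; valid = val
          ; represents = record
            { D≡ = trans merged≡ (trans (mergeAt-segments s A₂ (starts δ V′) chr′ (chr′ 1) 0 l₂ (Coherent-++ˡ l₂ coherent₂) (All.tabulate same) A₂δ base
                     (stops (∪-true (A ∪ suc δ) (top δ) {suc δ} (∪-same A (suc δ))) (∪-true (A ∪ suc δ) (top δ) {top k} (∪-true A (suc δ) {top k} A-top))))
                     (sym (cong (toDBWT (starts δ V′) chr′) rows≡)))
            ; coherent = λ eq → subst (Coherent (starts δ V′) chr′ (chr′ 1)) (proj₂ (∷-injective (trans (sym rows≡) eq))) co }
          ; first = λ _ → first′ one≢top
          ; flag = new-flag δ<n represents (λ eq Az → trans (sym (keep eq)) Az) (λ eq Az → trans (sym (keep eq)) Az)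
          ; bound = ≤-trans bd (≤-trans bound fewer) }
          where
          one≢top : 1 ≢ top k
          one≢top e = by-cases (upper k) refl
            where
            by-cases : ∀ zs → upper k ≡ zs → ⊥
            by-cases [] eq = contradiction (trans e (cong headOr0 eq)) λ ()
            by-cases (y ∷ ys) eq = ⊏⇒≢ (⊏-trans (All.lookup (lower-⊏ k) (subst (1 ∈_) (sym low) (here refl))) (All.lookup (upper-⊏ k) (subst (y ∈_) (sym eq) (here refl)))) (trans e (cong headOr0 eq))

        upper-z : ∀ {z zs} → upper δ ≡ z ∷ zs → top δ ≡ z × z ∈ rows δ
        upper-z {z} eq = cong headOr0 eq , upper-∈ {δ} (subst (z ∈_) (sym eq) (here refl))

        1∈V : V 1 ≡ true
        1∈V = first 1≤k

        δ≢sδ : δ ≢ suc δ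
        δ≢sδ = <⇒≢ ≤-refl

        lower-last : ∀ {us x} → lower k ≡ us ++ [ x ] → lastChar ch (ch 1) l′ ≡ ch x
        lower-last {us} {x} eq with last-exists ch 1 l′
        ... | ws , x′ , eq′ , e with ∷ʳ-injectiveʳ ws us (trans (sym eq′) (trans (sym low) eq))
        ...   | refl = e

        y-facts : ∀ {y ys} → upper k ≡ y ∷ ys → 1 ≤ y × y ≤ k × top k ≡ y
        y-facts {y} eq with rows-bounds k (upper-∈ {k} (subst (y ∈_) (sym eq) (here refl)))
        ... | p , q = p , q , cong headOr0 eq

      -- As the bit is false, the row after the old `$` is in `V`; so only row `δ` has a mark to
      -- lose, and `V` stays.
      merge-left : lastChar ch (ch 1) l′ ≡ ch δ → s ≡ false → State δ (merged k s D) (splitting δ D)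
      merge-left e refl = result V V↑ (λ z∈ → lift-same {V} (same (l₂-in z∈)))
        (λ j → mergeLeft-base false {A₂} {starts δ V} {chr′} {_} {δ} {vs₂} j (trans last≡ (sym chr-δ)) A₃δ
                 (stops (∪-true (A ∪ suc δ) (top δ) {suc δ} (∪-same A (suc δ))) (∪-true (A ∪ suc δ) (top δ) {top k} (∪-true A (suc δ) {top k} A-top)))
                 (All.tabulate λ z∈ → lift-same {V} (same (vs₂-in z∈))) (inj₁ refl))
        (Coherent-merge l₂ coherent₂ (trans last≡ (sym chr-δ)) (All.tabulate λ z∈ → lift-same {V} (same (l₂-in z∈)))
          (All.tabulate λ z∈ → lift-same {V} (same (vs₂-in z∈))))
        (λ _ → 1∈V)
        (λ eq → same (rows-suc δ (proj₂ (upper-z eq)) , λ z≡δ → proj₂ (left⇐ low e) (trans (proj₁ (upper-z eq)) z≡δ)))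
        (Ψ-left valid)
        where
        last≡ : lastChar chr′ (chr′ 1) l₂ ≡ ch δ
        last≡ = proj₁ (left⇐ low e)
        A₃δ : starts δ V δ ≡ false
        A₃δ = lift-false {V} Vδ δ≢sδ (λ t → proj₂ (left⇐ low e) (sym t))
        same : ∀ {z} → z ∈ rows (suc δ) × z ≢ δ → A z ≡ V z
        same {z} (z∈ , z≢δ) with z ≟ top k
        ... | no z≢top = A-other z≢δ z≢top
        ... | yes refl = trans A-top (sym (by-cases (upper k) refl))
          where
          by-cases : ∀ zs → upper k ≡ zs → V (top k) ≡ true
          by-cases [] eq = contradiction (cong headOr0 eq) (rows-1≤ {suc δ} z∈)
          by-cases (y ∷ ys) eq with flag
          ... | whole h = subst (λ w → V w ≡ true) (sym (cong headOr0 eq)) (h eq)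

      -- As the bit is true, the old `$` had split a repetition, whose character is that of the left
      -- neighbour, here `c`. Both parts are joined again around the new letter, and `V`, which does
      -- not contain `y`, stays.
      merge-both : s ≡ true → lastChar ch (ch 1) l′ ≡ ch δ → State δ (merged k s D) (splitting δ D)
      merge-both refl e with flag
      ... | split us x y ys low-x up-y Vy ex = go′ (right-∷ up-y ey)
        where
        ey : ch y ≡ ch δ
        ey = trans (sym ex) (trans (sym (lower-last low-x)) e)
        last≡ : lastChar chr′ (chr′ 1) l₂ ≡ ch δ
        last≡ = proj₁ (left⇐ low e)
        A₃δ : starts δ V δ ≡ false
        A₃δ = lift-false {V} Vδ δ≢sδ (λ t → proj₂ (left⇐ low e) (sym t))
        chr-y : chr′ y ≡ chr′ δ
        chr-y = trans (chr-other (<⇒≢ (s≤s (m≤n⇒m≤1+n (proj₁ (proj₂ (y-facts up-y))))))) (trans ey (sym chr-δ))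
        same : ∀ {z} → z ≢ δ → z ≢ y → A z ≡ V z
        same z≢δ z≢y = A-other z≢δ (λ t → z≢y (trans t (proj₂ (proj₂ (y-facts up-y)))))
        go′ : (∃[ zs ] vs₂ ≡ y ∷ zs) × top δ ≢ y → State δ (merged k true D) (splitting δ D)
        go′ ((zs , vs≡) , top≢y) = result V V↑ (λ z∈ → lift-same {V} (same (proj₂ (l₂-in z∈)) (l₂≢y z∈)))
            (λ j → subst (λ ws → mergeBoth true (lastChar chr′ (chr′ 1) l₂ ^^ suc j) (chr′ δ ^^ 1) (laterSegments A₂ chr′ ws) ≡
                                 segments (starts δ V) chr′ (lastChar chr′ (chr′ 1) l₂) (suc j) (δ ∷ ws)) (sym vs≡)
                     (mergeBoth-base {A₂} {starts δ V} {chr′} {_} {δ} {y} {zs} j (trans last≡ (sym chr-δ)) A₃δ A₂y A₃y chr-y (All.tabulate zs-same)))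
            (subst (Coherent (starts δ V) chr′ (chr′ 1)) (trans (++-assoc l₂ [ δ ] (y ∷ zs)) (cong (λ ws → l₂ ++ δ ∷ ws) (sym vs≡)))
              (Coherent-merge (l₂ ++ [ δ ]) (subst (Coherent (A₂ ∖ δ) chr′ (chr′ 1)) (trans (cong (λ ws → l₂ ++ δ ∷ ws) vs≡) (sym (++-assoc l₂ [ δ ] (y ∷ zs)))) co₁)
                (trans (lastChar-∷ʳ chr′ (chr′ 1) l₂ δ) (sym chr-y))
                (All.++⁺ (All.tabulate λ z∈ → trans (∖-other A₂ (proj₂ (l₂-in z∈))) (lift-same {V} (same (proj₂ (l₂-in z∈)) (l₂≢y z∈))))
                         (trans (∖-same A₂ δ) (sym A₃δ) ∷ []))
                (All.tabulate λ z∈ → trans (∖-other A₂ (proj₂ (vs₂-in (zs-in z∈)))) (zs-same z∈))))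
            (λ _ → 1∈V)
            (λ eq → same (λ z≡δ → proj₂ (left⇐ low e) (trans (proj₁ (upper-z eq)) z≡δ)) (λ z≡y → top≢y (trans (proj₁ (upper-z eq)) z≡y)))
            (Ψ-left valid)
          where
          zs-in : ∀ {z} → z ∈ zs → z ∈ vs₂
          zs-in {z} z∈ = subst (z ∈_) (sym vs≡) (there z∈)
          y∈vs : y ∈ vs₂
          y∈vs = subst (y ∈_) (sym vs≡) (here refl)
          l₂≢y : ∀ {z} → z ∈ l₂ → z ≢ y
          l₂≢y z∈ = AllPairs-across (1 ∷ l₂) unique₂ (there z∈) (there y∈vs)
          zs-same : ∀ {z} → z ∈ zs → A₂ z ≡ starts δ V z
          zs-same z∈ = lift-same {V} (same (proj₂ (vs₂-in (zs-in z∈)))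
            (λ z≡y → All.lookup (AllPairs.head (subst Unique vs≡ (AllPairs.tail (AllPairs-++⁻ʳ (1 ∷ l₂) unique₂)))) z∈ (sym z≡y)))
          A₂y : A₂ y ≡ true
          A₂y = ∪-true (A ∪ suc δ) (top δ) {y} (∪-true A (suc δ) {y} (subst (λ w → A w ≡ true) (proj₂ (proj₂ (y-facts up-y))) A-top))
          A₃y : starts δ V y ≡ false
          A₃y = lift-false {V} Vy (<⇒≢ (s≤s (m≤n⇒m≤1+n (proj₁ (proj₂ (y-facts up-y)))))) (λ t → top≢y (sym t))
          co₁ : Coherent (A₂ ∖ δ) chr′ (chr′ 1) (l₂ ++ δ ∷ vs₂)
          co₁ = Coherent-merge l₂ coherent₂ (trans last≡ (sym chr-δ)) (All.tabulate λ z∈ → sym (∖-other A₂ (proj₂ (l₂-in z∈))))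
                  (All.tabulate λ z∈ → sym (∖-other A₂ (proj₂ (vs₂-in z∈))))

      -- Had the old `$` split a repetition, the left neighbour would have character `c` as well. So
      -- the row after `$` is in `V`, and row `δ` takes its place there.
      merge-right : ∀ {y ys} → lastChar ch (ch 1) l′ ≢ ch δ → upper k ≡ y ∷ ys → ch y ≡ ch δ → State δ (merged k s D) (splitting δ D)
      merge-right {y} {ys} ¬e up-y ey = go′ (right-∷ up-y ey)
        where
        V′ : ℕ → Bool
        V′ = V ∖ top k ∪ δ
        top≡ : top k ≡ y
        top≡ = proj₂ (proj₂ (y-facts up-y))
        y≤k : y ≤ k
        y≤k = proj₁ (proj₂ (y-facts up-y))
        y≢δ : y ≢ δ
        y≢δ = <⇒≢ (s≤s y≤k)
        Vtop : V (top k) ≡ true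
        Vtop with flag
        ... | whole h = subst (λ w → V w ≡ true) (sym top≡) (h up-y)
        ... | split us x y′ ys′ low-x up-y′ _ ex = contradiction
                (trans (lower-last low-x) (trans ex (trans (cong ch (proj₁ (∷-injective (trans (sym up-y′) up-y)))) ey))) ¬e
        V′-valid : Valid δ V′
        V′-valid = Valid-∪ {V ∖ top k} (s≤s z≤n) ≤-refl val
          where
          val : Valid δ (V ∖ top k)
          val m h with m ≡ᵇ top k
          ... | false = V↑ m h
        V′y : V′ y ≡ false
        V′y = trans (∪-other (V ∖ top k) y≢δ) (trans (cong (V ∖ top k) (sym top≡)) (∖-same V (top k)))
        same : ∀ {z} → z ≢ y → A z ≡ V′ z
        same {z} z≢y with z ≟ δ
        ... | yes refl = trans Aδ (sym (∪-same (V ∖ top k) δ))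
        ... | no z≢δ = trans (A-other z≢δ z≢top) (sym (trans (∪-other (V ∖ top k) z≢δ) (∖-other V z≢top)))
          where
          z≢top : z ≢ top k
          z≢top t = z≢y (trans t top≡)
        lifted : ∀ z → z ≢ y → A₂ z ≡ starts δ V′ z
        lifted z z≢y = lift-same {V′} {z} (same {z} z≢y)
        chr-y : chr′ y ≡ chr′ δ
        chr-y = trans (chr-other (<⇒≢ (s≤s (m≤n⇒m≤1+n y≤k)))) (trans ey (sym chr-δ))
        go′ : (∃[ zs ] vs₂ ≡ y ∷ zs) × top δ ≢ y → State δ (merged k s D) (splitting δ D)
        go′ ((zs , vs≡) , top≢y) = result V′ V′-valid (λ {z} z∈ → lifted z (l₂≢y z∈))
            (λ j → subst (λ ws → mergeBoth s (lastChar chr′ (chr′ 1) l₂ ^^ suc j) (chr′ δ ^^ 1) (laterSegments A₂ chr′ ws) ≡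
                                 segments (starts δ V′) chr′ (lastChar chr′ (chr′ 1) l₂) (suc j) (δ ∷ ws)) (sym vs≡)
                     (mergeRight-base s {A₂} {starts δ V′} {chr′} {_} {δ} {y} {zs} j (λ p → ¬e (left⇒ low (trans p chr-δ)))
                       (trans (sym (lifted δ (λ p → y≢δ (sym p)))) A₂δ) A₂y A₃y chr-y (All.tabulate (λ {z} → zs-same {z}))))
            (subst (Coherent (starts δ V′) chr′ (chr′ 1)) (trans (++-assoc l₂ [ δ ] (y ∷ zs)) (cong (λ ws → l₂ ++ δ ∷ ws) (sym vs≡)))
              (Coherent-merge (l₂ ++ [ δ ]) (subst (Coherent A₂ chr′ (chr′ 1)) (trans (cong (λ ws → l₂ ++ δ ∷ ws) vs≡) (sym (++-assoc l₂ [ δ ] (y ∷ zs)))) coherent₂)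
                (trans (lastChar-∷ʳ chr′ (chr′ 1) l₂ δ) (sym chr-y))
                (All.++⁺ (All.tabulate λ {z} z∈ → lifted z (l₂≢y z∈)) (lifted δ (λ p → y≢δ (sym p)) ∷ []))
                (All.tabulate (λ {z} → zs-same {z}))))
            (λ 1≢top → trans (sym (same (λ p → 1≢top (trans p (sym top≡))))) (∪-true (V ∪ δ) (top k) {1} (∪-true V δ {1} 1∈V)))
            (λ eq → same (λ z≡y → top≢y (trans (proj₁ (upper-z eq)) z≡y)))
            (Ψ-right valid (subst (1 ≤_) (sym top≡) (proj₁ (y-facts up-y))) Vtop (trans (next-top δ<n up-y ey) (cong suc (sym top≡))))
          where
          y∈vs : y ∈ vs₂
          y∈vs = subst (y ∈_) (sym vs≡) (here refl)
          l₂≢y : ∀ {z} → z ∈ l₂ → z ≢ y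
          l₂≢y z∈ = AllPairs-across (1 ∷ l₂) unique₂ (there z∈) (there y∈vs)
          zs-same : ∀ {z} → z ∈ zs → A₂ z ≡ starts δ V′ z
          zs-same {z} z∈ = lifted z
            (λ z≡y → All.lookup (AllPairs.head (subst Unique vs≡ (AllPairs.tail (AllPairs-++⁻ʳ (1 ∷ l₂) unique₂)))) z∈ (sym z≡y))
          A₂y : A₂ y ≡ true
          A₂y = ∪-true (A ∪ suc δ) (top δ) {y} (∪-true A (suc δ) {y} (subst (λ w → A w ≡ true) top≡ A-top))
          A₃y : starts δ V′ y ≡ false
          A₃y = lift-false {V′} V′y (<⇒≢ (s≤s (m≤n⇒m≤1+n y≤k))) (λ t → top≢y (sym t))

    step : State δ (merged k s D) (splitting δ D)
    step = by-k k refl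
      where
      by-k : ∀ j → k ≡ j → State δ (merged k s D) (splitting δ D)
      -- `L_1` consists of `$` alone: there is no neighbour to merge with, and the first letter is
      -- the first run.
      by-k zero refl = slow (cong (λ b → if b then mergeAt s _ (updated δ D) else updated δ D) (trans (cong (adjacentTo$ (ch 1)) (Represents.D≡ represents)) refl)) ≤-refl
      by-k (suc _) eqk = by-left (lastChar ch (ch 1) l′ ≟ ch δ)
        where
        1≤k : 1 ≤ k
        1≤k = subst (1 ≤_) (sym eqk) (s≤s z≤n)
        l′ : List ℕ
        l′ = proj₁ (lower-head 1≤k k<n)
        low : lower k ≡ 1 ∷ l′
        low = proj₂ (lower-head 1≤k k<n)
        adj : adjacentTo$ (ch δ) D ≡ (lastChar ch (ch 1) l′ ≡ᵇ ch δ) ∨ headIs ch (ch δ) (upper k)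
        adj = adjacent≡ δ<n represents low
        by-left : Dec (lastChar ch (ch 1) l′ ≡ ch δ) → State δ (merged k s D) (splitting δ D)
        by-left (yes e) = by-flag s refl
          where
          fast : adjacentTo$ (ch δ) D ≡ true
          fast = trans adj (cong (_∨ headIs ch (ch δ) (upper k)) (trans (cong (_≡ᵇ ch δ) e) (≡ᵇ-refl (ch δ))))
          by-flag : ∀ b → s ≡ b → State δ (merged k s D) (splitting δ D)
          by-flag false p = merge-left 1≤k fast e p
          by-flag true  p = merge-both 1≤k fast p e
        by-left (no ¬e) = by-right (upper k) refl
          where
          slow′ : headIs ch (ch δ) (upper k) ≡ false → State δ (merged k s D) (splitting δ D)
          slow′ h = slow (cong (λ b → if b then mergeAt s _ (updated δ D) else updated δ D) (trans adj (cong₂ _∨_ (≢⇒≡ᵇ ¬e) h)))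
            (subst₂ (λ p q → suc (runCount p) ≤ runCount q)
              (sym (trans (cong (map ch) (trans (rows-split k) (cong (_++ upper k) low))) (cong (ch 1 ∷_) (map-++ ch l′ (upper k)))))
              (sym (trans (cong (λ zs → map ch (zs ++ δ ∷ upper k)) low) (cong (ch 1 ∷_) (map-++ ch l′ (δ ∷ upper k)))))
              (runCount-insert-new (ch 1) (map ch l′) (ch δ) (map ch (upper k)) (λ p → ¬e (trans (sym (lastChar-map ch 1 l′)) p))
                (trans (headIs-map ch (ch δ) (upper k)) h)))
          by-right : ∀ zs → upper k ≡ zs → State δ (merged k s D) (splitting δ D)
          by-right []       eq = slow′ (cong (headIs ch (ch δ)) eq)
          by-right (y ∷ ys) eq with ch y ≟ ch δ
          ... | yes ey = merge-right 1≤k (trans adj (trans (cong₂ _∨_ (≢⇒≡ᵇ ¬e) (trans (cong (headIs ch (ch δ)) eq) (trans (cong (_≡ᵇ ch δ) ey) (≡ᵇ-refl (ch δ))))) refl)) ¬e eq ey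
          ... | no ¬ey = slow′ (trans (cong (headIs ch (ch δ)) eq) (≢⇒≡ᵇ ¬ey))

  -- Cuts of heavy repetitions and F-intervals

  -- The inverse of `next δ` on `rows δ`.
  prev : ℕ → ℕ → ℕ
  prev δ m = if m ≡ᵇ 1 then δ else pred m

  module _ {k : ℕ} (δ≤n : suc k ≤ n) {D : DBWT} {s : Bool} (state : State k D s) where

    open State state

    private
      δ : ℕ
      δ = suc k

      A : ℕ → Bool
      A = starts k V

      Aδ : A δ ≡ true
      Aδ = ∪-true (V ∪ δ) (top k) {δ} (∪-same V δ)

      A-top : A (top k) ≡ true
      A-top = ∪-same (V ∪ δ) (top k)

      A-other : ∀ {z} → z ≢ δ → z ≢ top k → A z ≡ V z
      A-other z≢ z≢′ = trans (∪-other (V ∪ δ) z≢′) (∪-other V z≢)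

      clash : ∀ z → A z ≡ true → A z ≢ false
      clash z p q = contradiction (trans (sym p) q) λ ()

      V-false : ∀ {z} → A z ≡ false → V z ≡ false
      V-false {z} Az = trans (sym (A-other (λ { refl → clash δ Aδ Az }) (λ { refl → clash (top k) A-top Az }))) Az

      landing-V : ∀ {z} → z ≢ δ → bit (V (pred z)) ≤ landing k V z
      landing-V z≢ rewrite ≢⇒≡ᵇ z≢ = m≤m+n _ _

    -- The 2 stands for the marks that may be outside `V`: row `δ`, whose F-interval starts with row
    -- 1, and `top k`, whose F-interval starts with row `suc (top k)`.
    arrivals-bound : ∀ {xs} → Unique xs → (∀ {z} → z ∈ xs → z ∈ rows δ × z ≢ δ) →
                     ∑ (λ m → bit (A (prev δ m))) xs ≤ 2 + ∑ (landing k V) xs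
    arrivals-bound {xs} un h = ∑-raise₂ 1 (suc (top k)) un below (λ z → bit≤1 (A (prev δ z)))
      where
      below : ∀ {z} → z ∈ xs → z ≢ 1 → z ≢ suc (top k) → bit (A (prev δ z)) ≤ landing k V z
      below {z} z∈ z≢1 z≢top with rows-bounds δ (proj₁ (h z∈))
      below {suc z} z∈ z≢1 z≢top | _ , z<δ rewrite ≢⇒≡ᵇ z≢1 = ≤-trans
        (≤-reflexive (cong bit (A-other (<⇒≢ z<δ) (λ e → z≢top (cong suc e)))))
        (landing-V (proj₂ (h z∈)))

    departures-bound : ∀ {xs} → Unique xs → ∑ (bit ∘ A) xs ≤ 2 + ∑ (weight V) xs
    departures-bound {xs} un = ∑-raise₂ δ (top k) un (λ {z} _ z≢δ z≢top → ≤-reflexive (cong bit (A-other z≢δ z≢top))) (λ z → bit≤1 (A z))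

    module _ {us f ms e ns vs} (rows≡ : rows δ ≡ us ++ f ∷ ms ++ e ∷ ns ++ vs)
             (inner : All (λ x → A x ≡ false) (ms ++ e ∷ ns)) where

      private
        un : Unique (us ++ f ∷ ms ++ e ∷ ns ++ vs)
        un = subst Unique rows≡ (rows-unique δ)

        Ams : All (λ x → A x ≡ false) ms
        Ams = All.++⁻ˡ ms inner

        Aens : All (λ x → A x ≡ false) (e ∷ ns)
        Aens = All.++⁻ʳ ms inner

        Ae : A e ≡ false
        Ae = All.head Aens

        block : ℕ → Set
        block z = z ∈ f ∷ ms ++ e ∷ ns

        in-rows : ∀ {z} → block z → z ∈ rows δ
        in-rows {z} z∈ = subst (z ∈_) (sym (trans rows≡ (cong (λ zs → us ++ f ∷ zs) (sym (++-assoc ms (e ∷ ns) vs))))) (∈-++⁺ʳ us (∈-++⁺ˡ z∈))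

        e∈ : e ∈ rows δ
        e∈ = in-rows (there (∈-++⁺ʳ ms (here refl)))

        -- The row after `$` is marked, so the repetition of `$` has one letter, whereas this block
        -- contains `e` besides `f`.
        f≢δ : f ≢ δ
        f≢δ refl = head-top (ms ++ e ∷ ns) refl
          where
          upper≡ : (ms ++ e ∷ ns) ++ vs ≡ upper k
          upper≡ = trans (++-assoc ms (e ∷ ns) vs) (proj₂ (unique-split us (lower k) un (sym rows≡)))
          head-top : ∀ zs → ms ++ e ∷ ns ≡ zs → ⊥
          head-top []       eq = contradiction (trans (sym (length-++ ms)) (cong length eq)) (λ q → contradiction (trans (sym (+-suc (length ms) (length ns))) q) λ ())
          head-top (z ∷ zs) eq = clash z (subst (λ w → A w ≡ true) (cong headOr0 (trans (sym upper≡) (cong (_++ vs) eq))) A-top) (All.head (subst (All (λ x → A x ≡ false)) eq inner))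

        block≢δ : ∀ {z} → block z → z ≢ δ
        block≢δ (here refl) = f≢δ
        block≢δ (there z∈) refl = clash δ Aδ (All.lookup inner z∈)

        e≢δ : e ≢ δ
        e≢δ = block≢δ (there (∈-++⁺ʳ ms (here refl)))

        1≤e : 1 ≤ e
        1≤e = proj₁ (rows-bounds δ e∈)

        e≤k : e ≤ k
        e≤k = s≤s⁻¹ (≤∧≢⇒< (proj₂ (rows-bounds δ e∈)) e≢δ)

        8-2 : ∀ {p q} → 8 ≤ p → p ≤ 2 + q → θ ≤ q
        8-2 h h′ = s≤s⁻¹ (s≤s⁻¹ (≤-trans h h′))

      Ψ-cut-heavy-repetition : 8 ≤ ∑ (λ m → bit (A (prev δ m))) (f ∷ ms) → 8 ≤ ∑ (λ m → bit (A (prev δ m))) (e ∷ ns) →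
                               Ψ k (V ∪ e) ≤ Ψ k V
      Ψ-cut-heavy-repetition left right = Ψ-cut-repetition 1≤e e≤k us f ms ns (vs ++ [ 0 ]) list≡′
          (All.map V-false Ams) (V-false Ae) (All.map V-false (All.tail Aens)) small
          (≤-trans (8-2 left (arrivals-bound (AllPairs-++⁻ˡ (f ∷ ms) un₁) λ z∈ → in-rows (widen z∈) , block≢δ (widen z∈))) (m≤m+n _ (landing k V e)))
          (8-2 right (arrivals-bound (AllPairs-++⁻ˡ (e ∷ ns) (AllPairs-++⁻ʳ (f ∷ ms) un₁)) λ z∈ → in-rows (there (∈-++⁺ʳ ms z∈)) , block≢δ (there (∈-++⁺ʳ ms z∈))))
        where
        un₁ : Unique (f ∷ ms ++ e ∷ ns ++ vs)
        un₁ = AllPairs-++⁻ʳ us un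
        widen : ∀ {z} → z ∈ f ∷ ms → block z
        widen (here refl) = here refl
        widen (there z∈) = there (∈-++⁺ˡ z∈)
        list≡′ : list k ≡ us ++ f ∷ ms ++ e ∷ ns ++ vs ++ [ 0 ]
        list≡′ = trans (cong (_++ [ 0 ]) rows≡) (trans (++-assoc us _ [ 0 ]) (cong (λ zs → us ++ f ∷ zs)
                   (trans (++-assoc ms _ [ 0 ]) (cong (λ zs → ms ++ e ∷ zs) (++-assoc ns vs [ 0 ])))))
        -- `e` is unmarked, hence not `top k`, the only row where two F-intervals can be counted.
        small : landing k V e ≤ 1
        small = ≤-trans (≤-reflexive (landing-other k V e≢δ (λ { refl → clash (top k) A-top Ae }))) (bit≤1 (V (pred e)))

      module _ {us′ vs′} (rows≡′ : rows δ ≡ us′ ++ next δ f ∷ map (next δ) ms ++ next δ e ∷ map (next δ) ns ++ vs′)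
               (left : 8 ≤ ∑ (bit ∘ A) (next δ f ∷ map (next δ) ms)) (right : 8 ≤ ∑ (bit ∘ A) (next δ e ∷ map (next δ) ns)) where

        private
          next-block≡ : ∀ {z} → block z → next δ z ≡ suc z
          next-block≡ z∈ = cong suc (origin-other (block≢δ z∈))

          maps-block : ∀ {xs} → (∀ {z} → z ∈ xs → block z) → map (next δ) xs ≡ map suc xs
          maps-block {[]}     h = refl
          maps-block {x ∷ xs} h = cong₂ _∷_ (next-block≡ (h (here refl))) (maps-block (h ∘ there))

          ms′ ns′ : List ℕ
          ms′ = map suc ms
          ns′ = map suc ns

          rows-suc≡ : rows δ ≡ us′ ++ suc f ∷ ms′ ++ suc e ∷ ns′ ++ vs′
          rows-suc≡ = trans rows≡′ (cong₂ (λ p q → us′ ++ p ∷ q) (next-block≡ (here refl))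
            (cong₂ _++_ (maps-block (λ z∈ → there (∈-++⁺ˡ z∈))) (cong₂ (λ p q → p ∷ q ++ vs′) (next-block≡ (there (∈-++⁺ʳ ms (here refl)))) (maps-block (λ z∈ → there (∈-++⁺ʳ ms (there z∈)))))))

          left′ : 8 ≤ ∑ (bit ∘ A) (suc f ∷ ms′)
          left′ = subst (λ zs → 8 ≤ ∑ (bit ∘ A) zs) (cong₂ _∷_ (next-block≡ (here refl)) (maps-block {ms} (λ z∈ → there (∈-++⁺ˡ z∈)))) left

          right′ : 8 ≤ ∑ (bit ∘ A) (suc e ∷ ns′)
          right′ = subst (λ zs → 8 ≤ ∑ (bit ∘ A) zs) (cong₂ _∷_ (next-block≡ (there (∈-++⁺ʳ ms (here refl)))) (maps-block (λ z∈ → there (∈-++⁺ʳ ms (there z∈))))) right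

          un′ : Unique (us′ ++ suc f ∷ ms′ ++ suc e ∷ ns′ ++ vs′)
          un′ = subst Unique rows-suc≡ (rows-unique δ)

          un₁ : Unique (suc f ∷ ms′ ++ suc e ∷ ns′ ++ vs′)
          un₁ = AllPairs-++⁻ʳ us′ un′

          un-left : Unique (suc f ∷ ms′)
          un-left = AllPairs-++⁻ˡ (suc f ∷ ms′) un₁

          un-right : Unique (suc e ∷ ns′)
          un-right = AllPairs-++⁻ˡ (suc e ∷ ns′) (AllPairs-++⁻ʳ (suc f ∷ ms′) un₁)

          Vδ : V δ ≡ false
          Vδ = invalid-above valid ≤-refl

          -- Only the row after row δ can begin an F-interval, and then row δ does.
          landing-zero : ∀ {w} → w ∈ ms ++ e ∷ ns → suc w ≢ top k ⊎ V k ≡ false → landing k V (suc w) ≡ 0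
          landing-zero {w} w∈ h with suc w ≟ δ
          ... | yes eq rewrite suc-injective eq = landing-new k V
          ... | no ≢δ with h
          ...   | inj₁ ≢top = trans (landing-other k V ≢δ ≢top) (cong bit (V-false (All.lookup inner w∈)))
          ...   | inj₂ Vk with suc w ≟ top k
          ...     | no ≢top = trans (landing-other k V ≢δ ≢top) (cong bit (V-false (All.lookup inner w∈)))
          ...     | yes eq = trans (cong (landing k V) eq) (trans (landing-top k V)
                       (trans (cong₂ (λ p q → bit (V (pred p)) + bit q) (sym eq) Vk) (cong (λ b → bit b + 0) (V-false (All.lookup inner w∈)))))

          list≡′ : ∀ ws zs → rows δ ≡ ws ++ zs → list k ≡ ws ++ zs ++ [ 0 ]
          list≡′ ws zs eq = trans (cong (_++ [ 0 ]) eq) (++-assoc ws zs [ 0 ])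

          zeros : ∀ {xs} → (∀ {w} → w ∈ xs → landing k V (suc w) ≡ 0) → All (λ m → landing k V m ≡ 0) (map suc xs)
          zeros h = All.map⁺ (All.tabulate h)

          f≢e : suc f ≢ suc e
          f≢e = All.lookup (AllPairs.head un₁) (∈-++⁺ʳ ms′ (here refl))

        private
          -- The F-interval starts with row `δ`, so `landing` counts it from `top k`, its second
          -- row; the piece of the potential therefore begins at `y`.
          f-is-last : f ≡ k → Ψ k (V ∪ e) ≤ Ψ k V
          f-is-last refl = by-ms ms′ refl
            where
            upper≡ : ms′ ++ suc e ∷ ns′ ++ vs′ ≡ upper k
            upper≡ = proj₂ (unique-split us′ (lower k) un′ (sym rows-suc≡))
            e≢k : e ≢ k
            e≢k p = f≢e (cong suc (sym p))
            by-ms : ∀ xs → ms′ ≡ xs → Ψ k (V ∪ e) ≤ Ψ k V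
            -- There are 8 starts before the cut, so that part has more rows than `δ`.
            by-ms [] eq = contradiction (≤-trans left′ (≤-trans (≤-reflexive (cong (λ xs → bit (A δ) + ∑ (bit ∘ A) xs) eq)) (+-monoˡ-≤ 0 (bit≤1 (A δ))))) λ { (s≤s ()) }
            by-ms (y ∷ xs) eq = Ψ-cut-interval 1≤e e≤k (us′ ++ [ δ ]) y xs ns′ (vs′ ++ [ 0 ])
                (trans (list≡′ us′ _ rows-suc≡) (trans (cong (λ zs → us′ ++ δ ∷ zs) (trans (++-assoc ms′ _ [ 0 ]) (cong₂ (λ p q → p ++ suc e ∷ q) eq (++-assoc ns′ vs′ [ 0 ]))))
                  (trans (sym (++-assoc us′ [ δ ] _)) (cong (λ t → (us′ ++ [ δ ]) ++ y ∷ xs ++ t ∷ ns′ ++ vs′ ++ [ 0 ]) (sym (landing-row-other e≢k))))))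
                xs-zero (subst (λ t → landing k V t ≡ 0) (sym (landing-row-other e≢k)) (landing-zero (∈-++⁺ʳ ms (here refl)) (inj₁ (not-top (∈-++⁺ʳ xs (here refl))))))
                (zeros (λ w∈ → landing-zero (∈-++⁺ʳ ms (there w∈)) (inj₁ (not-top (∈-++⁺ʳ xs (there (∈-++⁺ˡ (∈-map⁺ suc w∈))))))))
                (≤-trans (8-2 left′ (≤-trans (departures-bound un-left) (≤-reflexive (cong (2 +_) (cong₂ _+_ (cong bit Vδ) (cong (∑ (weight V)) eq)))))) (m≤m+n _ _))
                (subst (λ t → θ ≤ weight V t + ∑ (weight V) ns′) (sym (landing-row-other e≢k)) (8-2 right′ (departures-bound un-right)))
              where
              top≡ : top k ≡ y
              top≡ = cong headOr0 (trans (sym upper≡) (cong (_++ suc e ∷ ns′ ++ vs′) eq))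
              un-y : Unique (y ∷ xs ++ suc e ∷ ns′ ++ vs′)
              un-y = subst (λ zs → Unique (zs ++ suc e ∷ ns′ ++ vs′)) eq (AllPairs.tail un₁)
              not-top : ∀ {z} → z ∈ xs ++ suc e ∷ ns′ ++ vs′ → z ≢ top k
              not-top z∈ p = All.lookup (AllPairs.head un-y) z∈ (sym (trans p top≡))
              xs-zero : All (λ m → landing k V m ≡ 0) xs
              xs-zero = All.tabulate λ {z} z∈ → from-ms z∈ (∈-map⁻ suc (subst (z ∈_) (sym eq) (there z∈)))
                where
                from-ms : ∀ {z} → z ∈ xs → ∃[ w ] (w ∈ ms × z ≡ suc w) → landing k V z ≡ 0
                from-ms z∈ (w , w∈ , refl) = landing-zero (∈-++⁺ˡ w∈) (inj₁ (not-top (∈-++⁺ˡ z∈)))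

          module _ (f≢k : f ≢ k) where

            -- If `top k` is in the interval without being its first row, then so is row `δ`, which
            -- directly precedes it. Hence `k` is in the block and, being different from `f`,
            -- unmarked.
            k-between : ∀ {w} → w ∈ ms ++ e ∷ ns → suc w ≡ top k → V k ≡ false
            k-between {w} w∈ eq with ∈-∃++ (∈-map⁺ suc w∈)
            ... | p , q , split≡ = V-false (Ak (last-∈ us′ p {lower k} {δ} (proj₁ (unique-split (us′ ++ suc f ∷ p) (lower k ++ [ δ ]) un-split same))))
              where
              rows-split′ : rows δ ≡ (us′ ++ suc f ∷ p) ++ suc w ∷ (q ++ vs′)
              rows-split′ = trans rows-suc≡ (trans (cong (λ zs → us′ ++ suc f ∷ zs) (trans (sym (++-assoc ms′ (suc e ∷ ns′) vs′))
                  (trans (cong (_++ vs′) (trans (sym (map-++ suc ms (e ∷ ns))) split≡)) (++-assoc p (suc w ∷ q) vs′))))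
                (sym (++-assoc us′ (suc f ∷ p) (suc w ∷ (q ++ vs′)))))
              un-split : Unique ((us′ ++ suc f ∷ p) ++ suc w ∷ (q ++ vs′))
              un-split = subst Unique rows-split′ (rows-unique δ)
              upper-∷ : ∃[ zs ] upper k ≡ suc w ∷ zs
              upper-∷ = by-cases (upper k) refl
                where
                by-cases : ∀ zs → upper k ≡ zs → ∃[ zs′ ] zs ≡ suc w ∷ zs′
                by-cases [] eq′ = contradiction (trans eq (cong headOr0 eq′)) λ ()
                by-cases (z ∷ zs) eq′ = zs , cong (_∷ zs) (sym (trans eq (cong headOr0 eq′)))
              same : (us′ ++ suc f ∷ p) ++ suc w ∷ (q ++ vs′) ≡ (lower k ++ [ δ ]) ++ suc w ∷ proj₁ upper-∷
              same = trans (sym rows-split′) (trans (cong (λ zs → lower k ++ δ ∷ zs) (proj₂ upper-∷)) (sym (++-assoc (lower k) [ δ ] _)))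
              Ak : δ ∈ suc f ∷ p → A k ≡ false
              Ak (here refl) = contradiction refl f≢k
              Ak (there δ∈p) with ∈-map⁻ suc (subst (δ ∈_) (sym split≡) (∈-++⁺ˡ δ∈p))
              ... | _ , k∈ , refl = All.lookup inner k∈

            all-zero : ∀ {w} → w ∈ ms ++ e ∷ ns → landing k V (suc w) ≡ 0
            all-zero {w} w∈ with suc w ≟ top k
            ... | no ≢top = landing-zero w∈ (inj₁ ≢top)
            ... | yes eq  = landing-zero w∈ (inj₂ (k-between w∈ eq))

            f-not-last : Ψ k (V ∪ e) ≤ Ψ k V
            f-not-last with e ≟ k
            ... | no e≢k = Ψ-cut-interval 1≤e e≤k us′ (suc f) ms′ ns′ (vs′ ++ [ 0 ])
                (trans (list≡′ us′ _ rows-suc≡) (cong (λ zs → us′ ++ suc f ∷ zs) (trans (++-assoc ms′ _ [ 0 ])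
                  (cong₂ (λ t q → ms′ ++ t ∷ q) (sym (landing-row-other e≢k)) (++-assoc ns′ vs′ [ 0 ])))))
                (zeros (λ w∈ → all-zero (∈-++⁺ˡ w∈)))
                (subst (λ t → landing k V t ≡ 0) (sym (landing-row-other e≢k)) (all-zero (∈-++⁺ʳ ms (here refl))))
                (zeros (λ w∈ → all-zero (∈-++⁺ʳ ms (there w∈))))
                (≤-trans (8-2 left′ (departures-bound un-left)) (m≤m+n _ _))
                (subst (λ t → θ ≤ weight V t + ∑ (weight V) ns′) (sym (landing-row-other e≢k)) (8-2 right′ (departures-bound un-right)))
            -- The new F-interval starts with row `δ` and is counted one row later. So row `δ` is
            -- assigned to the left part, and the potential is cut at the image of the first row of
            -- `ns`.
            ... | yes e≡k = by-ns ns refl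
              where
              se≡δ : suc e ≡ δ
              se≡δ = cong suc e≡k
              upper≡ : ns′ ++ vs′ ≡ upper k
              upper≡ = proj₂ (unique-split (us′ ++ suc f ∷ ms′) (lower k) (subst Unique flat (rows-unique δ)) (sym flat))
                where
                flat : rows δ ≡ (us′ ++ suc f ∷ ms′) ++ δ ∷ ns′ ++ vs′
                flat = trans rows-suc≡ (trans (cong (λ t → us′ ++ suc f ∷ ms′ ++ t ∷ ns′ ++ vs′) se≡δ) (sym (++-assoc us′ (suc f ∷ ms′) _)))
              by-ns : ∀ xs → ns ≡ xs → Ψ k (V ∪ e) ≤ Ψ k V
              by-ns [] eq = contradiction (≤-trans right′ (≤-trans (≤-reflexive (cong (λ xs → bit (A (suc e)) + ∑ (bit ∘ A) (map suc xs)) eq)) (+-monoˡ-≤ 0 (bit≤1 (A (suc e)))))) λ { (s≤s ()) }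
              by-ns (w ∷ xs) eq = Ψ-cut-interval 1≤e e≤k us′ (suc f) (ms′ ++ [ δ ]) (map suc xs) (vs′ ++ [ 0 ])
                  (trans (list≡′ us′ _ rows-suc≡) (cong (λ zs → us′ ++ suc f ∷ zs) (trans (++-assoc ms′ _ [ 0 ]) (trans (cong (λ zs → ms′ ++ zs)
                    (cong₂ _∷_ se≡δ (trans (++-assoc ns′ vs′ [ 0 ]) (trans (cong (λ zs → map suc zs ++ vs′ ++ [ 0 ]) eq) (cong (λ t → t ∷ map suc xs ++ vs′ ++ [ 0 ]) (sym row≡))))))
                    (sym (++-assoc ms′ [ δ ] _))))))
                  (All.++⁺ (zeros (λ w∈ → all-zero (∈-++⁺ˡ w∈))) (landing-new k V ∷ []))
                  (subst (λ t → landing k V t ≡ 0) (sym row≡) (all-zero (ns-in (here refl))))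
                  (zeros (λ z∈ → all-zero (ns-in (there z∈))))
                  (≤-trans (8-2 left′ (departures-bound un-left)) (≤-trans (+-monoʳ-≤ (weight V (suc f)) (≤-trans (m≤m+n _ _) (≤-reflexive (sym (∑-++ (weight V) ms′ [ δ ]))))) (m≤m+n _ _)))
                  (8-2 right′ (≤-trans (departures-bound un-right) (≤-reflexive (cong (2 +_) (cong₂ _+_ (trans (cong (weight V) se≡δ) (cong bit Vδ))
                    (trans (cong (λ zs → ∑ (weight V) (map suc zs)) eq) (cong (λ t → weight V t + ∑ (weight V) (map suc xs)) (sym row≡))))))))
                where
                row≡ : landing-row k e ≡ suc w
                row≡ = trans (cong (landing-row k) e≡k) (trans (landing-row-last k) (cong headOr0 (trans (sym upper≡) (cong (λ zs → map suc zs ++ vs′) eq))))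
                ns-in : ∀ {z} → z ∈ w ∷ xs → z ∈ ms ++ e ∷ ns
                ns-in {z} z∈ = ∈-++⁺ʳ ms (there (subst (z ∈_) (sym eq) z∈))

        Ψ-cut-heavy-interval : Ψ k (V ∪ e) ≤ Ψ k V
        Ψ-cut-heavy-interval with f ≟ k
        ... | yes f≡k = f-is-last f≡k
        ... | no f≢k  = f-not-last f≢k

    -- An unmarked row is neither the row of `$` nor the row after it, so it can join `V` while the
    -- bit keeps its meaning.
    cut-state : ∀ {e D′} → e ∈ rows δ → A e ≡ false → D′ ≡ toDBWT (A ∪ e) (chr δ) (rows δ) → Ψ k (V ∪ e) ≤ Ψ k V → State k D′ s
    cut-state {e} {D′} e∈ Ae D′≡ bd = record
      { V = V ∪ e
      ; valid = valid′
      ; represents = Represents-cong (λ {z} _ → commute z) (s≤s z≤n) δ≤n (record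
          { D≡ = D′≡ ; coherent = λ eq → more (Represents.coherent represents eq) })
      ; first = λ 1≤k → ∪-true V e {1} (first 1≤k)
      ; flag = flag′ flag
      ; bound = ≤-trans bd bound }
      where
      e≤k : e ≤ k
      e≤k = s≤s⁻¹ (≤∧≢⇒< (proj₂ (rows-bounds δ e∈)) (λ { refl → clash δ Aδ Ae }))
      valid′ : Valid k (V ∪ e)
      valid′ m h with m ≟ e
      ... | yes refl = proj₁ (rows-bounds δ e∈) , e≤k
      ... | no m≢e = valid m (trans (sym (∪-other V m≢e)) h)
      commute : ∀ z → (A ∪ e) z ≡ starts k (V ∪ e) z
      commute z with z ≡ᵇ e | z ≡ᵇ top k | z ≡ᵇ δ
      ... | true  | true  | _     = refl
      ... | true  | false | true  = refl
      ... | true  | false | false = refl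
      ... | false | _     | _     = refl
      more : ∀ {c xs} → Coherent A (chr δ) c xs → Coherent (A ∪ e) (chr δ) c xs
      more [] = []
      more (_∷_ {x = x} h co) = (λ p → h (weaken x p)) ∷ more co
        where
        weaken : ∀ x → (A ∪ e) x ≡ false → A x ≡ false
        weaken x p with x ≡ᵇ e
        ... | false = p
      flag′ : ∀ {s} → Flag k V s → Flag k (V ∪ e) s
      flag′ (whole h) = whole (λ {y} eq → ∪-true V e {y} (h eq))
      flag′ (split us x y vs lo up Vy ex) = split us x y vs lo up
        (trans (∪-other V (λ { refl → clash y (subst (λ w → A w ≡ true) (cong headOr0 up) A-top) Ae })) Vy) ex

-- Suffix arrays and the LF mapping

at-drop : ∀ e i xs j → at e (drop i xs) (suc j) ≡ at e xs (i + suc j)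
at-drop e zero    xs       j = refl
at-drop e (suc i) []       j = refl
at-drop e (suc i) (x ∷ xs) j rewrite +-suc i j = trans (at-drop e i xs j) (cong (at e xs) (+-suc i j))

drop-at : ∀ e i xs → i < length xs → drop i xs ≡ at e xs (suc i) ∷ drop (suc i) xs
drop-at e zero    (x ∷ xs) _       = refl
drop-at e (suc i) (x ∷ xs) (s≤s p) = drop-at e i xs p

at-lookup : ∀ {n} e (T : Vec ℕ n) i → at e (toList T) (suc (toℕ i)) ≡ lookup T i
at-lookup e (x ∷ T) Fin.zero    = refl
at-lookup e (x ∷ T) (Fin.suc i) = at-lookup e T i

at-++ : ∀ e us x vs → at e (us ++ x ∷ vs) (suc (length us)) ≡ x
at-++ e []           x vs = refl
at-++ e (w ∷ us) x vs = at-++ e us x vs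

positionOf-++ : ∀ us {x vs} → All (_≢ x) us → positionOf x (us ++ x ∷ vs) ≡ suc (length us)
positionOf-++ []       {x} []       rewrite ≡ᵇ-refl x = refl
positionOf-++ (w ∷ us) (w≢ ∷ us≢) rewrite ≢⇒≡ᵇ w≢ = cong suc (positionOf-++ us us≢)

∑-↭ : ∀ f {xs ys} → xs ↭ ys → ∑ f xs ≡ ∑ f ys
∑-↭ f {xs} {ys} p = trans (∑-sum xs) (trans (sum-↭ (map⁺ f p)) (sym (∑-sum ys)))
  where
  ∑-sum : ∀ xs → ∑ f xs ≡ sum (map f xs)
  ∑-sum []       = refl
  ∑-sum (x ∷ xs) = cong (f x +_) (∑-sum xs)

∑-map : ∀ f g xs → ∑ f (map g xs) ≡ ∑ (f ∘ g) xs
∑-map f g []       = refl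
∑-map f g (x ∷ xs) = cong (f (g x) +_) (∑-map f g xs)

∑-+ : ∀ f g xs → ∑ f xs + ∑ g xs ≡ ∑ (λ x → f x + g x) xs
∑-+ f g []       = refl
∑-+ f g (x ∷ xs) = trans (interchange (f x) (∑ f xs) (g x) (∑ g xs)) (cong (f x + g x +_) (∑-+ f g xs))

-- Counting marked rows and covered positions

module _ {P : ℕ → Set} (P? : ∀ x → Dec (P x)) where

  indicator : ℕ → ℕ
  indicator x = bit (does (P? x))

  indicator-yes : ∀ {x} → P x → indicator x ≡ 1
  indicator-yes {x} p with P? x
  ... | yes _ = refl
  ... | no ¬p = contradiction p ¬p

  indicator-no : ∀ {x} → ¬ P x → indicator x ≡ 0
  indicator-no {x} ¬p with P? x
  ... | yes p = contradiction p ¬p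
  ... | no _  = refl

  length-filter-∑ : ∀ xs → length (filter P? xs) ≡ ∑ indicator xs
  length-filter-∑ []       = refl
  length-filter-∑ (x ∷ xs) with P? x
  ... | yes _ = cong suc (length-filter-∑ xs)
  ... | no _  = length-filter-∑ xs

map-filter-∘ : ∀ {A : Set} {P : A → Set} {R : ℕ → Set} (P? : ∀ x → Dec (P x)) (R? : ∀ x → Dec (R x)) (f : A → ℕ) →
               (∀ {x} → P x → R (f x)) → (∀ {x} → R (f x) → P x) → ∀ xs → map f (filter P? xs) ≡ filter R? (map f xs)
map-filter-∘ P? R? f to from []       = refl
map-filter-∘ P? R? f to from (x ∷ xs) with P? x | R? (f x)
... | yes p | yes _ = cong (f x ∷_) (map-filter-∘ P? R? f to from xs)
... | no _  | no _  = map-filter-∘ P? R? f to from xs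
... | yes p | no ¬r = contradiction (to p) ¬r
... | no ¬p | yes r = contradiction (from r) ¬p

chosen : (ℕ → Bool) → List ℕ → List ℕ
chosen A []       = []
chosen A (x ∷ xs) = if A x then x ∷ chosen A xs else chosen A xs

chosen-↭ : ∀ A {xs ys} → xs ↭ ys → chosen A xs ↭ chosen A ys
chosen-↭ A {xs} {ys} p = subst₂ _↭_ (chosen≡ xs) (chosen≡ ys) (filter-↭ A? p)
  where
  A? : ∀ x → Dec (A x ≡ true)
  A? x = A x ≟ᵇ true
  chosen≡ : ∀ xs → filter A? xs ≡ chosen A xs
  chosen≡ [] = refl
  chosen≡ (x ∷ xs) with A x
  ... | true  = cong (x ∷_) (chosen≡ xs)
  ... | false = chosen≡ xs

chosen-map : ∀ {A B : ℕ → Bool} f xs → (∀ {x} → x ∈ xs → B (f x) ≡ A x) → chosen B (map f xs) ≡ map f (chosen A xs)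
chosen-map f []       h = refl
chosen-map {A} f (x ∷ xs) h rewrite h (here refl) with A x
... | true  = cong (f x ∷_) (chosen-map f xs (h ∘ there))
... | false = chosen-map f xs (h ∘ there)

chosen-⊆ : ∀ A xs {z} → z ∈ chosen A xs → z ∈ xs
chosen-⊆ A (x ∷ xs) z∈ with A x
chosen-⊆ A (x ∷ xs) (here refl) | true = here refl
chosen-⊆ A (x ∷ xs) (there z∈)  | true = there (chosen-⊆ A xs z∈)
... | false = there (chosen-⊆ A xs z∈)

positions-++ : ∀ A p us vs → positions A p (us ++ vs) ≡ positions A p us ++ positions A (p + length us) vs
positions-++ A p []       vs = cong (λ q → positions A q vs) (sym (+-identityʳ p))
positions-++ A p (w ∷ us) vs with A w
... | true  = cong (p ∷_) (trans (positions-++ A (suc p) us vs) (cong (λ q → positions A (suc p) us ++ positions A q vs) (sym (+-suc p (length us)))))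
... | false = trans (positions-++ A (suc p) us vs) (cong (λ q → positions A (suc p) us ++ positions A q vs) (sym (+-suc p (length us))))

positions-bounds : ∀ A p xs → All (λ v → p ≤ v × v < p + length xs) (positions A p xs)
positions-bounds A p []       = []
positions-bounds A p (x ∷ xs) with A x | positions-bounds A (suc p) xs
... | true  | ih = (≤-refl , ≤-trans (s≤s (m≤m+n p (length xs))) (≤-reflexive (sym (+-suc p _)))) ∷ All.map (λ { (l , r) → <⇒≤ l , ≤-trans r (≤-reflexive (sym (+-suc p _))) }) ih
... | false | ih = All.map (λ { (l , r) → <⇒≤ l , ≤-trans r (≤-reflexive (sym (+-suc p _))) }) ih

positions-sorted : ∀ A p xs → Linked _≤_ (positions A p xs)
positions-sorted A p xs = sorted xs p
  where
  cons : ∀ {v vs} → All (v ≤_) vs → Linked _≤_ vs → Linked _≤_ (v ∷ vs)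
  cons {vs = []} _ _ = [-]
  cons {vs = _ ∷ _} (p ∷ _) l = p ∷ l
  sorted : ∀ xs p → Linked _≤_ (positions A p xs)
  sorted []       p = []
  sorted (x ∷ xs) p with A x
  ... | true  = cons (All.map (λ q → <⇒≤ (proj₁ q)) (positions-bounds A (suc p) xs)) (sorted xs (suc p))
  ... | false = sorted xs (suc p)

length-positions : ∀ A p xs → length (positions A p xs) ≡ ∑ (bit ∘ A) xs
length-positions A p []       = refl
length-positions A p (x ∷ xs) with A x
... | true  = cong suc (length-positions A (suc p) xs)
... | false = length-positions A (suc p) xs

at-positions : ∀ A p xs j → j < ∑ (bit ∘ A) xs →
               ∃[ us ] ∃[ s ] ∃[ vs ] (xs ≡ us ++ s ∷ vs × A s ≡ true × at 0 (positions A p xs) (suc j) ≡ p + length us × ∑ (bit ∘ A) us ≡ j)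
at-positions A p (x ∷ xs) j j< with A x in Ax
at-positions A p (x ∷ xs) zero    j<       | true = [] , x , xs , refl , Ax , sym (+-identityʳ p) , refl
at-positions A p (x ∷ xs) (suc j) (s≤s j<) | true with at-positions A (suc p) xs j j<
... | us , s , vs , eq , As , e , c = x ∷ us , s , vs , cong (x ∷_) eq , As , trans e (sym (+-suc p (length us))) , trans (cong (λ b → bit b + ∑ (bit ∘ A) us) Ax) (cong suc c)
at-positions A p (x ∷ xs) j j< | false with at-positions A (suc p) xs j j<
... | us , s , vs , eq , As , e , c = x ∷ us , s , vs , cong (x ∷_) eq , As , trans e (sym (+-suc p (length us))) , trans (cong (λ b → bit b + ∑ (bit ∘ A) us) Ax) c

InRange : ℕ → ℕ → ℕ → Set
InRange lo hi x = lo ≤ x × x ≤ hi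

inRange? : ∀ lo hi v → Dec (InRange lo hi v)
inRange? lo hi x = (lo ≤? x) ×-dec (x ≤? hi)

positions-range : ∀ A us ms vs → filter (inRange? (suc (length us)) (length us + length ms)) (positions A 1 (us ++ ms ++ vs)) ≡ positions A (suc (length us)) ms
positions-range A us ms vs = begin
  filter R? (positions A 1 (us ++ ms ++ vs))
    ≡⟨ cong (filter R?) (trans (positions-++ A 1 us (ms ++ vs)) (cong (positions A 1 us ++_) (positions-++ A lo ms vs))) ⟩
  filter R? (positions A 1 us ++ positions A lo ms ++ positions A (lo + length ms) vs)
    ≡⟨ trans (filter-++ R? (positions A 1 us) _) (cong (filter R? (positions A 1 us) ++_) (filter-++ R? (positions A lo ms) _)) ⟩
  filter R? (positions A 1 us) ++ filter R? (positions A lo ms) ++ filter R? (positions A (lo + length ms) vs)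
    ≡⟨ cong₂ _++_ (filter-none R? (All.map (λ { (_ , q) (r , _) → <⇒≱ q r }) (positions-bounds A 1 us)))
         (cong₂ _++_ (filter-all R? (All.map (λ { (q , r) → q , s≤s⁻¹ r }) (positions-bounds A lo ms)))
           (filter-none R? (All.map (λ { (q , _) (_ , r) → <⇒≱ q r }) (positions-bounds A (lo + length ms) vs)))) ⟩
  positions A lo ms ++ []
    ≡⟨ ++-identityʳ _ ⟩
  positions A lo ms ∎
  where
  open ≡-Reasoning
  lo : ℕ
  lo = suc (length us)
  R? : ∀ v → Dec (InRange lo (length us + length ms) v)
  R? = inRange? lo (length us + length ms)

∈-pieces : ∀ {D P} → P ∈ pieces D → P ∈ piecesFrom 1 1 D
∈-pieces {D} {P} = subst (P ∈_) (pieces≡ D)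

record IsBlock (A : ℕ → Bool) (chr : ℕ → Char) (xs : List ℕ) (P : Piece) : Set where
  field
    front  : List ℕ
    first  : ℕ
    inside : List ℕ
    after  : List ℕ
    list≡  : xs ≡ front ++ first ∷ inside ++ after
    inner  : All (λ x → A x ≡ false) inside
    start≡ : start P ≡ suc (length front)
    rep≡   : rep P ≡ chr first ^^ suc (length inside)
    cut≡   : ∀ ms e ns → inside ≡ ms ++ e ∷ ns →
             cut (index P) (suc (length ms)) (toDBWT A chr xs) ≡ toDBWT (A ∪ e) chr xs

  end≡ : end P ≡ length front + suc (length inside)
  end≡ = cong₂ (λ p R → p + len R ∸ 1) start≡ rep≡

is-block : ∀ {A chr x xs P} → Coherent A chr (chr x) xs → Unique xs → P ∈ pieces (toDBWT A chr (x ∷ xs)) → IsBlock A chr (x ∷ xs) P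
is-block {A} {chr} {x} {xs} {P} co un P∈ with block-of A chr (chr x) 1 xs 1 1 co un (∈-pieces {toDBWT A chr (x ∷ xs)} P∈)
... | inj₁ B = record
    { front = [] ; first = x ; inside = inside ; after = after ; list≡ = cong (x ∷_) list≡ ; inner = inner
    ; start≡ = start≡ ; rep≡ = rep≡ ; cut≡ = λ ms e ns eq → trans (cong (λ i → cut i (suc (length ms)) (segments A chr (chr x) 1 xs)) index≡) (cut≡ ms e ns eq) }
    where open FirstBlock B
... | inj₂ B = record
    { front = x ∷ before ; first = first ; inside = inside ; after = after ; list≡ = cong (x ∷_) list≡ ; inner = inner
    ; start≡ = start≡ ; rep≡ = rep≡ ; cut≡ = λ ms e ns eq → trans (cong (λ i → cut i (suc (length ms)) (segments A chr (chr x) 1 xs)) index≡) (cut≡ ms e ns eq) }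
    where open LaterBlock B

Coherent-block : ∀ {A chr c ms vs} → Coherent A chr c (ms ++ vs) → All (λ x → A x ≡ false) ms → All (λ x → chr x ≡ c) ms
Coherent-block {ms = []} co [] = []
Coherent-block {ms = m ∷ ms} (h ∷ co) (Am ∷ Ams) = h Am ∷ All.map (λ e → trans e (h Am)) (Coherent-block co Ams)

Coherent-tail : ∀ {A chr c} us {z vs} → Coherent A chr c (us ++ z ∷ vs) → Coherent A chr (chr z) vs
Coherent-tail []       (_ ∷ co) = co
Coherent-tail (w ∷ us) (_ ∷ co) = Coherent-tail us co

block-chars : ∀ {A chr x xs f ms vs} us → Coherent A chr (chr x) xs → x ∷ xs ≡ us ++ f ∷ ms ++ vs →
              All (λ z → A z ≡ false) ms → All (λ z → chr z ≡ chr f) ms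
block-chars []       co refl inner = Coherent-block co inner
block-chars {A} {chr} (w ∷ us) co eq inner with ∷-injective eq
... | refl , eq′ = Coherent-block (Coherent-tail us (subst (Coherent A chr (chr w)) eq′ co)) inner

map-++⁻ : ∀ (f : ℕ → ℕ) xs {us s vs} → map f xs ≡ us ++ s ∷ vs →
          ∃[ us′ ] ∃[ e ] ∃[ vs′ ] (xs ≡ us′ ++ e ∷ vs′ × us ≡ map f us′ × s ≡ f e × vs ≡ map f vs′)
map-++⁻ f (x ∷ xs) {[]}     refl = [] , x , xs , refl , refl , refl , refl
map-++⁻ f (x ∷ xs) {w ∷ us} eq with ∷-injective eq
... | refl , eq′ with map-++⁻ f xs {us} eq′
...   | us′ , e , vs′ , p , q , r , t = x ∷ us′ , e , vs′ , cong (x ∷_) p , cong (f x ∷_) q , r , t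

halves : ∀ {t} → 16 ≤ t → 8 ≤ ⌈ t /2⌉ × ⌈ t /2⌉ < t × (∀ {j} → ⌈ t /2⌉ + j ≡ t → 8 ≤ j)
halves {t} 16≤t = ⌈n/2⌉-mono 16≤t , half<
  , λ {j} eq → subst (8 ≤_) (+-cancelˡ-≡ ⌈ t /2⌉ _ j (trans (trans (+-comm ⌈ t /2⌉ ⌊ t /2⌋) (⌊n/2⌋+⌈n/2⌉≡n t)) (sym eq))) (⌊n/2⌋-mono 16≤t)
  where
  half< : ⌈ t /2⌉ < t
  half< = ≤-trans (+-monoˡ-≤ ⌈ t /2⌉ (≤-trans (s≤s z≤n) (⌊n/2⌋-mono 16≤t))) (≤-reflexive (⌊n/2⌋+⌈n/2⌉≡n t))

-- The row before which a heavy piece is cut. The covered position with number `⌈ t /2⌉ + 1` has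
-- `⌈ t /2⌉` covered ones before it and leaves the other `⌊ t /2⌋` to the right part; for `t ≥ 16`
-- both are at least 8.
Middle : (ℕ → Bool) → ℕ → List ℕ → List ℕ → Set
Middle C p xs cs = ∃[ g₁ ] ∃[ z ] ∃[ g₂ ] (xs ≡ g₁ ++ z ∷ g₂ × at 0 cs (⌈ length cs /2⌉ + 1) ≡ p + length g₁ ×
                                           8 ≤ ∑ (bit ∘ C) g₁ × 8 ≤ ∑ (bit ∘ C) (z ∷ g₂))

at-middle : ∀ {C : ℕ → Bool} p xs {cs} → cs ≡ positions C p xs → 16 ≤ length cs → Middle C p xs cs
at-middle {C} p xs refl h with halves h
... | h₁ , h₂ , h₃ with at-positions C p xs ⌈ length (positions C p xs) /2⌉ (≤-trans h₂ (≤-reflexive (length-positions C p xs)))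
...   | g₁ , z , g₂ , eq , _ , e , c = g₁ , z , g₂ , eq
      , trans (cong (at 0 (positions C p xs)) (+-comm ⌈ length (positions C p xs) /2⌉ 1)) e
      , subst (8 ≤_) (sym c) h₁
      , h₃ (trans (cong (_+ ∑ (bit ∘ C) (z ∷ g₂)) (sym c)) (trans (sym (∑-++ (bit ∘ C) g₁ (z ∷ g₂))) (trans (cong (∑ (bit ∘ C)) (sym eq)) (sym (length-positions C p xs)))))

replicate-+ : ∀ m n (c : Char) → replicate (m + n) c ≡ replicate m c ++ replicate n c
replicate-+ zero    n c = refl
replicate-+ (suc m) n c = cong (c ∷_) (replicate-+ m n c)

expand-join : ∀ D {Q R} E → char Q ≡ char R → expand (D ++ Q ∷ R ∷ E) ≡ expand (D ++ (Q ⊕ R) ∷ E)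
expand-join D {Q} {R} E e = trans (concatMap-++ _ D (Q ∷ R ∷ E)) (trans (cong (expand D ++_) step) (sym (concatMap-++ _ D ((Q ⊕ R) ∷ E))))
  where
  step : replicate (len Q) (char Q) ++ replicate (len R) (char R) ++ expand E ≡ replicate (len Q + len R) (char Q) ++ expand E
  step = trans (sym (++-assoc (replicate (len Q) (char Q)) _ _)) (cong (_++ expand E)
    (trans (cong (λ c → replicate (len Q) (char Q) ++ replicate (len R) c) (sym e)) (sym (replicate-+ (len Q) (len R) (char Q)))))

double-count : ∀ {A : Set} {R : A → A → Set} (R? : ∀ a b → Dec (R a b)) xs ys →
               (∀ {b} → b ∈ ys → length (filter (λ a → R? a b) xs) ≤ 1) → sum (map (λ a → length (filter (R? a) ys)) xs) ≤ length ys
double-count {A} R? xs [] h = ≤-reflexive (zeros xs)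
  where
  zeros : ∀ xs → sum (map (λ (a : A) → 0) xs) ≡ 0
  zeros []       = refl
  zeros (x ∷ xs) = zeros xs
double-count R? xs (b ∷ ys) h = ≤-trans (≤-reflexive (column xs)) (+-mono-≤ (h (here refl)) (double-count R? xs ys (h ∘ there)))
  where
  column : ∀ xs → sum (map (λ a → length (filter (R? a) (b ∷ ys))) xs) ≡ length (filter (λ a → R? a b) xs) + sum (map (λ a → length (filter (R? a) ys)) xs)
  column []       = refl
  column (x ∷ xs) with R? x b
  ... | yes _ = cong suc (trans (cong (length (filter (R? x) ys) +_) (column xs)) (x∙yz≈y∙xz (length (filter (R? x) ys)) (length (filter (λ a → R? a b) xs)) _))
  ... | no _ = trans (cong (length (filter (R? x) ys) +_) (column xs)) (x∙yz≈y∙xz (length (filter (R? x) ys)) (length (filter (λ a → R? a b) xs)) _)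

filter-length-mono : ∀ {A : Set} {P Q : A → Set} (P? : ∀ x → Dec (P x)) (Q? : ∀ x → Dec (Q x)) xs → (∀ {x} → x ∈ xs → P x → Q x) →
                     length (filter P? xs) ≤ length (filter Q? xs)
filter-length-mono P? Q? []       h = z≤n
filter-length-mono P? Q? (x ∷ xs) h with P? x | Q? x
... | yes _ | yes _ = s≤s (filter-length-mono P? Q? xs (h ∘ there))
... | yes p | no ¬q = contradiction (h (here refl) p) ¬q
... | no _  | yes _ = m≤n⇒m≤1+n (filter-length-mono P? Q? xs (h ∘ there))
... | no _  | no _  = filter-length-mono P? Q? xs (h ∘ there)

Spans : ℕ → Piece → Set
Spans p P = start P ≤ p × p ≤ end P

spans? : ∀ p P → Dec (Spans p P)
spans? p P = (start P ≤? p) ×-dec (p ≤? end P)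

spans-none : ∀ {q} i p D → q < p → length (filter (spans? q) (piecesFrom i p D)) ≡ 0
spans-none i p []      _   = refl
spans-none {q} i p (R ∷ D) q<p = trans
  (cong length (filter-reject (spans? q) {record { index = i ; start = p ; rep = R }} {piecesFrom (suc i) (p + len R) D} (λ { (p≤q , _) → <⇒≱ q<p p≤q })))
  (spans-none (suc i) (p + len R) D (≤-trans q<p (m≤m+n p (len R))))

spans-once : ∀ {q} i p D → All (λ R → 1 ≤ len R) D → length (filter (spans? q) (piecesFrom i p D)) ≤ 1
spans-once i p []      _ = z≤n
spans-once {q} i p (R ∷ D) (1≤ ∷ 1≤s) = by-dec (spans? q P)
  where
  P : Piece
  P = record { index = i ; start = p ; rep = R }
  Ps : List Piece
  Ps = piecesFrom (suc i) (p + len R) D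
  by-dec : Dec (Spans q P) → length (filter (spans? q) (P ∷ Ps)) ≤ 1
  by-dec (no ¬s) = ≤-trans (≤-reflexive (cong length (filter-reject (spans? q) {P} {Ps} ¬s))) (spans-once (suc i) (p + len R) D 1≤s)
  by-dec (yes s) = ≤-trans (≤-reflexive (cong length (filter-accept (spans? q) {P} {Ps} s)))
    (s≤s (≤-reflexive (spans-none (suc i) (p + len R) D (≤-trans (s≤s (proj₂ s)) (≤-reflexive (m+[n∸m]≡n (≤-trans 1≤ (m≤n+m (len R) p))))))))

piece-in-expand : ∀ i p D {P} → P ∈ piecesFrom i p D →
                  ∃[ us ] ∃[ vs ] (expand D ≡ us ++ replicate (len (rep P)) (char (rep P)) ++ vs × start P ≡ p + length us × rep P ∈ D)
piece-in-expand i p (R ∷ D) (here refl) = [] , expand D , refl , sym (+-identityʳ p) , here refl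
piece-in-expand i p (R ∷ D) {P} (there P∈) with piece-in-expand (suc i) (p + len R) D P∈
... | us , vs , eq , e , R∈ = replicate (len R) (char R) ++ us , vs
      , trans (cong (replicate (len R) (char R) ++_) eq) (sym (++-assoc (replicate (len R) (char R)) us _))
      , trans e (trans (+-assoc p (len R) (length us)) (cong (p +_) (sym (trans (length-++ (replicate (len R) (char R))) (cong (_+ length us) (length-replicate (len R)))))))
      , there R∈

length-piecesFrom : ∀ i p D → length (piecesFrom i p D) ≡ length D
length-piecesFrom i p []      = refl
length-piecesFrom i p (R ∷ D) = cong suc (length-piecesFrom (suc i) (p + len R) D)

length-pieces : ∀ D → length (pieces D) ≡ length D
length-pieces D = trans (cong length (pieces≡ D)) (length-piecesFrom 1 1 D)

sum-bound : ∀ {A : Set} {f : A → ℕ} {c xs} → All (λ x → f x ≤ c) xs → sum (map f xs) ≤ length xs * c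
sum-bound []       = z≤n
sum-bound (p ∷ ps) = +-mono-≤ p (sum-bound ps)

length-concatMap : ∀ {A B : Set} (f : A → List B) xs → length (concatMap f xs) ≡ sum (map (length ∘ f) xs)
length-concatMap f []       = refl
length-concatMap f (x ∷ xs) = trans (length-++ (f x)) (cong (length (f x) +_) (length-concatMap f xs))

All-concatMap : ∀ {A B : Set} {P : B → Set} (f : A → List B) {xs} → (∀ {x} → x ∈ xs → All P (f x)) → All P (concatMap f xs)
All-concatMap f {[]}     h = []
All-concatMap f {x ∷ xs} h = All.++⁺ (h (here refl)) (All-concatMap f (h ∘ there))

-- Sizes of B-trees and of numbers

module _ {A : Set} {t : ℕ} (2≤t : 2 ≤ t) where

  mutual
    -- Every node other than the root has at least `t - 1 ≥ 1` keys, and the root has one by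
    -- `1 ≤ m`; each key is in one node.
    nodeCount-≤ : ∀ {h m} {b : BTree A h} → 1 ≤ m → Filled t m b → nodeCount b ≤ length (inorder b)
    nodeCount-≤ 1≤m (leaf m≤ _) = ≤-trans 1≤m m≤
    nodeCount-≤ {b = node b bs} 1≤m (node m≤ _ fb fbs) = begin
      suc (nodeCount b + nodeCounts bs) ≡⟨ +-suc (nodeCount b) (nodeCounts bs) ⟨
      nodeCount b + suc (nodeCounts bs) ≤⟨ +-mono-≤ (nodeCount-≤ (∸-monoˡ-≤ 1 2≤t) fb) (nodeCounts-≤ (≤-trans 1≤m m≤) fbs) ⟩
      length (inorder b) + length (inorders bs) ≡⟨ length-++ (inorder b) ⟨
      length (inorder b ++ inorders bs) ∎
      where open ≤-Reasoning

    nodeCounts-≤ : ∀ {h} {bs : List (A × BTree A h)} → 1 ≤ length bs → All (Filled t (t ∸ 1) ∘ proj₂) bs → suc (nodeCounts bs) ≤ length (inorders bs)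
    nodeCounts-≤ {bs = (k , b) ∷ []}      _ (f ∷ [])     = s≤s (≤-trans (+-monoˡ-≤ 0 (nodeCount-≤ (∸-monoˡ-≤ 1 2≤t) f)) (≤-reflexive (sym (length-++ (inorder b)))))
    nodeCounts-≤ {bs = (k , b) ∷ c ∷ bs} _ (f ∷ fs) = s≤s (≤-trans (+-mono-≤ (nodeCount-≤ (∸-monoˡ-≤ 1 2≤t) f) (≤-trans (n≤1+n _) (nodeCounts-≤ {bs = c ∷ bs} (s≤s z≤n) fs)))
                                                        (≤-reflexive (sym (length-++ (inorder b)))))

  -- Only a root that is a leaf may be empty, hence the additional 1.
  IsBTree-size : ∀ {h} {b : BTree A h} → IsBTree t b → nodeCount b ≤ suc (length (inorder b))
  IsBTree-size {b = leaf ks}           _ = s≤s z≤n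
  IsBTree-size {h = suc h} {b = node _ _} f = m≤n⇒m≤1+n (nodeCount-≤ (s≤s z≤n) f)

-- Rounding costs a factor 2 at most, because `⌊log₂ n ⌋ + 1 ≤ 2 * ⌊log₂ n ⌋` for `n ≥ 2`.
log-^ : ∀ e {n} → 2 ≤ n → ⌊log₂ n ^ e ⌋ ≤ (2 * e) * ⌊log₂ n ⌋
log-^ e {n} 2≤n = begin
  ⌊log₂ n ^ e ⌋ ≤⟨ ⌊log₂⌋-mono-≤ (^-monoˡ-≤ e n≤) ⟩
  ⌊log₂ (2 ^ suc ⌊log₂ n ⌋) ^ e ⌋ ≡⟨ cong ⌊log₂_⌋ (^-*-assoc 2 (suc ⌊log₂ n ⌋) e) ⟩
  ⌊log₂ 2 ^ (suc ⌊log₂ n ⌋ * e) ⌋ ≡⟨ ⌊log₂[2^n]⌋≡n (suc ⌊log₂ n ⌋ * e) ⟩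
  suc ⌊log₂ n ⌋ * e ≤⟨ *-monoˡ-≤ e (+-monoˡ-≤ ⌊log₂ n ⌋ 1≤log) ⟩
  (⌊log₂ n ⌋ + ⌊log₂ n ⌋) * e ≡⟨ lem ⌊log₂ n ⌋ e ⟩
  (2 * e) * ⌊log₂ n ⌋ ∎
  where
  open ≤-Reasoning
  lem : ∀ l e → (l + l) * e ≡ (2 * e) * l
  lem = solve-∀
  1≤log : 1 ≤ ⌊log₂ n ⌋
  1≤log = ⌊log₂⌋-mono-≤ 2≤n
  n≤ : n ≤ 2 ^ suc ⌊log₂ n ⌋
  n≤ with n ≤? 2 ^ suc ⌊log₂ n ⌋
  ... | yes p = p
  ... | no ¬p = contradiction (≤-trans (≤-reflexive (sym (⌊log₂[2^n]⌋≡n (suc ⌊log₂ n ⌋)))) (⌊log₂⌋-mono-≤ (<⇒≤ (≰⇒> ¬p)))) (<-irrefl refl)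

module _ (K : Constants) (n w : ℕ) .{{_ : NonZero w}} where

  words-mono : ∀ {l m} → l ≤ m → words K n w l ≤ words K n w m
  words-mono l≤m = s≤s (/-monoˡ-≤ w (⌊log₂⌋-mono-≤ l≤m))

  words-bits : ∀ m → w * words K n w m ≤ w + ⌊log₂ m ⌋
  words-bits m = ≤-trans (≤-reflexive (*-suc w _)) (+-monoʳ-≤ w (≤-trans (≤-reflexive (*-comm w _)) (m/n*n≤m ⌊log₂ m ⌋ w)))

map-split : ∀ (f : ℕ → ℕ) xs us {c vs} → map f xs ≡ us ++ c ∷ vs → ∃[ ws ] ∃[ m ] ∃[ zs ] (xs ≡ ws ++ m ∷ zs × length ws ≡ length us × f m ≡ c)
map-split f xs us eq with map-++⁻ f xs {us} eq
... | ws , m , zs , p , refl , refl , _ = ws , m , zs , p , sym (length-map f ws) , refl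

-- The rows of a text

module Text {d n : ℕ} (T : Text n) (2≤n : 2 ≤ n) (input : IsInput d n T) where

  open IsInput input

  str : List Char
  str = toList T

  abstract
    -- This is `T[n - m]`, with the default `$` for `m = n` in accordance with `T[0] := $`. It is
    -- abstract, so that it unfolds through `ch-def` only.
    ch : ℕ → Char
    ch m = at $ str (n ∸ m)

    ch-def : ∀ m → ch m ≡ at $ str (n ∸ m)
    ch-def m = refl

  at-index : ∀ {j} (j<n : j < n) → at $ str (suc j) ≡ lookup T (fromℕ< j<n)
  at-index j<n = trans (cong (λ i → at $ str (suc i)) (sym (toℕ-fromℕ< j<n))) (at-lookup $ T (fromℕ< j<n))

  ch-zero : ch 0 ≡ 1
  ch-zero = trans (ch-def 0) (trans (cong (at $ str) (sym suc-pred-n)) (trans (at-index j<n) (Equivalence.from ($-last (fromℕ< j<n)) (trans (cong suc (toℕ-fromℕ< j<n)) suc-pred-n))))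
    where
    suc-pred-n : suc (pred n) ≡ n
    suc-pred-n = m+[n∸m]≡n (≤-trans (s≤s z≤n) 2≤n)
    j<n : pred n < n
    j<n = ≤-reflexive suc-pred-n

  ch-pos : ∀ {m} → 1 ≤ m → m < n → 1 < ch m
  ch-pos {m} 1≤m m<n = ≤∧≢⇒< (subst (1 ≤_) (sym at≡) (proj₁ (inAlphabet i)))
    (λ e → <⇒≢ (∸-monoʳ-< {n} {m} {0} 1≤m (<⇒≤ m<n))
             (trans (sym n∸m≡) (trans (cong suc (sym (toℕ-fromℕ< j<n))) (Equivalence.to ($-last i) (trans (sym at≡) (sym e))))))
    where
    n∸m≡ : suc (n ∸ suc m) ≡ n ∸ m
    n∸m≡ = sym (+-∸-assoc 1 m<n)
    j<n : n ∸ suc m < n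
    j<n = ≤-trans (≤-reflexive n∸m≡) (m∸n≤m n m)
    i : Fin n
    i = fromℕ< j<n
    at≡ : ch m ≡ lookup T i
    at≡ = trans (ch-def m) (trans (cong (at $ str) (sym n∸m≡)) (at-index j<n))

  1≤n^d : 1 ≤ n ^ d
  1≤n^d = let i = fromℕ< {0} (≤-trans (s≤s z≤n) 2≤n) in ≤-trans (proj₁ (inAlphabet i)) (proj₂ (inAlphabet i))

  ch-bound : ∀ m → ch m ≤ n ^ d
  ch-bound m = subst (_≤ n ^ d) (sym (ch-def m)) (bound (n ∸ m) (m∸n≤m n m))
    where
    bound : ∀ i → i ≤ n → at $ str i ≤ n ^ d
    bound zero    _   = 1≤n^d
    bound (suc i) i<n = subst (_≤ n ^ d) (sym (at-index i<n)) (proj₂ (inAlphabet (fromℕ< i<n)))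

  open UpdateStep n ch ch-zero ch-pos public

  S : ℕ → List Char
  S = suffix T

  S-suc : ∀ {m} → m < n → S (suc m) ≡ ch m ∷ S m
  S-suc {m} m<n = trans (drop-at $ (n ∸ suc m) str (subst (n ∸ suc m <_) (sym (length-toList T)) (≤-trans (≤-reflexive n∸m≡) (m∸n≤m n m))))
    (cong₂ _∷_ (trans (cong (at $ str) n∸m≡) (sym (ch-def m))) (cong (λ j → drop j str) n∸m≡))
    where
    n∸m≡ : suc (n ∸ suc m) ≡ n ∸ m
    n∸m≡ = sym (+-∸-assoc 1 m<n)

  length-S : ∀ {m} → m ≤ n → length (S m) ≡ m
  length-S {m} m≤n = trans (length-drop (n ∸ m) str) (trans (cong (_∸ (n ∸ m)) (length-toList T)) (m∸[m∸n]≡n m≤n))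

  S-zero : S 0 ≡ []
  S-zero with S 0 | length-S z≤n
  ... | [] | _ = refl

  private
    module Order = DecTotalOrder (Lex.≤-decTotalOrder ≤-decTotalOrder)

  -- Connects `_⊏_`, which refers to `ch` alone, with the lexicographic order by which the suffixes
  -- are sorted.
  S-mono : ∀ {l m} → l ≤ n → m ≤ n → l ⊏ m → S l Order.≤ S m
  S-mono l≤n m≤n (empty {m}) rewrite S-zero | S-suc m≤n = LexCore.halt
  S-mono l<n m<n (char< {l} {m} p) rewrite S-suc l<n | S-suc m<n = LexCore.this (<⇒≤ p , <⇒≢ p)
  S-mono l<n m<n (char≡ {l} {m} e p) rewrite S-suc l<n | S-suc m<n = LexCore.next e (S-mono (<⇒≤ l<n) (<⇒≤ m<n) p)

  module _ {δ : ℕ} (1≤δ : 1 ≤ δ) (δ≤n : δ ≤ n) where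

    ∈-≤n : ∀ {m} → m ∈ rows δ → m ≤ n
    ∈-≤n m∈ = ≤-trans (proj₂ (rows-bounds δ m∈)) δ≤n

    private
      sorted-S : ∀ {xs} → (∀ {m} → m ∈ xs → m ≤ n) → Sorted xs → Linked Order._≤_ (map S xs)
      sorted-S {[]}         _ _ = []
      sorted-S {x ∷ []}     _ _ = [-]
      sorted-S {x ∷ y ∷ xs} h ((p ∷ _) ∷ s) = S-mono (h (here refl)) (h (there (here refl))) p ∷ sorted-S (h ∘ there) s

      lengths : List ℕ
      lengths = map (δ ∸_) (upTo δ)

      lengths↭ : lengths ↭ rows δ
      lengths↭ = same-members⇒↭ (Unique-lengths (upTo δ) (Unique.upTo⁺ δ) (λ i∈ → ∈-upTo⁻ i∈)) (rows-unique δ) to from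
        where
        Unique-lengths : ∀ xs → Unique xs → (∀ {i} → i ∈ xs → i < δ) → Unique (map (δ ∸_) xs)
        Unique-lengths [] _ _ = []
        Unique-lengths (x ∷ xs) (x∉ ∷ un) h = All.map⁺ (All.tabulate λ y∈ e → All.lookup x∉ y∈ (∸-cancelˡ-≡ (<⇒≤ (h (here refl))) (<⇒≤ (h (there y∈))) e))
          ∷ Unique-lengths xs un (h ∘ there)
        to : ∀ {m} → m ∈ lengths → m ∈ rows δ
        to m∈ with ∈-map⁻ (δ ∸_) m∈
        ... | i , i∈ , refl = rows⁺ δ (m<n⇒0<n∸m (∈-upTo⁻ i∈)) (m∸n≤m δ i)
        from : ∀ {m} → m ∈ rows δ → m ∈ lengths
        from {m} m∈ with rows-bounds δ m∈
        ... | 1≤m , m≤δ = subst (_∈ lengths) (m∸[m∸n]≡n m≤δ) (∈-map⁺ (δ ∸_) (∈-upTo⁺ (∸-monoʳ-< {δ} {m} {0} 1≤m m≤δ)))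

      drops≡ : map (λ i → drop i (suffix T δ)) (upTo δ) ≡ map S lengths
      drops≡ = trans (map-cong-local (All.tabulate λ {i} i∈ → trans (drop-drop (n ∸ δ) i str) (cong (λ j → drop j str) (index≡ i (<⇒≤ (∈-upTo⁻ i∈)))))) (map-∘ (upTo δ))
        where
        index≡ : ∀ i → i ≤ δ → n ∸ δ + i ≡ n ∸ (δ ∸ i)
        index≡ i i≤δ = sym (trans (cong (_∸ (δ ∸ i)) (trans (sym (m∸n+n≡m δ≤n)) (trans (cong (n ∸ δ +_) (sym (trans (+-comm i (δ ∸ i)) (m∸n+n≡m i≤δ)))) (sym (+-assoc (n ∸ δ) i (δ ∸ i))))))
                        (m+n∸n≡m (n ∸ δ + i) (δ ∸ i)))

      -- Sorted lists that are permutations of each other agree.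
      sorted≡ : sortStrings (map (λ i → drop i (suffix T δ)) (upTo δ)) ≡ map S (rows δ)
      sorted≡ = Pointwise.Pointwise-≡⇒≡ (Pointwise.map (Pointwise.Pointwise-≡⇒≡)
        (↗↭↗⇒≋ Order.totalOrder (sortStrings-↗ _) (sorted-S ∈-≤n (rows-sorted δ))
          (↭⇒↭ₛ′ Order.Eq.isEquivalence (↭-trans (sortStrings-↭ _) (↭-trans (↭-reflexive drops≡) (map⁺ S lengths↭))))))

    suffixArray≡ : suffixArray T δ ≡ map (suc δ ∸_) (rows δ)
    suffixArray≡ = begin
      map (λ s → suc δ ∸ length s) (sortStrings (map (λ i → drop i (suffix T δ)) (upTo δ))) ≡⟨ cong (map (λ s → suc δ ∸ length s)) sorted≡ ⟩
      map (λ s → suc δ ∸ length s) (map S (rows δ)) ≡⟨ map-∘ (rows δ) ⟨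
      map (λ m → suc δ ∸ length (S m)) (rows δ) ≡⟨ map-cong-local (All.tabulate λ m∈ → cong (suc δ ∸_) (length-S (∈-≤n m∈))) ⟩
      map (suc δ ∸_) (rows δ) ∎
      where
      open ≡-Reasoning

    bwt≡ : bwt T δ ≡ map (chr δ) (rows δ)
    bwt≡ = begin
      map (λ x → at $ (suffix T δ) (x ∸ 1)) (suffixArray T δ) ≡⟨ cong (map (λ x → at $ (suffix T δ) (x ∸ 1))) suffixArray≡ ⟩
      map (λ x → at $ (suffix T δ) (x ∸ 1)) (map (suc δ ∸_) (rows δ)) ≡⟨ map-∘ (rows δ) ⟨
      map (λ m → at $ (suffix T δ) (suc δ ∸ m ∸ 1)) (rows δ) ≡⟨ map-cong-local (All.tabulate λ m∈ → char-at (proj₁ (rows-bounds δ m∈)) (proj₂ (rows-bounds δ m∈))) ⟩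
      map (chr δ) (rows δ) ∎
      where
      open ≡-Reasoning
      char-at : ∀ {m} → 1 ≤ m → m ≤ δ → at $ (suffix T δ) (suc δ ∸ m ∸ 1) ≡ chr δ m
      char-at {m} 1≤m m≤δ with m ≟ δ
      ... | yes refl rewrite m+n∸n≡m 1 m = sym (chr-last m)
      ... | no m≢δ = begin
          at $ (suffix T δ) (suc δ ∸ m ∸ 1) ≡⟨ cong (at $ (suffix T δ)) (trans (cong (_∸ 1) (+-∸-assoc 1 m≤δ)) (sym suc≡)) ⟩
          at $ (suffix T δ) (suc (δ ∸ suc m)) ≡⟨ at-drop $ (n ∸ δ) str (δ ∸ suc m) ⟩
          at $ str (n ∸ δ + suc (δ ∸ suc m)) ≡⟨ cong (at $ str) (trans (cong (n ∸ δ +_) suc≡) (trans (sym (+-∸-assoc (n ∸ δ) m≤δ)) (cong (_∸ m) (m∸n+n≡m δ≤n)))) ⟩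
          at $ str (n ∸ m) ≡⟨ ch-def m ⟨
          ch m ≡⟨ chr-other m≢δ ⟨
          chr δ m ∎
        where
        suc≡ : suc (δ ∸ suc m) ≡ δ ∸ m
        suc≡ = sym (+-∸-assoc 1 (≤∧≢⇒< m≤δ m≢δ))

  pos : ℕ → ℕ → ℕ
  pos δ m = positionOf m (rows δ)

  pos-++ : ∀ {δ m} us {vs} → rows δ ≡ us ++ m ∷ vs → pos δ m ≡ suc (length us)
  pos-++ {δ} {m} us eq = trans (cong (positionOf m) eq)
    (positionOf-++ us (All.tabulate λ w∈ → AllPairs-across us (subst Unique eq (rows-unique δ)) w∈ (here refl)))

  module _ {δ : ℕ} (1≤δ : 1 ≤ δ) (δ≤n : δ ≤ n) where

    -- The suffix array entry of row `m` is `suc δ ∸ m`. One position to the left in the text begins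
    -- the suffix longer by one; from the first position, that of row `δ`, LF goes to position `δ`,
    -- that of row 1.
    LF≡ : ∀ {m} → m ∈ rows δ → LF T δ (pos δ m) ≡ pos δ (next δ m)
    LF≡ {m} m∈ with ∈-∃++ m∈
    ... | us , vs , eq = begin
        LF T δ (pos δ m) ≡⟨ cong (λ xs → LF′ xs (at 0 xs (pos δ m))) (suffixArray≡ 1≤δ δ≤n) ⟩
        LF′ (map (suc δ ∸_) (rows δ)) (at 0 (map (suc δ ∸_) (rows δ)) (pos δ m)) ≡⟨ cong (LF′ (map (suc δ ∸_) (rows δ))) at≡ ⟩
        LF′ (map (suc δ ∸_) (rows δ)) (suc δ ∸ m) ≡⟨ cong (λ x → positionOf x (map (suc δ ∸_) (rows δ))) goal≡ ⟩
        positionOf (suc δ ∸ next δ m) (map (suc δ ∸_) (rows δ)) ≡⟨ position-map (rows δ) id (next-∈ δ≤n m∈) ⟩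
        pos δ (next δ m) ∎
      where
      open ≡-Reasoning
      LF′ : List ℕ → ℕ → ℕ
      LF′ xs x = positionOf (if x ≡ᵇ 1 then δ else x ∸ 1) xs
      at≡ : at 0 (map (suc δ ∸_) (rows δ)) (pos δ m) ≡ suc δ ∸ m
      at≡ = trans (cong₂ (at 0) (trans (cong (map (suc δ ∸_)) eq) (map-++ (suc δ ∸_) us (m ∷ vs))) (trans (pos-++ {δ} us eq) (cong suc (sym (length-map (suc δ ∸_) us)))))
              (at-++ 0 (map (suc δ ∸_) us) (suc δ ∸ m) (map (suc δ ∸_) vs))
      goal≡ : (if (suc δ ∸ m) ≡ᵇ 1 then δ else suc δ ∸ m ∸ 1) ≡ suc δ ∸ next δ m
      goal≡ with m ≟ δ
      ... | yes refl rewrite m+n∸n≡m 1 m | origin-last m = refl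
      ... | no m≢δ rewrite origin-other m≢δ | ≢⇒≡ᵇ {suc δ ∸ m} {1} (λ e → m≢δ (≤-antisym (proj₂ (rows-bounds δ m∈)) (m∸n≡0⇒m≤n (suc-injective (trans (sym (+-∸-assoc 1 (proj₂ (rows-bounds δ m∈)))) e))))) =
            trans (∸-+-assoc (suc δ) m 1) (cong (suc δ ∸_) (+-comm m 1))
      position-map : ∀ xs → (∀ {z} → z ∈ xs → z ∈ rows δ) → ∀ {w} → w ∈ rows δ → positionOf (suc δ ∸ w) (map (suc δ ∸_) xs) ≡ positionOf w xs
      position-map []       h w∈ = refl
      position-map (z ∷ zs) h {w} w∈ with z ≟ w
      ... | yes refl rewrite ≡ᵇ-refl (suc δ ∸ z) | ≡ᵇ-refl z = refl
      ... | no z≢w rewrite ≢⇒≡ᵇ z≢w | ≢⇒≡ᵇ {suc δ ∸ z} {suc δ ∸ w} (λ e → z≢w (∸-cancelˡ-≡ (m≤n⇒m≤1+n (proj₂ (rows-bounds δ (h (here refl))))) (m≤n⇒m≤1+n (proj₂ (rows-bounds δ w∈))) e)) =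
            cong suc (position-map zs (h ∘ there) w∈)

  module _ {k : ℕ} (δ<n : suc k < n) where

    private
      δ : ℕ
      δ = suc k
      c : Char
      c = ch δ
      1<c : 1 < c
      1<c = ch-pos (s≤s z≤n) δ<n
      δ≤n : δ ≤ n
      δ≤n = <⇒≤ δ<n

    rep$≡ : rep$ T δ ≡ suc (length (lower k))
    rep$≡ = trans (cong (positionOf $) (trans (bwt≡ (s≤s z≤n) δ≤n) (trans (map-++ (chr δ) (lower k) (δ ∷ upper k)) (cong (λ x → map (chr δ) (lower k) ++ x ∷ map (chr δ) (upper k)) (chr-last δ)))))
      (trans (positionOf-++ (map (chr δ) (lower k)) (All.map⁺ (All.tabulate λ z∈ e →
          <⇒≢ (chr-pos δ≤n (rows-suc k (lower-∈ {k} z∈)) (<⇒≢ (s≤s (proj₂ (rows-bounds k (lower-∈ {k} z∈)))))) (sym e))))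
        (cong suc (length-map (chr δ) (lower k))))

    private
      arrives : ℕ → ℕ
      arrives m = indicator (_⊏? suc δ) (next δ m)

      smaller equals : ℕ → ℕ
      smaller m  = indicator (_<? c) (chr δ m)
      equals m = indicator (_≟ c) (chr δ m)

      next-old : ∀ {m} → m ∈ rows k → next δ m ≡ suc m
      next-old m∈ = cong suc (origin-other (<⇒≢ (s≤s (proj₂ (rows-bounds k m∈)))))

      chr-old : ∀ {m} → m ∈ rows k → chr δ m ≡ ch m
      chr-old m∈ = chr-other (<⇒≢ (s≤s (proj₂ (rows-bounds k m∈))))

      smaller-is : ∀ {m v} → m ∈ rows k → indicator (_<? c) (ch m) ≡ v → smaller m ≡ v
      smaller-is m∈ = trans (cong (indicator (_<? c)) (chr-old m∈))

      equals-is : ∀ {m v} → m ∈ rows k → indicator (_≟ c) (ch m) ≡ v → equals m ≡ v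
      equals-is m∈ = trans (cong (indicator (_≟ c)) (chr-old m∈))

      arrives-is : ∀ {m v} → m ∈ rows k → indicator (_⊏? suc δ) (suc m) ≡ v → arrives m ≡ v
      arrives-is m∈ = trans (cong (indicator (_⊏? suc δ)) (next-old m∈))

      on-lower : ∀ {m} → m ∈ lower k → smaller m + equals m ≡ arrives m
      on-lower {m} m∈l with lower-∈ {k} m∈l | <-cmp (ch m) c
      ... | m∈ | tri< p q _ = trans (cong₂ _+_ (smaller-is m∈ (indicator-yes (_<? c) {ch m} p)) (equals-is m∈ (indicator-no (_≟ c) {ch m} q)))
                                (sym (arrives-is m∈ (indicator-yes (_⊏? suc δ) {suc m} (char< p))))
      ... | m∈ | tri≈ p q _ = trans (cong₂ _+_ (smaller-is m∈ (indicator-no (_<? c) {ch m} p)) (equals-is m∈ (indicator-yes (_≟ c) {ch m} q)))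
                                (sym (arrives-is m∈ (indicator-yes (_⊏? suc δ) {suc m} (char≡ q (All.lookup (lower-⊏ k) m∈l)))))
      ... | m∈ | tri> p q r = trans (cong₂ _+_ (smaller-is m∈ (indicator-no (_<? c) {ch m} p)) (equals-is m∈ (indicator-no (_≟ c) {ch m} q)))
                                (sym (arrives-is m∈ (indicator-no (_⊏? suc δ) {suc m} (⊏-asym (char< r)))))

      on-upper : ∀ {m} → m ∈ upper k → smaller m ≡ arrives m
      on-upper {m} m∈u with upper-∈ {k} m∈u | <-cmp (ch m) c
      ... | m∈ | tri< p q _ = trans (smaller-is m∈ (indicator-yes (_<? c) {ch m} p)) (sym (arrives-is m∈ (indicator-yes (_⊏? suc δ) {suc m} (char< p))))
      ... | m∈ | tri≈ p q _ = trans (smaller-is m∈ (indicator-no (_<? c) {ch m} p))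
                                (sym (arrives-is m∈ (indicator-no (_⊏? suc δ) {suc m} (λ r → ⊏-asym (All.lookup (upper-⊏ k) m∈u) (⊏-cancel r q)))))
      ... | m∈ | tri> p q r = trans (smaller-is m∈ (indicator-no (_<? c) {ch m} p)) (sym (arrives-is m∈ (indicator-no (_⊏? suc δ) {suc m} (⊏-asym (char< r)))))

      chr-δ : chr δ δ ≡ 1
      chr-δ = chr-last δ

      at-δ : smaller δ ≡ 1 × equals δ ≡ 0 × arrives δ ≡ 1
      at-δ = trans (cong (indicator (_<? c)) chr-δ) (indicator-yes (_<? c) 1<c)
           , trans (cong (indicator (_≟ c)) chr-δ) (indicator-no (_≟ c) (<⇒≢ 1<c))
           , trans (cong (indicator (_⊏? suc δ)) (cong suc (origin-last δ))) (indicator-yes (_⊏? suc δ) (1⊏ (s≤s (s≤s z≤n)) δ<n))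

      take-pos : ∀ (us : List ℕ) w vs → take (suc (length us)) (us ++ w ∷ vs) ≡ us ++ [ w ]
      take-pos []       w vs = refl
      take-pos (z ∷ us) w vs = cong (z ∷_) (take-pos us w vs)

      lower-count : length (lower δ) ≡ ∑ arrives (rows δ)
      lower-count = trans (length-filter-∑ (_⊏? suc δ) (rows δ)) (trans (sym (∑-↭ (indicator (_⊏? suc δ)) (next-↭ δ≤n))) (∑-map (indicator (_⊏? suc δ)) (next δ) (rows δ)))

      smaller-count : length (filter (_<? c) (bwt T δ)) ≡ ∑ smaller (rows δ)
      smaller-count = trans (cong (λ xs → length (filter (_<? c) xs)) (bwt≡ (s≤s z≤n) δ≤n)) (trans (length-filter-∑ (_<? c) (map (chr δ) (rows δ))) (∑-map (indicator (_<? c)) (chr δ) (rows δ)))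

      taken : take (rep$ T δ) (bwt T δ) ≡ map (chr δ) (lower k ++ [ δ ])
      taken = begin
        take (rep$ T δ) (bwt T δ) ≡⟨ cong₂ take (trans rep$≡ (cong suc (sym (length-map (chr δ) (lower k)))))
                                                                                              (trans (bwt≡ (s≤s z≤n) δ≤n) (map-++ (chr δ) (lower k) (δ ∷ upper k))) ⟩
        take (suc (length (map (chr δ) (lower k)))) (map (chr δ) (lower k) ++ chr δ δ ∷ map (chr δ) (upper k)) ≡⟨ take-pos (map (chr δ) (lower k)) (chr δ δ) (map (chr δ) (upper k)) ⟩
        map (chr δ) (lower k) ++ [ chr δ δ ] ≡⟨ map-++ (chr δ) (lower k) [ δ ] ⟨
        map (chr δ) (lower k ++ [ δ ]) ∎
        where open ≡-Reasoning

      equals-count : length (filter (_≟ c) (take (rep$ T δ) (bwt T δ))) ≡ ∑ equals (lower k ++ [ δ ])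
      equals-count = trans (cong (λ xs → length (filter (_≟ c) xs)) taken)
        (trans (length-filter-∑ (_≟ c) (map (chr δ) (lower k ++ [ δ ]))) (∑-map (indicator (_≟ c)) (chr δ) (lower k ++ [ δ ])))

    -- The rows before the new row are counted by their preimages under LF. The image of a row `m`
    -- of `rows k` precedes the new row if `ch m < c`, or if `ch m ≡ c` and `m` precedes `δ`: these
    -- are the two counts in `ins`. Row `δ` contributes its image, row 1, through `$ < c`.
    ins≡ : ins T δ ≡ suc (length (lower δ))
    ins≡ = cong suc (begin
      length (filter (_<? nextChar T δ) (bwt T δ)) + length (filter (_≟ nextChar T δ) (take (rep$ T δ) (bwt T δ)))
        ≡⟨ cong (λ q → length (filter (_<? q) (bwt T δ)) + length (filter (_≟ q) (take (rep$ T δ) (bwt T δ)))) (ch-def δ) ⟨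
      length (filter (_<? c) (bwt T δ)) + length (filter (_≟ c) (take (rep$ T δ) (bwt T δ))) ≡⟨ cong₂ _+_ smaller-count equals-count ⟩
      ∑ smaller (rows δ) + ∑ equals (lower k ++ [ δ ]) ≡⟨ cong₂ _+_ (∑-++ smaller (lower k) (δ ∷ upper k)) (∑-++ equals (lower k) [ δ ]) ⟩
      ∑ smaller (lower k) + (smaller δ + ∑ smaller (upper k)) + (∑ equals (lower k) + (equals δ + 0))
        ≡⟨ cong₂ (λ p q → ∑ smaller (lower k) + (p + ∑ smaller (upper k)) + (∑ equals (lower k) + (q + 0))) (proj₁ at-δ) (proj₁ (proj₂ at-δ)) ⟩
      ∑ smaller (lower k) + (1 + ∑ smaller (upper k)) + (∑ equals (lower k) + 0) ≡⟨ rearrange (∑ smaller (lower k)) (∑ smaller (upper k)) (∑ equals (lower k)) ⟩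
      (∑ smaller (lower k) + ∑ equals (lower k)) + (1 + ∑ smaller (upper k)) ≡⟨ cong₂ (λ p q → p + (1 + q)) (trans (∑-+ smaller equals (lower k)) (∑-cong (lower k) on-lower)) (∑-cong (upper k) on-upper) ⟩
      ∑ arrives (lower k) + (1 + ∑ arrives (upper k)) ≡⟨ cong (λ p → ∑ arrives (lower k) + (p + ∑ arrives (upper k))) (proj₂ (proj₂ at-δ)) ⟨
      ∑ arrives (lower k) + (arrives δ + ∑ arrives (upper k)) ≡⟨ ∑-++ arrives (lower k) (δ ∷ upper k) ⟨
      ∑ arrives (rows δ) ≡⟨ lower-count ⟨
      length (lower δ) ∎)
      where
      open ≡-Reasoning
      rearrange : ∀ a b d → a + (1 + b) + (d + 0) ≡ (a + d) + (1 + b)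
      rearrange = solve-∀

    nextChar≡ : nextChar T δ ≡ c
    nextChar≡ = sym (ch-def δ)

    update≡ : ∀ D → update T δ D ≡ updated δ D
    update≡ D = cong₂ (λ q i → insert$ (i ∸ 1) (replace$ q D)) nextChar≡ ins≡

    updateSplits≡ : ∀ D → updateSplits T δ D ≡ splitting δ D
    updateSplits≡ D = cong₂ (λ q i → insert$Splits (i ∸ 1) (replace$ q D)) nextChar≡ ins≡

    fastMerge≡ : ∀ s D → fastMerge T δ s D ≡ merged k s D
    fastMerge≡ s D = trans (cong₂ (λ q D′ → if adjacentTo$ q D then mergeAt s (if rep$ T δ <ᵇ ins T δ then rep$ T δ ∸ 1 else rep$ T δ) D′ else D′)
                             nextChar≡ (update≡ D))
      (cong₂ (λ r i → if adjacentTo$ c D then mergeAt s (if r <ᵇ i then r ∸ 1 else r) (updated δ D) else updated δ D) rep$≡ ins≡)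

  -- Balancing

  pos-positions : ∀ {δ} A us vs → rows δ ≡ us ++ vs → positions A (suc (length us)) vs ≡ map (pos δ) (chosen A vs)
  pos-positions A us []       eq = refl
  pos-positions {δ} A us (x ∷ vs) eq
    with A x | pos-positions {δ} A (us ++ [ x ]) vs (trans eq (sym (++-assoc us [ x ] vs)))
  ... | true  | ih = cong₂ _∷_ (sym (pos-++ {δ} us eq)) (trans (cong (λ p → positions A (suc p) vs) len≡) ih)
    where
    len≡ : suc (length us) ≡ length (us ++ [ x ])
    len≡ = sym (trans (length-++ us) (+-comm (length us) 1))
  ... | false | ih = trans (cong (λ p → positions A (suc p) vs) (sym (trans (length-++ us) (+-comm (length us) 1)))) ih

  module Cutting {k : ℕ} (δ≤n : suc k ≤ n) {D : DBWT} {s : Bool} (state : State k D s) {tl : List ℕ} (rows-∷ : rows (suc k) ≡ 1 ∷ tl) where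

    open State state

    private
      δ : ℕ
      δ = suc k

      1≤δ : 1 ≤ δ
      1≤δ = s≤s z≤n

      -- `B` marks the rows with which F-intervals start: those whose preimage starts a repetition.
      A B : ℕ → Bool
      A = starts k V
      B m = A (prev δ m)

      D≡ : D ≡ toDBWT A (chr δ) (1 ∷ tl)
      D≡ = trans (Represents.D≡ represents) (cong (toDBWT A (chr δ)) rows-∷)

      coherent : Coherent A (chr δ) (chr δ 1) tl
      coherent = Represents.coherent represents rows-∷

      A1 : A 1 ≡ true
      A1 = by-k k refl
        where
        by-k : ∀ j → k ≡ j → A 1 ≡ true
        by-k zero    refl = ∪-true (V ∪ 1) (top 0) {1} (∪-same V 1)
        by-k (suc _) eqk  = ∪-true (V ∪ δ) (top k) {1} (∪-true V δ {1} (first (subst (1 ≤_) (sym eqk) (s≤s z≤n))))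

      starts≡ : map start (pieces D) ≡ positions A 1 (rows δ)
      starts≡ = trans (cong (map start) (trans (cong pieces D≡) (pieces≡ _)))
        (trans (starts-segments A (chr δ) (chr δ 1) 1 1 1 tl) (trans first-A (cong (positions A 1) (sym rows-∷))))
        where
        first-A : 1 ∷ positions A 2 tl ≡ positions A 1 (1 ∷ tl)
        first-A rewrite A1 = refl

      -- Only a permutation, since LF need not keep the order of the repetitions; the sorting inside
      -- `coveredByRep` makes up for this.
      F-starts↭ : map (F-start T δ) (pieces D) ↭ positions B 1 (rows δ)
      F-starts↭ = ↭-trans (↭-reflexive (begin
          map (F-start T δ) (pieces D) ≡⟨ map-∘ (pieces D) ⟩
          map (LF T δ) (map start (pieces D)) ≡⟨ cong (map (LF T δ)) (trans starts≡ (pos-positions {δ} A [] (rows δ) refl)) ⟩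
          map (LF T δ) (map (pos δ) (chosen A (rows δ))) ≡⟨ map-∘ (chosen A (rows δ)) ⟨
          map (LF T δ ∘ pos δ) (chosen A (rows δ)) ≡⟨ map-cong-local (All.tabulate λ m∈ → LF≡ 1≤δ δ≤n (chosen-⊆ A (rows δ) m∈)) ⟩
          map (pos δ ∘ next δ) (chosen A (rows δ)) ≡⟨ map-∘ (chosen A (rows δ)) ⟩
          map (pos δ) (map (next δ) (chosen A (rows δ))) ≡⟨ cong (map (pos δ)) (chosen-map {A} {B} (next δ) (rows δ) (λ m∈ → cong A (prev-next m∈))) ⟨
          map (pos δ) (chosen B (map (next δ) (rows δ))) ∎))
        (↭-trans (map⁺ (pos δ) (chosen-↭ B (next-↭ δ≤n))) (↭-reflexive (sym (pos-positions {δ} B [] (rows δ) refl))))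
        where
        open ≡-Reasoning
        prev-next : ∀ {m} → m ∈ rows δ → prev δ (next δ m) ≡ m
        prev-next {m} m∈ with m ≟ δ
        ... | yes refl rewrite origin-last m = refl
        ... | no m≢δ rewrite origin-other m≢δ = by-m m (proj₁ (rows-bounds δ m∈))
          where
          by-m : ∀ m → 1 ≤ m → prev δ (suc m) ≡ m
          by-m (suc m) _ = refl

    block-at : ∀ {P} → P ∈ pieces D → IsBlock A (chr δ) (1 ∷ tl) P
    block-at {P} P∈ = is-block coherent (AllPairs.tail (subst Unique rows-∷ (rows-unique δ))) (subst (λ D → P ∈ pieces D) D≡ P∈)

    module Block {P : Piece} (block : IsBlock A (chr δ) (1 ∷ tl) P) where

      open IsBlock block renaming (first to f; front to us; after to vs; list≡ to block≡)

      rows≡ : rows δ ≡ us ++ f ∷ inside ++ vs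
      rows≡ = trans rows-∷ block≡

      seg : List ℕ
      seg = f ∷ inside

      covered-rep : coveredByRep T δ D P ≡ positions B (suc (length us)) seg
      covered-rep = Pointwise.Pointwise-≡⇒≡ (↗↭↗⇒≋ ≤-totalOrder (sortNumbers-↗ _) (positions-sorted B _ seg)
        (↭⇒↭ₛ (↭-trans (sortNumbers-↭ _) (↭-trans (↭-reflexive (map-filter-∘ (repCovers? T δ P) R? (F-start T δ) (λ {Q} → to {Q}) (λ {Q} → from {Q}) (pieces D)))
          (↭-trans (filter-↭ R? F-starts↭) (↭-reflexive (trans (cong (λ zs → filter R? (positions B 1 zs)) rows≡) (positions-range B us seg vs))))))))
        where
        R? : ∀ v → Dec (InRange (suc (length us)) (length us + length seg) v)
        R? = inRange? (suc (length us)) (length us + length seg)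
        to : ∀ {Q} → RepCovers T δ P Q → InRange (suc (length us)) (length us + length seg) (F-start T δ Q)
        to {Q} (p , q) = subst (_≤ F-start T δ Q) start≡ p , subst (F-start T δ Q ≤_) end≡ q
        from : ∀ {Q} → InRange (suc (length us)) (length us + length seg) (F-start T δ Q) → RepCovers T δ P Q
        from {Q} (p , q) = subst (_≤ F-start T δ Q) (sym start≡) p , subst (F-start T δ Q ≤_) (sym end≡) q

      same-chars : All (λ x → chr δ x ≡ chr δ f) inside
      same-chars = block-chars us coherent block≡ inner

      seg′ : List ℕ
      seg′ = map (next δ) seg

      row-∈ : ∀ {z} → z ∈ seg → z ∈ rows δ
      row-∈ {z} z∈ = subst (z ∈_) (sym rows≡) (∈-++⁺ʳ us (∈-++⁺ˡ z∈))

      apply-cut : ∀ ms e ns → inside ≡ ms ++ e ∷ ns → ∀ {ℓ} → ℓ ≡ suc (length ms) → Ψ k (V ∪ e) ≤ Ψ k V → State k (cut (index P) ℓ D) s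
      apply-cut ms e ns eq refl bd = cut-state δ≤n state
        (row-∈ (there (subst (e ∈_) (sym eq) (∈-++⁺ʳ ms (here refl)))))
        (All.lookup inner (subst (e ∈_) (sym eq) (∈-++⁺ʳ ms (here refl))))
        (trans (cong (cut (index P) (suc (length ms))) D≡) (trans (cut≡ ms e ns eq) (cong (toDBWT (A ∪ e) (chr δ)) (sym rows-∷))))
        bd

      inner′ : ∀ {ms e ns} → inside ≡ ms ++ e ∷ ns → All (λ x → A x ≡ false) (ms ++ e ∷ ns)
      inner′ eq = subst (All (λ x → A x ≡ false)) eq inner

      rows-cut : ∀ {ms e ns} → inside ≡ ms ++ e ∷ ns → rows δ ≡ us ++ f ∷ ms ++ e ∷ ns ++ vs
      rows-cut {ms} {e} {ns} eq = trans rows≡ (cong (λ zs → us ++ f ∷ zs) (trans (cong (_++ vs) eq) (++-assoc ms (e ∷ ns) vs)))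

      interval : ∃[ us′ ] ∃[ vs′ ] rows δ ≡ us′ ++ seg′ ++ vs′
      interval = next-block δ≤n us f inside vs rows≡ same-chars

      module _ {α : ℕ} (16≤α : 16 ≤ α) where

        cut-repetition : HeavyRep T δ D α P → ∀ {ℓ} → ℓ ≡ at 0 (coveredByRep T δ D P) (⌈ length (coveredByRep T δ D P) /2⌉ + 1) ∸ start P →
                         State k (cut (index P) ℓ D) s
        cut-repetition heavy {ℓ} ℓ≡ = from-middle (at-middle {B} (suc (length us)) seg covered-rep (≤-trans 16≤α heavy))
          where
          from-middle : Middle B (suc (length us)) seg (coveredByRep T δ D P) → State k (cut (index P) ℓ D) s
          -- The part before the cut covers 8 starts, so it has rows and the cut falls inside the
          -- piece.
          from-middle ([] , _ , _ , _ , _ , () , _)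
          from-middle (g ∷ ms , e , ns , eq , mid≡ , left , right) = apply-cut ms e ns (proj₂ (∷-injective eq))
            (trans ℓ≡ (trans (cong₂ _∸_ mid≡ start≡) (m+n∸m≡n (suc (length us)) (suc (length ms)))))
            (Ψ-cut-heavy-repetition δ≤n state (rows-cut (proj₂ (∷-injective eq))) (inner′ (proj₂ (∷-injective eq)))
              (subst (λ z → 8 ≤ ∑ (bit ∘ B) (z ∷ ms)) (sym (proj₁ (∷-injective eq))) left) right)

      module Interval {us′ vs′ : List ℕ} (rows≡′ : rows δ ≡ us′ ++ seg′ ++ vs′) where

        private
          F-start≡ : F-start T δ P ≡ suc (length us′)
          F-start≡ = trans (cong (LF T δ) (trans start≡ (sym (pos-++ {δ} us rows≡)))) (trans (LF≡ 1≤δ δ≤n (row-∈ (here refl))) (pos-++ {δ} us′ rows≡′))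

          F-end≡ : F-end T δ P ≡ length us′ + length seg′
          F-end≡ with last-exists id f inside
          ... | ws , l , eq , _ = begin
              LF T δ (end P) ≡⟨ cong (LF T δ) (trans end≡ (sym pos-l)) ⟩
              LF T δ (pos δ l) ≡⟨ LF≡ 1≤δ δ≤n (row-∈ (subst (l ∈_) (sym eq) (∈-++⁺ʳ ws (here refl)))) ⟩
              pos δ (next δ l) ≡⟨ pos-++ {δ} (us′ ++ map (next δ) ws) (trans rows≡′ (trans (cong (λ zs → us′ ++ map (next δ) zs ++ vs′) eq)
                                                (trans (cong (us′ ++_) (trans (cong (_++ vs′) (map-++ (next δ) ws [ l ])) (++-assoc (map (next δ) ws) [ next δ l ] vs′))) (sym (++-assoc us′ (map (next δ) ws) (next δ l ∷ vs′)))))) ⟩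
              suc (length (us′ ++ map (next δ) ws)) ≡⟨ cong suc (trans (length-++ us′) (cong (length us′ +_) (length-map (next δ) ws))) ⟩
              suc (length us′ + length ws) ≡⟨ +-suc (length us′) (length ws) ⟨
              length us′ + suc (length ws) ≡⟨ cong (length us′ +_) (trans (sym len-ws) (sym (length-map (next δ) seg))) ⟩
              length us′ + length seg′ ∎
            where
            open ≡-Reasoning
            len-ws : length seg ≡ suc (length ws)
            len-ws = trans (cong length eq) (trans (length-++ ws) (+-comm (length ws) 1))
            pos-l : pos δ l ≡ length us + suc (length inside)
            pos-l = trans (pos-++ {δ} (us ++ ws) (trans rows≡ (trans (cong (λ zs → us ++ zs ++ vs) eq) (trans (cong (us ++_) (++-assoc ws [ l ] vs)) (sym (++-assoc us ws (l ∷ vs)))))))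
                      (trans (cong suc (length-++ us)) (trans (sym (+-suc (length us) (length ws))) (cong (length us +_) (sym len-ws))))

          covered-F : coveredByF T δ D P ≡ positions A (suc (length us′)) seg′
          covered-F = trans (map-filter-∘ (F-covers? T δ P) R? start (λ {Q} → to {Q}) (λ {Q} → from {Q}) (pieces D))
            (trans (cong (filter R?) (trans starts≡ (cong (positions A 1) rows≡′))) (positions-range A us′ seg′ vs′))
            where
            R? : ∀ v → Dec (InRange (suc (length us′)) (length us′ + length seg′) v)
            R? = inRange? (suc (length us′)) (length us′ + length seg′)
            to : ∀ {Q} → F-Covers T δ P Q → InRange (suc (length us′)) (length us′ + length seg′) (start Q)
            to {Q} (p , q) = subst (_≤ start Q) F-start≡ p , subst (start Q ≤_) F-end≡ q
            from : ∀ {Q} → InRange (suc (length us′)) (length us′ + length seg′) (start Q) → F-Covers T δ P Q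
            from {Q} (p , q) = subst (_≤ start Q) (sym F-start≡) p , subst (start Q ≤_) (sym F-end≡) q

        module _ {α : ℕ} (16≤α : 16 ≤ α) where

          cut-interval : HeavyF T δ D α P → ∀ {ℓ} → ℓ ≡ at 0 (coveredByF T δ D P) (⌈ length (coveredByF T δ D P) /2⌉ + 1) ∸ F-start T δ P →
                         State k (cut (index P) ℓ D) s
          cut-interval heavy {ℓ} ℓ≡ = from-middle (at-middle {A} (suc (length us′)) seg′ covered-F (≤-trans 16≤α heavy))
            where
            from-middle : Middle A (suc (length us′)) seg′ (coveredByF T δ D P) → State k (cut (index P) ℓ D) s
            from-middle (g₁ , z , g₂ , eq , mid≡ , left , right) = from-split (map-++⁻ (next δ) seg eq)
              where
              from-split : ∃[ h₁ ] ∃[ e ] ∃[ ns ] (seg ≡ h₁ ++ e ∷ ns × g₁ ≡ map (next δ) h₁ × z ≡ next δ e × g₂ ≡ map (next δ) ns) →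
                           State k (cut (index P) ℓ D) s
              from-split ([] , _ , _ , _ , refl , _ , _) = contradiction left λ ()
              from-split (g ∷ ms , e , ns , eq′ , refl , refl , refl) = apply-cut ms e ns inside≡
                (trans ℓ≡ (trans (cong₂ _∸_ mid≡ F-start≡) (trans (m+n∸m≡n (suc (length us′)) (suc (length (map (next δ) ms)))) (cong suc (length-map (next δ) ms)))))
                (Ψ-cut-heavy-interval δ≤n state (rows-cut inside≡) (inner′ inside≡)
                  (trans rows≡′ (cong (us′ ++_) (trans (cong (λ zs → map (next δ) (f ∷ zs) ++ vs′) inside≡)
                    (trans (cong (_++ vs′) (map-++ (next δ) (f ∷ ms) (e ∷ ns))) (++-assoc (map (next δ) (f ∷ ms)) (next δ e ∷ map (next δ) ns) vs′)))))
                  (subst (λ z → 8 ≤ ∑ (bit ∘ A) (next δ z ∷ map (next δ) ms)) (sym (proj₁ (∷-injective eq′))) left) right)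
                where
                inside≡ : inside ≡ ms ++ e ∷ ns
                inside≡ = proj₂ (∷-injective eq′)

  if-elim : ∀ {x y : ℕ} (P : ℕ → Set) b → (IsTrue b → P x) → (¬ IsTrue b → P y) → P (if b then x else y)
  if-elim P true  f g = f _
  if-elim P false f g = g id

  balance-step : ∀ {α k D s P} → 16 ≤ α → suc k ≤ n → State k D s → P ∈ pieces D →
                 HeavyRep T (suc k) D α P ⊎ HeavyF T (suc k) D α P → State k (cut (index P) (cutLength T (suc k) D α P) D) s
  balance-step {α} {k} {D} {s} {P} 16≤α δ≤n state P∈ heavy = with-rows (rows-head (s≤s z≤n) δ≤n)
    where
    with-rows : ∃[ tl ] rows (suc k) ≡ 1 ∷ tl → State k (cut (index P) (cutLength T (suc k) D α P) D) s
    with-rows (tl , rows-∷) = with-block (block-at P∈)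
      where
      open Cutting δ≤n state rows-∷
      with-block : IsBlock (starts k (State.V state)) (chr (suc k)) (1 ∷ tl) P → State k (cut (index P) (cutLength T (suc k) D α P) D) s
      with-block block = with-interval interval
        where
        open Block block
        with-interval : ∃[ us′ ] ∃[ vs′ ] rows (suc k) ≡ us′ ++ seg′ ++ vs′ → State k (cut (index P) (cutLength T (suc k) D α P) D) s
        -- `cutLength` prefers the cut for a heavy repetition; if the repetition is not heavy, the
        -- F-interval must be.
        with-interval (us′ , vs′ , rows≡′) = if-elim (λ ℓ → State k (cut (index P) ℓ D) s) (α ≤ᵇ length (coveredByRep T (suc k) D P))
          (λ t → cut-repetition 16≤α (≤ᵇ⇒≤ α _ t) refl) (λ ¬t → Interval.cut-interval rows≡′ 16≤α (heavy-F ¬t heavy) refl)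
          where
          heavy-F : ¬ IsTrue (α ≤ᵇ length (coveredByRep T (suc k) D P)) →
                    HeavyRep T (suc k) D α P ⊎ HeavyF T (suc k) D α P → HeavyF T (suc k) D α P
          heavy-F ¬t (inj₁ h) = contradiction (≤⇒≤ᵇ h) ¬t
          heavy-F ¬t (inj₂ h) = h

  -- The number of repetitions

  runs-mono : ∀ {j k} → j ≤ k → k ≤ n → runCount (map ch (rows j)) ≤ runCount (map ch (rows k))
  runs-mono {j} {k} j≤k k≤n with m≤n⇒m<n∨m≡n j≤k
  ... | inj₂ refl = ≤-refl
  runs-mono {j} {suc k} j≤k k<n | inj₁ j<k = ≤-trans (runs-mono (s≤s⁻¹ j<k) (<⇒≤ k<n)) (step₁ k k<n)
    where
    step₁ : ∀ k → k < n → runCount (map ch (rows k)) ≤ runCount (map ch (rows (suc k)))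
    step₁ zero    _   = z≤n
    step₁ (suc k) k<n with lower-head {suc k} (s≤s z≤n) k<n
    ... | l , low = subst₂ (λ p q → runCount p ≤ runCount q)
          (sym (trans (cong (map ch) (trans (rows-split (suc k)) (cong (_++ upper (suc k)) low))) (cong (ch 1 ∷_) (map-++ ch l (upper (suc k))))))
          (sym (trans (cong (λ zs → map ch (zs ++ suc (suc k) ∷ upper (suc k))) low) (cong (ch 1 ∷_) (map-++ ch l (suc (suc k) ∷ upper (suc k))))))
          (runCount-insert (ch 1) (map ch l) (ch (suc (suc k))) (map ch (upper (suc k))))

  runs≡ : runs T ≡ runCount (map ch (rows n))
  runs≡ = cong runCount (trans (bwt≡ (≤-trans (s≤s z≤n) 2≤n) ≤-refl) (map-cong-local (All.tabulate λ {m} _ → same m)))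
    where
    same : ∀ m → chr n m ≡ ch m
    same m with m ≟ n
    ... | no m≢n = chr-other m≢n
    -- In `L_n` row `n` has the character `$`, and so does `ch n`, as the default at position 0 of
    -- the text. Thus the run count of the invariant becomes that of the full BWT at `n`.
    ... | yes refl = trans (chr-last m) (sym (trans (ch-def m) (cong (at $ str) (n∸n≡0 m))))

  -- What holds in every phase. No `State` is maintained while equal neighbours are joined, but
  -- these facts survive a join and suffice for the space. In `few`, 4 allows for the rows of the
  -- old and the new `$` and the rows after them, 1 for the first repetition, which `segments` opens
  -- without consulting a mark.
  record Facts (δ : ℕ) (D : DBWT) : Set where
    field
      1≤δ      : 1 ≤ δ
      δ≤n      : δ ≤ n
      expands  : expand D ≡ map (chr δ) (rows δ)
      positive : All (λ R → 1 ≤ len R) D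
      few      : length D ≤ 5 + 10 * runs T

  represents-facts : ∀ {A δ D} → 1 ≤ δ → δ ≤ n → Represents A δ D → ∑ (bit ∘ A) (rows δ) ≤ 4 + 10 * runs T → Facts δ D
  represents-facts {A} {δ} {D} 1≤δ δ≤n rep few = with-rows (rows-head 1≤δ δ≤n)
    where
    open Represents rep
    with-rows : ∃[ tl ] rows δ ≡ 1 ∷ tl → Facts δ D
    with-rows (tl , eq) = record
      { 1≤δ = 1≤δ ; δ≤n = δ≤n
      ; expands = trans (cong expand D≡′) (trans (expand-segments A (chr δ) (chr δ 1) 1 (coherent eq)) (sym (cong (map (chr δ)) eq)))
      ; positive = subst (All (λ R → 1 ≤ len R)) (sym D≡′) (positive-segments A (chr δ) (chr δ 1) 1 tl ≤-refl)
      ; few = ≤-trans (≤-reflexive (trans (cong length D≡′) (length-segments A (chr δ) (chr δ 1) 1 tl)))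
                (s≤s (≤-trans (m≤n+m _ (bit (A 1))) (≤-trans (≤-reflexive (sym (cong (∑ (bit ∘ A)) eq))) few))) }
      where
      D≡′ : D ≡ segments A (chr δ) (chr δ 1) 1 tl
      D≡′ = trans D≡ (cong (toDBWT A (chr δ)) eq)

  ∑-∪ : ∀ A e {xs} → Unique xs → ∑ (bit ∘ (A ∪ e)) xs ≤ suc (∑ (bit ∘ A) xs)
  ∑-∪ A e un = ∑-raise un (λ _ z≢e → ≤-reflexive (cong bit (∪-other A z≢e))) (≤-trans (bit≤1 ((A ∪ e) e)) (s≤s z≤n))

  ∑-starts : ∀ k V {xs} → Unique xs → ∑ (bit ∘ starts k V) xs ≤ 2 + ∑ (weight V) xs
  ∑-starts k V un = ≤-trans (∑-∪ (V ∪ suc k) (top k) un) (s≤s (∑-∪ V (suc k) un))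

  state-few : ∀ {k D s} → suc k ≤ n → (state : State k D s) → ∑ (weight (State.V state)) (rows (suc k)) ≤ 10 * runs T
  state-few {k} k<n state = ≤-trans (m≤n+m _ _) (≤-trans (State.bound state)
    (*-monoʳ-≤ 10 (≤-trans (runs-mono (<⇒≤ k<n) ≤-refl) (≤-reflexive (sym runs≡)))))

  state-facts : ∀ {k D s} → suc k ≤ n → State k D s → Facts (suc k) D
  state-facts {k} k<n state = represents-facts (s≤s z≤n) k<n (State.represents state)
    (≤-trans (∑-starts k (State.V state) (rows-unique (suc k))) (+-mono-≤ {2} {4} (m≤m+n 2 2) (state-few k<n state)))

  inserted-facts : ∀ {k D s} → suc k < n → State k D s → Facts (suc (suc k)) (updated (suc k) D)
  inserted-facts {k} δ<n state = represents-facts (s≤s z≤n) δ<n (updated-represents δ<n (State.represents state))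
    (≤-trans (∑-∪ (starts k V ∪ suc (suc k)) (top (suc k)) un) (s≤s (≤-trans (∑-∪ (starts k V) (suc (suc k)) un) (s≤s
      (≤-trans (∑-starts k V un) (s≤s (s≤s (≤-trans (≤-reflexive (∑-new k (cong bit (invalid-above (State.valid state) (m≤n⇒m≤1+n ≤-refl)))))
        (state-few (<⇒≤ δ<n) state)))))))))
    where
    V : ℕ → Bool
    V = State.V state
    un : Unique (rows (suc (suc k)))
    un = rows-unique (suc (suc k))

  initial-state : State 0 (($ ^^ 1) ∷ []) false
  initial-state = record
    { V = λ _ → false
    ; valid = λ _ ()
    ; represents = record { D≡ = cong (λ c → (c ^^ 1) ∷ []) (sym ch-zero) ; coherent = λ { refl → [] } }
    ; first = λ ()
    ; flag = whole λ ()
    ; bound = z≤n }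

  module _ {α : ℕ} (16≤α : 16 ≤ α) where

    -- Phase `inserted` has no successor: it shows the DBWT between insertion and merge, and `merge`
    -- performs both. So the invariant is needed in phase `balancing` only.
    reached-state : ∀ {δ D s} → Reached α T balancing δ D s → ∃[ k ] (δ ≡ suc k × suc k ≤ n × State k D s)
    reached-state initial = 0 , refl , ≤-trans (s≤s z≤n) 2≤n , initial-state
    reached-state (merge {δ} {D} {s} δ<n R _) with reached-state R
    ... | k , refl , _ , state = suc k , refl , δ<n , subst₂ (State (suc k)) (sym (fastMerge≡ δ<n s D)) (sym (updateSplits≡ δ<n D)) (step δ<n state)
    reached-state (balance R P∈ heavy) with reached-state R
    ... | k , refl , δ≤n , state = k , refl , δ≤n , balance-step 16≤α δ≤n state P∈ heavy

    reached-facts : ∀ {φ δ D s} → Reached α T φ δ D s → Facts δ D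
    reached-facts initial = state-facts (≤-trans (s≤s z≤n) 2≤n) initial-state
    reached-facts (insert {δ} {D} {s} δ<n R _) with reached-state R
    ... | k , refl , _ , state = subst (Facts (suc (suc k))) (sym (update≡ δ<n D)) (inserted-facts δ<n state)
    reached-facts R@(merge _ _ _) with reached-state R
    ... | k , refl , δ≤n , state = state-facts δ≤n state
    reached-facts R@(balance _ _ _) with reached-state R
    ... | k , refl , δ≤n , state = state-facts δ≤n state
    reached-facts (finish R _) = reached-facts R
    reached-facts (join {D} {Q} {R} {E} R′ e) = record
      { 1≤δ = 1≤δ ; δ≤n = δ≤n ; expands = trans (sym (expand-join D E e)) expands
      ; positive = All.++⁺ (All.++⁻ˡ D positive) (positive-join (All.++⁻ʳ D positive))
      ; few = ≤-trans (≤-trans (≤-reflexive (length-++ D)) (≤-trans (+-monoʳ-≤ (length D) (n≤1+n _)) (≤-reflexive (sym (length-++ D))))) few }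
      where
      open Facts (reached-facts R′)
      positive-join : All (λ R → 1 ≤ len R) (Q ∷ R ∷ E) → All (λ R → 1 ≤ len R) ((Q ⊕ R) ∷ E)
      positive-join (p ∷ _ ∷ ps) = ≤-trans p (m≤m+n _ _) ∷ ps

  -- The number of edges

  module _ {δ : ℕ} (1≤δ : 1 ≤ δ) (δ≤n : δ ≤ n) where

    pos-mono : ∀ {l m} → l ∈ rows δ → m ∈ rows δ → l ⊏ m → pos δ l < pos δ m
    pos-mono {l} {m} l∈ m∈ l⊏m with ∈-∃++ l∈
    ... | us , vs , eq with ∈-++⁻ us (subst (m ∈_) eq m∈)
    ...   | inj₁ m∈us = contradiction l⊏m (⊏-asym (AllPairs-across us (subst Sorted eq (rows-sorted δ)) m∈us (here refl)))
    ...   | inj₂ (here refl) = contradiction l⊏m ⊏-irrefl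
    ...   | inj₂ (there m∈vs) with ∈-∃++ m∈vs
    ...     | ws , zs , refl = subst₂ _<_ (sym (pos-++ {δ} us eq)) (sym (pos-++ {δ} (us ++ l ∷ ws) (trans eq (sym (++-assoc us (l ∷ ws) (m ∷ zs))))))
                (s≤s (≤-trans (≤-reflexive (+-comm 1 (length us))) (≤-trans (+-monoʳ-≤ (length us) (s≤s z≤n)) (≤-reflexive (sym (length-++ us))))))

    pos-reflects : ∀ {l m} → pos δ l ≤ pos δ m → l ∈ rows δ → m ∈ rows δ → ¬ (m ⊏ l)
    pos-reflects p l∈ m∈ m⊏l = <⇒≱ (pos-mono m∈ l∈ m⊏l) p

    pos-≤ : ∀ {l m} → l ∈ rows δ → m ∈ rows δ → ¬ (m ⊏ l) → pos δ l ≤ pos δ m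
    pos-≤ {l} {m} l∈ m∈ ¬m⊏l with ⊏-cmp l m
    ... | tri< p _ _    = <⇒≤ (pos-mono l∈ m∈ p)
    ... | tri≈ _ refl _ = ≤-refl
    ... | tri> _ _ p    = contradiction p ¬m⊏l

    length-rows : length (rows δ) ≡ δ
    length-rows = count δ
      where
      count : ∀ δ → length (rows δ) ≡ δ
      count zero    = refl
      count (suc δ) = trans (length-++ (lower δ)) (trans (+-suc _ _) (cong suc (trans (sym (length-++ (lower δ))) (trans (cong length (sym (rows-split δ))) (count δ)))))

    pos-bound : ∀ {m} → m ∈ rows δ → pos δ m ≤ δ
    pos-bound {m} m∈ with ∈-∃++ m∈
    ... | us , vs , eq = ≤-trans (≤-reflexive (pos-++ {δ} us eq)) (≤-trans (≤-trans (≤-reflexive (+-comm 1 (length us))) (+-monoʳ-≤ (length us) (s≤s z≤n)))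
                           (≤-reflexive (trans (sym (length-++ us)) (trans (cong length (sym eq)) length-rows))))

    -- LF reflects the order on the rows with one character, so the F-intervals
    -- are as disjoint as the repetitions.
    next-between : ∀ {f w l} → f ∈ rows δ → w ∈ rows δ → l ∈ rows δ → chr δ f ≡ chr δ l →
                   ¬ (next δ w ⊏ next δ f) → ¬ (next δ l ⊏ next δ w) → ¬ (w ⊏ f) × ¬ (l ⊏ w)
    next-between {f} {w} {l} f∈ w∈ l∈ e p q = (λ r → p (next-mono δ≤n w∈ f∈ wf r)) , (λ r → q (next-mono δ≤n l∈ w∈ (trans (sym e) (sym wf)) r))
      where
      wf : chr δ w ≡ chr δ f
      wf = ≤-antisym (≤-trans (≮⇒≥ (λ r → q (char< r))) (≤-reflexive (sym e))) (≮⇒≥ (λ r → p (char< r)))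

    module _ {D : DBWT} (expands : expand D ≡ map (chr δ) (rows δ)) (positive : All (λ R → 1 ≤ len R) D) where

      -- The first and last rows of a piece are recovered from the expanded string and not from
      -- marks, so that the edges can also be counted in the finishing phase.
      record Located (P : Piece) : Set where
        field
          first last : ℕ
          first∈  : first ∈ rows δ
          last∈   : last ∈ rows δ
          start≡  : start P ≡ pos δ first
          end≡    : end P ≡ pos δ last
          chars   : chr δ first ≡ chr δ last
          ofChar  : char (rep P) ≡ chr δ first
          len≤    : len (rep P) ≤ δ

      located : ∀ {P} → P ∈ pieces D → Located P
      located {P} P∈ with piece-in-expand 1 1 D (∈-pieces {D} P∈)
      ... | us , vs , eq , start≡ , R∈ = by-len (len (rep P)) refl (All.lookup positive R∈)
        where
        c : Char
        c = char (rep P)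
        by-len : ∀ k → len (rep P) ≡ k → 1 ≤ k → Located P
        by-len (suc k) lenk _ with map-split (chr δ) (rows δ) us {c} {replicate k c ++ vs} (trans (sym expands) (trans eq (cong (λ j → us ++ replicate j c ++ vs) lenk)))
                                 | map-split (chr δ) (rows δ) (us ++ replicate k c) {c} {vs}
                                     (trans (sym expands) (trans eq (trans (cong (λ j → us ++ replicate j c ++ vs) lenk)
                                       (trans (cong (us ++_) (replicate-suc-∷ʳ k c vs)) (sym (++-assoc us (replicate k c) (c ∷ vs)))))))
        ... | ws , f , zs , eqf , lf , cf | ws′ , l , zs′ , eql , ll , cl = record
          { first = f ; last = l
          ; first∈ = subst (f ∈_) (sym eqf) (∈-++⁺ʳ ws (here refl))
          ; last∈ = subst (l ∈_) (sym eql) (∈-++⁺ʳ ws′ (here refl))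
          ; start≡ = trans start≡ (sym (trans (pos-++ {δ} ws eqf) (cong suc lf)))
          ; end≡ = trans (cong₂ (λ p j → p + j ∸ 1) start≡ lenk) (trans (+-suc (length us) k) (sym (trans (pos-++ {δ} ws′ eql)
                     (cong suc (trans ll (trans (length-++ us) (cong (length us +_) (length-replicate k))))))))
          ; chars = trans cf (sym cl)
          ; ofChar = sym cf
          ; len≤ = begin
              len (rep P) ≡⟨ length-replicate (len (rep P)) ⟨
              length (replicate (len (rep P)) c) ≤⟨ m≤m+n _ (length vs) ⟩
              length (replicate (len (rep P)) c) + length vs ≡⟨ length-++ (replicate (len (rep P)) c) ⟨
              length (replicate (len (rep P)) c ++ vs) ≤⟨ m≤n+m _ (length us) ⟩
              length us + length (replicate (len (rep P)) c ++ vs) ≡⟨ length-++ us ⟨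
              length (us ++ replicate (len (rep P)) c ++ vs) ≡⟨ cong length eq ⟨
              length (expand D) ≡⟨ trans (cong length expands) (trans (length-map (chr δ) (rows δ)) length-rows) ⟩
              δ ∎ }
          where open ≤-Reasoning

      spans≤1 : ∀ q → length (filter (spans? q) (pieces D)) ≤ 1
      spans≤1 q = subst (λ Ps → length (filter (spans? q) Ps) ≤ 1) (sym (pieces≡ D)) (spans-once 1 1 D positive)

      rep-edges : sum (map (λ P → length (filter (repCovers? T δ P) (pieces D))) (pieces D)) ≤ length (pieces D)
      rep-edges = double-count (repCovers? T δ) (pieces D) (pieces D)
        (λ {Q} _ → ≤-trans (filter-length-mono (λ P → repCovers? T δ P Q) (spans? (F-start T δ Q)) (pieces D) (λ _ s → s)) (spans≤1 (F-start T δ Q)))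

      -- If the F-interval of `Q` covers the row `first`, then the preimage `w` of this row is in
      -- `Q`; as repetitions are disjoint, `Q` is determined.
      F-edges : sum (map (λ Q → length (filter (F-covers? T δ Q) (pieces D))) (pieces D)) ≤ length (pieces D)
      F-edges = double-count (F-covers? T δ) (pieces D) (pieces D) (λ {P} P∈ → one P (located P∈))
        where
        one : ∀ P → Located P → length (filter (λ Q → F-covers? T δ Q P) (pieces D)) ≤ 1
        one P LP = through (next-surjective δ≤n first∈)
          where
          open Located LP
          through : ∃[ w ] (w ∈ rows δ × next δ w ≡ first) → length (filter (λ Q → F-covers? T δ Q P) (pieces D)) ≤ 1
          through (w , w∈ , nw≡) = ≤-trans (filter-length-mono (λ Q → F-covers? T δ Q P) (spans? (pos δ w)) (pieces D) (λ {Q} Q∈ → covers Q (located Q∈)))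
                                     (spans≤1 (pos δ w))
            where
            covers : ∀ Q → Located Q → F-Covers T δ Q P → Spans (pos δ w) Q
            covers Q LQ (p , q) = subst (_≤ pos δ w) (sym LQ.start≡) (pos-≤ LQ.first∈ w∈ (proj₁ between))
                                , subst (pos δ w ≤_) (sym LQ.end≡) (pos-≤ w∈ LQ.last∈ (proj₂ between))
              where
              module LQ = Located LQ
              start-w : start P ≡ pos δ (next δ w)
              start-w = trans start≡ (cong (pos δ) (sym nw≡))
              p′ : pos δ (next δ LQ.first) ≤ pos δ (next δ w)
              p′ = subst₂ _≤_ (trans (cong (LF T δ) LQ.start≡) (LF≡ 1≤δ δ≤n LQ.first∈)) start-w p
              q′ : pos δ (next δ w) ≤ pos δ (next δ LQ.last)
              q′ = subst₂ _≤_ start-w (trans (cong (LF T δ) LQ.end≡) (LF≡ 1≤δ δ≤n LQ.last∈)) q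
              between : ¬ (w ⊏ LQ.first) × ¬ (LQ.last ⊏ w)
              between = next-between LQ.first∈ w∈ LQ.last∈ LQ.chars
                (pos-reflects p′ (next-∈ δ≤n LQ.first∈) (next-∈ δ≤n w∈)) (pos-reflects q′ (next-∈ δ≤n w∈) (next-∈ δ≤n LQ.last∈))

      start-≤ : ∀ {P} → P ∈ pieces D → start P ≤ δ
      start-≤ P∈ = let open Located (located P∈) in ≤-trans (≤-reflexive start≡) (pos-bound first∈)

      F-start-≤ : ∀ {P} → P ∈ pieces D → F-start T δ P ≤ δ
      F-start-≤ P∈ = let open Located (located P∈) in
        ≤-trans (≤-reflexive (trans (cong (LF T δ) start≡) (LF≡ 1≤δ δ≤n first∈))) (pos-bound (next-∈ δ≤n first∈))

      char-≤ : ∀ {P} → P ∈ pieces D → char (rep P) ≤ n ^ d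
      char-≤ P∈ = let open Located (located P∈) in ≤-trans (≤-reflexive ofChar) (ch-bound (origin δ first))

-- Words and bits

sum-mono : ∀ {A : Set} {f g : A → ℕ} {xs} → All (λ x → f x ≤ g x) xs → sum (map f xs) ≤ sum (map g xs)
sum-mono []       = z≤n
sum-mono (p ∷ ps) = +-mono-≤ p (sum-mono ps)

sum-*ʳ : ∀ {A : Set} (f : A → ℕ) c xs → sum (map (λ x → f x * c) xs) ≡ sum (map f xs) * c
sum-*ʳ f c []       = refl
sum-*ʳ f c (x ∷ xs) = trans (cong (f x * c +_) (sum-*ʳ f c xs)) (sym (*-distribʳ-+ c (f x) (sum (map f xs))))

slots : Constants → ℕ
slots K = (2 * minDegree K ∸ 1) * 3 + 2 * minDegree K + 2

module SpaceBound (K : Constants) {n : ℕ} (w : ℕ) .{{_ : NonZero w}} (2≤n : 2 ≤ n) (T : Text n) (input : IsInput (numberExp K) n T) where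

  private
    d : ℕ
    d = numberExp K

    1≤n : 1 ≤ n
    1≤n = ≤-trans (s≤s z≤n) 2≤n

    -- With the exponent `suc d`, the `X` words also hold lengths and labels up to `n`, even for
    -- `d = 0`.
    fw X : ℕ
    fw = field-words K n w
    X = words K n w (n ^ suc d)

    field≤ : n ^ d ≤ n ^ suc d
    field≤ = ≤-trans (≤-reflexive (sym (+-identityʳ (n ^ d)))) (*-monoˡ-≤ (n ^ d) 1≤n)

    fits-field : ∀ {m} → m ≤ n ^ d → words K n w m ≤ X
    fits-field m≤ = words-mono K n w (≤-trans m≤ field≤)

    fits-length : ∀ {m} → m ≤ n → words K n w m ≤ X
    fits-length m≤ = words-mono K n w (≤-trans m≤ (≤-trans (≤-reflexive (sym (*-identityʳ n))) (*-monoʳ-≤ n (m>0 d))))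
      where
      m>0 : ∀ e → 1 ≤ n ^ e
      m>0 zero    = ≤-refl
      m>0 (suc e) = *-mono-≤ 1≤n (m>0 e)

    fw≤X : fw ≤ X
    fw≤X = fits-field ≤-refl

  -- A group is nonempty, so its own `4 * X` words can be charged to its elements, which take
  -- `5 * X` each.
  order-bound : ∀ {G xs} → Maintains (n ^ d) G xs → orderWords K n w G ≤ length xs * (9 * X)
  order-bound {G} {xs} maintains = begin
    orderWords K n w G ≤⟨ sum-mono (All.zipWith (λ { (p , q) → group p q }) (nonempty , tagBound)) ⟩
    sum (map (λ g → length (proj₂ g) * (9 * X)) G) ≡⟨ sum-*ʳ (length ∘ proj₂) (9 * X) G ⟩
    sum (map (length ∘ proj₂) G) * (9 * X) ≡⟨ cong (λ ms → sum ms * (9 * X)) (map-cong (λ g → sym (length-map proj₂ (proj₂ g))) G) ⟩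
    sum (map (length ∘ members) G) * (9 * X) ≡⟨ cong (_* (9 * X)) (length-concatMap members G) ⟨
    length (concatMap members G) * (9 * X) ≡⟨ cong (λ ys → length ys * (9 * X)) elements ⟩
    length xs * (9 * X) ∎
    where
    open ≤-Reasoning hiding (start)
    open Maintains maintains
    group : ∀ {tag} {es : List (ℕ × Node)} → 1 ≤ length es → tag ≤ n ^ d × All (λ e → proj₁ e ≤ n ^ d) es →
            words K n w tag + 3 * fw + sum (map (λ e → words K n w (proj₁ e) + 4 * fw) es) ≤ length es * (9 * X)
    group {tag} {es} 1≤ (t≤ , es≤) = begin
      words K n w tag + 3 * fw + sum (map (λ e → words K n w (proj₁ e) + 4 * fw) es)
        ≤⟨ +-mono-≤ (+-mono-≤ (fits-field t≤) (*-monoʳ-≤ 3 fw≤X)) (sum-bound {c = 5 * X} (All.map (λ e≤ → +-mono-≤ (fits-field e≤) (*-monoʳ-≤ 4 fw≤X)) es≤)) ⟩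
      (X + 3 * X) + length es * (5 * X) ≤⟨ +-monoˡ-≤ (length es * (5 * X)) (≤-trans (≤-reflexive (sym (*-identityˡ (X + 3 * X)))) (*-monoˡ-≤ (X + 3 * X) 1≤)) ⟩
      length es * (X + 3 * X) + length es * (5 * X) ≡⟨ lem (length es) X ⟩
      length es * (9 * X) ∎
      where
      lem : ∀ l X → l * (X + 3 * X) + l * (5 * X) ≡ l * (9 * X)
      lem = solve-∀

  module _ {δ : ℕ} {D : DBWT} (1≤δ : 1 ≤ δ) (δ≤n : δ ≤ n)
           (expands : expand D ≡ map (Text.chr T 2≤n input δ) (Text.rows T 2≤n input δ)) (positive : All (λ R → 1 ≤ len R) D) where

    open Text T 2≤n input

    private
      Ps : List Piece
      Ps = pieces D

      k : ℕ
      k = length Ps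

      located′ : ∀ {P} → P ∈ Ps → Located 1≤δ δ≤n expands positive P
      located′ = located 1≤δ δ≤n expands positive

      node≤ : ∀ {P x} → P ∈ Ps → nodeWords K n w (x , rep P) ≤ 5 * X
      node≤ P∈ = ≤-trans (+-mono-≤ (+-mono-≤ (fits-field (char-≤ 1≤δ δ≤n expands positive P∈)) (fits-length (≤-trans (Located.len≤ (located′ P∈)) δ≤n))) (*-monoʳ-≤ 3 fw≤X))
                   (≤-reflexive (lem X))
        where
        lem : ∀ X → X + X + 3 * X ≡ 5 * X
        lem = solve-∀

      directed≤ : ∀ e → label e ≤ n → directedWords K n w e ≤ 7 * X
      directed≤ e l≤ = +-mono-≤ (fits-length l≤) (*-monoʳ-≤ 6 fw≤X)

    -- Each repetition has two nodes and one undirected edge, and of each kind of directed edges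
    -- there are at most as many as repetitions: `2 * 5 + 2 + 2 * 7 = 26`.
    graph-bound : graphWords K n w (LF-intervalGraph T δ D) ≤ k * (26 * X)
    graph-bound = begin
      graphWords K n w (LF-intervalGraph T δ D) ≤⟨ +-mono-≤ (+-mono-≤ nodes-bound undirected-bound) directed-bound ⟩
      (k + k) * (5 * X) + k * (2 * X) + (k + k) * (7 * X) ≡⟨ lem k X ⟩
      k * (26 * X) ∎
      where
      open ≤-Reasoning hiding (start)
      lem : ∀ k X → (k + k) * (5 * X) + k * (2 * X) + (k + k) * (7 * X) ≡ k * (26 * X)
      lem = solve-∀
      us vs : List (Node × Repetition)
      us = map (λ P → u (index P) , rep P) Ps
      vs = map (λ P → v (index P) , rep P) Ps
      nodes-bound : sum (map (nodeWords K n w) (us ++ vs)) ≤ (k + k) * (5 * X)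
      nodes-bound = ≤-trans (sum-bound {f = nodeWords K n w} {5 * X} {us ++ vs} (All.++⁺ (All.map⁺ (All.tabulate λ {P} P∈ → node≤ {P} {u (index P)} P∈)) (All.map⁺ (All.tabulate λ {P} P∈ → node≤ {P} {v (index P)} P∈))))
        (≤-reflexive (cong (_* (5 * X)) (trans (length-++ us) (cong₂ _+_ (length-map _ Ps) (length-map _ Ps)))))
      undirected-bound : length (map (λ P → u (index P) , v (index P)) Ps) * (2 * fw) ≤ k * (2 * X)
      undirected-bound = *-mono-≤ (≤-reflexive (length-map _ Ps)) (*-monoʳ-≤ 2 fw≤X)
      edgeF edgeRep : Piece → Piece → DirectedEdge
      edgeF Q P = record { source = u (index P) ; target = v (index Q) ; label = start P ∸ F-start T δ Q }
      edgeRep P Q = record { source = v (index Q) ; target = u (index P) ; label = F-start T δ Q ∸ start P }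
      intoF : Piece → List DirectedEdge
      intoF Q = map (edgeF Q) (filter (F-covers? T δ Q) Ps)
      intoRep : Piece → List DirectedEdge
      intoRep P = map (edgeRep P) (filter (repCovers? T δ P) Ps)
      labelF : ∀ {Q} → Q ∈ Ps → All (λ e → directedWords K n w e ≤ 7 * X) (intoF Q)
      labelF {Q} _ = All.map⁺ (All.tabulate λ {P} P∈ → directed≤ (edgeF Q P) (≤-trans (m∸n≤m (start P) (F-start T δ Q)) (≤-trans (start-≤ 1≤δ δ≤n expands positive (proj₁ (∈-filter⁻ (F-covers? T δ Q) {xs = Ps} P∈))) δ≤n)))
      labelRep : ∀ {P} → P ∈ Ps → All (λ e → directedWords K n w e ≤ 7 * X) (intoRep P)
      labelRep {P} _ = All.map⁺ (All.tabulate λ {Q} Q∈ → directed≤ (edgeRep P Q) (≤-trans (m∸n≤m (F-start T δ Q) (start P)) (≤-trans (F-start-≤ 1≤δ δ≤n expands positive (proj₁ (∈-filter⁻ (repCovers? T δ P) {xs = Ps} Q∈))) δ≤n)))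
      edge-count : length (concatMap intoF Ps ++ concatMap intoRep Ps) ≤ k + k
      edge-count = ≤-trans (≤-reflexive (length-++ (concatMap intoF Ps))) (+-mono-≤
        (≤-trans (≤-reflexive (trans (length-concatMap intoF Ps) (cong sum (map-cong (λ Q → length-map (edgeF Q) (filter (F-covers? T δ Q) Ps)) Ps)))) (F-edges 1≤δ δ≤n expands positive))
        (≤-trans (≤-reflexive (trans (length-concatMap intoRep Ps) (cong sum (map-cong (λ P → length-map (edgeRep P) (filter (repCovers? T δ P) Ps)) Ps)))) (rep-edges 1≤δ δ≤n expands positive)))
      directed-bound : sum (map (directedWords K n w) (concatMap intoF Ps ++ concatMap intoRep Ps)) ≤ (k + k) * (7 * X)
      directed-bound = ≤-trans (sum-bound {f = directedWords K n w} {7 * X} {concatMap intoF Ps ++ concatMap intoRep Ps} (All.++⁺ (All-concatMap intoF labelF) (All-concatMap intoRep labelRep)))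
        (*-monoˡ-≤ (7 * X) edge-count)

    -- `43 = 26 + 3 + 3 + 9 + 1 + 1`. The factor `suc k` absorbs what is reserved regardless of `k`:
    -- an array header, the root of the tree, the registers.
    storage-bound : ∀ {α S} → Stores K α T δ D S → spaceInWords K n w S ≤ suc k * (43 + slots K + registers K) * X
    storage-bound {α} {S} stores = begin
      spaceInWords K n w S
        ≤⟨ +-mono-≤ (+-mono-≤ (+-mono-≤ (+-mono-≤ (+-mono-≤ (+-mono-≤ (+-mono-≤ graph≤ u-list≤) v-list≤) order≤) heavyReps≤) heavyFs≤) tree≤) registers≤ ⟩
      suc k * (26 * X) + suc k * (3 * X) + suc k * (3 * X) + suc k * (9 * X) + suc k * X + suc k * X + suc k * (slots K * X) + suc k * (registers K * X)
        ≡⟨ lem (suc k) X (slots K) (registers K) ⟩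
      suc k * (43 + slots K + registers K) * X ∎
      where
      open ≤-Reasoning hiding (start)
      open Stores stores
      lem : ∀ j X c g → j * (26 * X) + j * (3 * X) + j * (3 * X) + j * (9 * X) + j * X + j * X + j * (c * X) + j * (g * X) ≡ j * (43 + c + g) * X
      lem = solve-∀
      k≤ : k ≤ suc k
      k≤ = n≤1+n k
      graph≤ : graphWords K n w (graph S) ≤ suc k * (26 * X)
      graph≤ = ≤-trans (≤-reflexive (cong (graphWords K n w) graph≡)) (≤-trans graph-bound (*-monoˡ-≤ (26 * X) k≤))
      linked≤ : ∀ xs → length xs ≡ k → linkedListWords K n w xs ≤ suc k * (3 * X)
      linked≤ xs e = *-mono-≤ (≤-trans (≤-reflexive e) k≤) (*-monoʳ-≤ 3 fw≤X)
      u-list≤ : linkedListWords K n w (u-list S) ≤ suc k * (3 * X)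
      u-list≤ = linked≤ (u-list S) (trans (cong length u-list≡) (length-map _ Ps))
      v-list≤ : linkedListWords K n w (v-list S) ≤ suc k * (3 * X)
      v-list≤ = linked≤ (v-list S) (trans (cong length (proj₂ (proj₂ (proj₂ v-list≡)))) (trans (length-map _ (proj₁ v-list≡)) (↭-length (proj₁ (proj₂ v-list≡)))))
      order≤ : orderWords K n w (order S) ≤ suc k * (9 * X)
      order≤ = ≤-trans (order-bound order≡) (*-monoˡ-≤ (9 * X) (≤-trans (≤-reflexive (length-map _ Ps)) k≤))
      heavyReps≤ : arrayWords K n w (heavyReps S) ≤ suc k * X
      heavyReps≤ = *-mono-≤ (s≤s (≤-trans (≤-reflexive (trans (↭-length heavyReps≡) (length-map (u ∘ index) (filter (heavyRep? T δ D α) Ps)))) (length-filter (heavyRep? T δ D α) Ps))) fw≤X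
      heavyFs≤ : arrayWords K n w (heavyFs S) ≤ suc k * X
      heavyFs≤ = *-mono-≤ (s≤s (≤-trans (≤-reflexive (trans (↭-length heavyFs≡) (length-map (v ∘ index) (filter (heavyF? T δ D α) Ps)))) (length-filter (heavyF? T δ D α) Ps))) fw≤X
      tree≤ : treeWords K n w (tree S) ≤ suc k * (slots K * X)
      tree≤ = *-mono-≤ (≤-trans (IsBTree-size (minDegree≥2 K) isBTree)
          (s≤s (≤-trans (≤-reflexive (trans (↭-length entries) (length-map entry (filter (indexed? D) Ps)))) (length-filter (indexed? D) Ps)))) (*-monoʳ-≤ (slots K) fw≤X)
      registers≤ : registers K * fw ≤ suc k * (registers K * X)
      registers≤ = ≤-trans (*-monoʳ-≤ (registers K) fw≤X) (m≤m+n _ _)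

  space-bound : ∀ {α S} → 16 ≤ α → WordSize K n w → Occurs K α T S →
                spaceInBits K n w S ≤ 16 * (43 + slots K + registers K) * (wordFactor K + 2 * suc d) * (runs T * ⌊log₂ n ⌋)
  space-bound {α} {S} 16≤α size (φ , δ , D , s , reached , stores) = begin
    w * spaceInWords K n w S ≤⟨ *-monoʳ-≤ w (storage-bound 1≤δ δ≤n expands positive stores) ⟩
    w * (suc k * G * X) ≡⟨ lem₁ w (suc k * G) X ⟩
    suc k * G * (w * X) ≤⟨ *-mono-≤ (*-monoˡ-≤ G pieces≤) bits≤ ⟩
    16 * runs T * G * ((wordFactor K + 2 * suc d) * ⌊log₂ n ⌋) ≡⟨ lem₂ (runs T) G (wordFactor K + 2 * suc d) ⌊log₂ n ⌋ ⟩
    16 * G * (wordFactor K + 2 * suc d) * (runs T * ⌊log₂ n ⌋) ∎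
    where
    open ≤-Reasoning hiding (start)
    open Text T 2≤n input using (ch; rows-head; Facts; reached-facts; runs≡)
    open Facts (reached-facts 16≤α reached)
    G k : ℕ
    G = 43 + slots K + registers K
    k = length (pieces D)
    lem₁ : ∀ w a X → w * (a * X) ≡ a * (w * X)
    lem₁ = solve-∀
    lem₂ : ∀ r G c l → 16 * r * G * (c * l) ≡ 16 * G * c * (r * l)
    lem₂ = solve-∀
    1≤runs : 1 ≤ runs T
    1≤runs = ≤-trans (≤-trans (s≤s z≤n) (≤-reflexive (sym (trans (cong (runCount ∘ map ch) (proj₂ (rows-head 1≤n ≤-refl))) (runCount-∷ (ch 1) (map ch (proj₁ (rows-head 1≤n ≤-refl)))))))) (≤-reflexive (sym runs≡))
    pieces≤ : suc k ≤ 16 * runs T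
    pieces≤ = begin
      suc k ≡⟨ cong suc (length-pieces D) ⟩
      suc (length D) ≤⟨ s≤s few ⟩
      6 + 10 * runs T ≤⟨ +-monoˡ-≤ (10 * runs T) (*-monoʳ-≤ 6 1≤runs) ⟩
      6 * runs T + 10 * runs T ≡⟨ *-distribʳ-+ (runs T) 6 10 ⟨
      16 * runs T ∎
    -- Rounding up to whole words wastes at most `w` bits, and `w` is `O(log n)` by the upper bound
    -- on the word size.
    bits≤ : w * X ≤ (wordFactor K + 2 * suc d) * ⌊log₂ n ⌋
    bits≤ = begin
      w * X ≤⟨ words-bits K n w (n ^ suc d) ⟩
      w + ⌊log₂ n ^ suc d ⌋ ≤⟨ +-mono-≤ (WordSize.upper size) (log-^ (suc d) 2≤n) ⟩
      wordFactor K * ⌊log₂ n ⌋ + (2 * suc d) * ⌊log₂ n ⌋ ≡⟨ *-distribʳ-+ ⌊log₂ n ⌋ (wordFactor K) (2 * suc d) ⟨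
      (wordFactor K + 2 * suc d) * ⌊log₂ n ⌋ ∎

theorem21 : (α : ℕ) → 16 ≤ α → (K : Constants) →
    ∃[ C ] ((n w : ℕ) → .{{_ : NonZero w}} → 2 ≤ n → WordSize K n w →
    (T : Text n) → IsInput (numberExp K) n T →
    (S : Storage) → Occurs K α T S →
    spaceInBits K n w S ≤ C * (runs T * ⌊log₂ n ⌋))
theorem21 α 16≤α K = 16 * (43 + slots K + registers K) * (wordFactor K + 2 * suc (numberExp K))
  , λ n w 2≤n size T input S occurs → SpaceBound.space-bound K w 2≤n T input 16≤α size occurs
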